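{- Let $SC(a,a,b)$ be the number of lozenge tilings of the hexagon $H(a,a,b)$ that are invariant under rotation by $180^\circ$ around its center, and let $$PP(a,b,c)=\prod_{i=1}^{a}\prod_{j=1}^{b}\prod_{k=1}^{c}\frac{i+j+k-1}{i+j+k-2}.$$ Then for all positive integers $x,y$, $$SC(2x,2x,2y)=PP(x,x,y)^2,$$ $$SC(2x,2x,2y+1)=PP(x,x,y)\,PP(x,x,y+1),$$ $$SC(2x+1,2x+1,2y)=PP(x,x+1,y)^2.$$
   Context: Work in the regular triangular lattice with unit side. $H(a,b,c)$ is the lattice hexagon with all angles $120^\circ$ and side lengths $a,b,c,a,b,c$ in cyclic order. A lozenge is a unit rhombus that is the union of two unit triangles of the lattice sharing an edge; a lozenge tiling of the hexagon is a covering of it by lozenges contained in it, without gaps or overlaps. (Tilings invariant under rotation by $180^\circ$ correspond to self-complementary plane partitions; $PP(a,b,c)$ is MacMahon's product for the number of plane partitions contained in an $a\times b\times c$ box.) -}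

module Defs where

open import Data.Integer using (+_)
open import Data.List using (List; []; _∷_; _++_; map; filter; length; upTo; foldr; cartesianProduct)
import Data.List.Membership.DecPropositional as DecMembership
open import Data.List.Relation.Unary.All as All using (All)
open import Data.Nat using (ℕ; suc; _+_; _∸_; _≤_; _≤?_; _≟_)
open import Data.Product using (_×_; _,_)
open import Data.Product.Properties using (≡-dec)
open import Data.Rational as ℚ using (ℚ; 1ℚ; _/_)
open import Relation.Binary.Definitions using (DecidableEquality)
open import Relation.Binary.PropositionalEquality using (_≡_; refl)
open import Relation.Nullary using (Dec; yes; no; _×-dec_)
open import Relation.Unary using (Decidable)

-- (p , q) stands for the lattice point p·e₁ + q·e₂, where e₁ and e₂ are unit
-- vectors at an angle of 60°.  Natural coordinates suffice because the
-- hexagon is placed in the sector p, q ≥ 0.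
Point : Set
Point = ℕ × ℕ

_≟ₚ_ : DecidableEquality Point
_≟ₚ_ = ≡-dec _≟_ _≟_

data Orientation : Set where
  △ ▽ : Orientation

_≟ₒ_ : DecidableEquality Orientation
△ ≟ₒ △ = yes refl
△ ≟ₒ ▽ = no λ ()
▽ ≟ₒ △ = no λ ()
▽ ≟ₒ ▽ = yes refl

flip : Orientation → Orientation
flip △ = ▽
flip ▽ = △

-- (△ , p , q) and (▽ , p , q) are the two unit triangles into which the unit
-- parallelogram with lowest corner (p , q) is cut by its short diagonal.
Triangle : Set
Triangle = Orientation × Point

_≟ₜ_ : DecidableEquality Triangle
_≟ₜ_ = ≡-dec _≟ₒ_ _≟ₚ_

vertices : Triangle → List Point
vertices (△ , p , q) = (p , q)         ∷ (suc p , q) ∷ (p , suc q) ∷ []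
vertices (▽ , p , q) = (suc p , suc q) ∷ (p , suc q) ∷ (suc p , q) ∷ []

module _ where
  open DecMembership _≟ₚ_ using (_∈?_)

  SharesEdge : Triangle → Triangle → Set
  SharesEdge s t = length (filter (_∈? vertices t) (vertices s)) ≡ 2

  sharesEdge? : ∀ s t → Dec (SharesEdge s t)
  sharesEdge? s t = length (filter (_∈? vertices t) (vertices s)) ≟ 2

-- Two triangles sharing an edge have opposite orientations.  A lozenge is
-- recorded as the pair of its two triangles, the ▽ first, so that every
-- lozenge has exactly one representation.
Lozenge : Set
Lozenge = Triangle × Triangle

_≟ₗ_ : DecidableEquality Lozenge
_≟ₗ_ = ≡-dec _≟ₜ_ _≟ₜ_

triangles : Lozenge → List Triangle
triangles (s , t) = s ∷ t ∷ []

open DecMembership _≟ₜ_ using () renaming (_∈?_ to _∈ₜ?_)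
open DecMembership _≟ₗ_ using (_∈_) renaming (_∈?_ to _∈ₗ?_)

module Hexagon (a b c : ℕ) where

  -- H(a,b,c) with corners, counterclockwise,
  --   (c , 0), (a + c , 0), (a + c , b), (a , b + c), (0 , b + c), (0 , c);
  -- its sides have directions e₁, e₂, e₂ - e₁, -e₁, -e₂, e₁ - e₂ and
  -- lengths a, b, c, a, b, c.
  InHexagon : Point → Set
  InHexagon (p , q) = p ≤ a + c × q ≤ b + c × c ≤ p + q × p + q ≤ a + b + c

  inHexagon? : Decidable InHexagon
  inHexagon? (p , q) =
    (p ≤? a + c) ×-dec (q ≤? b + c) ×-dec (c ≤? p + q) ×-dec (p + q ≤? a + b + c)

  -- By convexity, a triangle lies in the hexagon iff its vertices do.
  trianglesOf : Orientation → List Triangle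
  trianglesOf o =
    filter (λ t → All.all? inHexagon? (vertices t))
      (map (o ,_) (cartesianProduct (upTo (a + c)) (upTo (b + c))))

  allTriangles : List Triangle
  allTriangles = trianglesOf △ ++ trianglesOf ▽

  allLozenges : List Lozenge
  allLozenges =
    filter (λ (s , t) → sharesEdge? s t)
      (cartesianProduct (trianglesOf ▽) (trianglesOf △))

  -- The rotation by 180° around the center sends the point (p , q) to
  -- (a + c - p , b + c - q), hence a triangle to one of the opposite
  -- orientation.  On triangles of the hexagon no subtraction is truncated.
  rotateTriangle : Triangle → Triangle
  rotateTriangle (o , p , q) = flip o , (a + c) ∸ suc p , (b + c) ∸ suc q

  rotate : Lozenge → Lozenge
  rotate (s , t) = rotateTriangle t , rotateTriangle s

  covering : Triangle → List Lozenge → List Lozenge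
  covering t = filter (λ l → t ∈ₜ? triangles l)

  -- Sets of lozenges of the hexagon are represented by sublists of
  -- allLozenges.
  IsTiling : List Lozenge → Set
  IsTiling T = All (λ t → length (covering t T) ≡ 1) allTriangles

  IsInvariant : List Lozenge → Set
  IsInvariant T = All (_∈ T) (map rotate T) × All (_∈ map rotate T) T

  isTiling? : Decidable IsTiling
  isTiling? T = All.all? (λ t → length (covering t T) ≟ 1) allTriangles

  isInvariant? : Decidable IsInvariant
  isInvariant? T =
    All.all? (_∈ₗ? T) (map rotate T) ×-dec All.all? (_∈ₗ? map rotate T) T

-- As allLozenges has no repetitions, each of its subsets is listed once.
sublists : ∀ {A : Set} → List A → List (List A)
sublists []       = [] ∷ []
sublists (x ∷ xs) = map (x ∷_) (sublists xs) ++ sublists xs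

SC : ℕ → ℕ → ℕ → ℕ
SC a b c =
  length (filter (λ T → isTiling? T ×-dec isInvariant? T) (sublists allLozenges))
  where open Hexagon a b c

∏[<_]_ : ℕ → (ℕ → ℚ) → ℚ
∏[< n ] f = foldr ℚ._*_ 1ℚ (map f (upTo n))

-- The indices run from 0 instead of 1, so that i + j + k - 1 and
-- i + j + k - 2 become i + j + k + 2 and i + j + k + 1.
PP : ℕ → ℕ → ℕ → ℚ
PP a b c =
  ∏[< a ] λ i → ∏[< b ] λ j → ∏[< c ] λ k →
    + suc (suc (i + j + k)) / suc (i + j + k)

fromℕ : ℕ → ℚ
fromℕ n = + n / 1

{-# OPTIONS --safe #-}
module Submission where

-- The lines p + q = const cut the hexagon H(a,a,c) into strips.  Recording the
-- lozenges crossed by the lines turns a tiling of the lower half into a chain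
-- of interlacing rows, and a tiling invariant under the rotation is such a
-- chain whose top row, on the line through the center, is a palindrome.  By
-- induction along the chain, the number of chains below a row with a marked
-- positions t₁, …, tₐ is a determinant of falling factorials, that is
-- ∏ᵢ<ⱼ (tᵢ - tⱼ) / ∏ᵢ<ₐ i!.
--
-- For a palindromic row this Vandermonde product is the product of weights and
-- of squared differences of the nodes s (s + γ), where s enumerates the marked
-- positions on one side of the center.  The sum over all palindromic rows is
-- therefore a discrete Selberg integral on a quadratic lattice; it is the
-- product of the squared norms of the orthogonal polynomials on that lattice,
-- and comparing these norms with the ratios of consecutive PP(a,b,c) gives the
-- three formulas.

open import Defs
open import Data.Bool as Bool using (Bool; true; false; not; if_then_else_; _∨_)
open import Data.Empty using (⊥)
open import Data.Integer as ℤ using (ℤ; 0ℤ; 1ℤ; -1ℤ) renaming (+_ to int)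
import Data.Integer.Properties as ℤₚ
open import Data.Integer.Tactic.RingSolver using (solve-∀)
open import Data.List
  using (List; []; _∷_; _++_; [_]; map; length; filter; concatMap; foldr; upTo; downFrom; cartesianProduct)
import Data.List.Membership.DecPropositional as DecMembership
open import Data.List.Membership.Propositional using (_∈_; _∉_; find; lose)
open import Data.List.Membership.Propositional.Properties
  using (∈-map⁺; ∈-map⁻; ∈-++⁺ˡ; ∈-++⁺ʳ; ∈-++⁻; ∈-filter⁺; ∈-filter⁻; ∈-upTo⁺;
         ∈-cartesianProduct⁺; ∈-cartesianProduct⁻; ∈-concatMap⁺; ∈-concatMap⁻)
open import Data.List.Membership.Propositional.Properties.WithK using (unique∧set⇒bag)
open import Data.List.Properties using (length-map; length-++; map-applyUpTo; ∷-injectiveʳ)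
open import Data.List.Relation.Binary.BagAndSetEquality using (∼bag⇒↭)
open import Data.List.Relation.Binary.Permutation.Propositional.Properties using (↭-length)
open import Data.List.Relation.Unary.All as All using (All; []; _∷_)
open import Data.List.Relation.Unary.All.Properties as Allₚ using (All¬⇒¬Any; ¬Any⇒All¬)
open import Data.List.Relation.Unary.AllPairs using ([]; _∷_)
open import Data.List.Relation.Unary.Any using (here; there)
open import Data.List.Relation.Unary.Unique.Propositional using (Unique)
import Data.List.Relation.Unary.Unique.Propositional.Properties as Uniqueₚ
open import Data.Nat as ℕ using (ℕ; zero; suc; _∸_; _!; _<_; _≤_; _<?_; _≟_; z≤n; s≤s)
import Data.Nat.Properties as ℕₚ
open import Data.Nat.Tactic.RingSolver using () renaming (solve-∀ to solveℕ)
open import Data.Product using (∃; _×_; _,_; proj₁; proj₂)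
open import Data.Rational as ℚ using (ℚ; 1ℚ; _/_)
import Data.Rational.Properties as ℚₚ
open import Data.Rational.Unnormalised as ℚᵘ using (mkℚᵘ; *≡*)
import Data.Rational.Unnormalised.Properties as ℚᵘₚ
open import Data.Sum using (_⊎_; inj₁; inj₂)
open import Data.Unit using (⊤; tt)
open import Data.Vec using (Vec; []; _∷_; _∷ʳ_)
open import Data.Vec.Properties using (∷-injectiveˡ; ∷ʳ-injective) renaming (∷-injectiveʳ to ∷ᵥ-injectiveʳ)
open import Function using (_∘_; id; mk⇔)
open import Level using (0ℓ)
open import Relation.Binary.PropositionalEquality
  using (_≡_; _≢_; refl; sym; trans; cong; cong₂; subst; module ≡-Reasoning)
open import Relation.Nullary using (Dec; yes; no; does; contradiction; _×-dec_)
open import Relation.Nullary.Decidable using (dec-true; dec-false)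
open import Relation.Unary using (Pred; Decidable)
open ≡-Reasoning

-- Falling factorials replace powers throughout. Being monic, they give the same Vandermonde
-- determinant, and their forward differences are again multiples of falling factorials, so that
-- summing over an interlacing row telescopes exactly in every column.
--
-- The orthogonal polynomials are never paired with each other. It is enough to pair them with
-- polynomials vanishing at the right-hand nodes: the mutual pairing of the Newton bases at the two
-- ends is an explicit product, because the weight times a left-hand Newton polynomial has a closed
-- antidifference. The parameters `γ`, `e`, `κ`, `κ′` record just this. In each of the three cases
-- the weight has degree `2e + 1`, and `n * κ n` is `1 + e` times the sum of the first `n` weights.
--
-- Only the quotient of the sums for `k + 1` and for `k` symmetric pairs is computed; the products
-- then follow by induction on `k`. Divisions are avoided: every identity is multiplied out over the
-- integers, and factors are cancelled only where they are known to be nonzero, such as factorials,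
-- superfactorials and `grid a b 1ℤ`.

module IntegerSums where

  infixl 6 _+_ _-_
  infixl 7 _*_

  -- Opaque copies keep integer expressions neutral, so that unification treats
  -- the operations as injective and never evaluates them.
  opaque
    _+_ _-_ _*_ : ℤ → ℤ → ℤ
    _+_ = ℤ._+_
    _-_ = ℤ._-_
    _*_ = ℤ._*_

  opaque
    unfolding _+_
    +-identityˡ : ∀ a → 0ℤ + a ≡ a
    +-identityˡ = solve-∀
    +-identityʳ : ∀ a → a + 0ℤ ≡ a
    +-identityʳ = solve-∀
    +-assoc : ∀ a b c → a + b + c ≡ a + (b + c)
    +-assoc = solve-∀
    +-comm : ∀ a b → a + b ≡ b + a
    +-comm = solve-∀
    -‿identityʳ : ∀ a → a - 0ℤ ≡ a
    -‿identityʳ = solve-∀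
    -‿self : ∀ a → a - a ≡ 0ℤ
    -‿self = solve-∀
    *-zeroˡ : ∀ a → 0ℤ * a ≡ 0ℤ
    *-zeroˡ = solve-∀
    *-zeroʳ : ∀ a → a * 0ℤ ≡ 0ℤ
    *-zeroʳ = solve-∀
    *-identityˡ : ∀ a → 1ℤ * a ≡ a
    *-identityˡ = solve-∀
    *-identityʳ : ∀ a → a * 1ℤ ≡ a
    *-identityʳ = solve-∀
    *-assoc : ∀ a b c → a * b * c ≡ a * (b * c)
    *-assoc = solve-∀
    *-comm : ∀ a b → a * b ≡ b * a
    *-comm = solve-∀
    *-distribˡ-+ : ∀ a b c → a * (b + c) ≡ a * b + a * c
    *-distribˡ-+ = solve-∀
    *-distribʳ-+ : ∀ a b c → (b + c) * a ≡ b * a + c * a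
    *-distribʳ-+ = solve-∀
    *-distribˡ-- : ∀ a b c → a * (b - c) ≡ a * b - a * c
    *-distribˡ-- = solve-∀
    [a+b]-[c+d] : ∀ a b c d → a + b - (c + d) ≡ (a - c) + (b - d)
    [a+b]-[c+d] = solve-∀
    a*[b*c]≡b*[a*c] : ∀ a b c → a * (b * c) ≡ b * (a * c)
    a*[b*c]≡b*[a*c] = solve-∀

  opaque
    unfolding _+_

    i*j≡0⇒i≡0∨j≡0 : ∀ i {j} → i * j ≡ 0ℤ → i ≡ 0ℤ ⊎ j ≡ 0ℤ
    i*j≡0⇒i≡0∨j≡0 i = ℤₚ.i*j≡0⇒i≡0∨j≡0 i

    i-j≡0⇒i≡j : ∀ i j → i - j ≡ 0ℤ → i ≡ j
    i-j≡0⇒i≡j = ℤₚ.i-j≡0⇒i≡j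

    int-+ : ∀ m n → int (m ℕ.+ n) ≡ int m + int n
    int-+ m n = refl

    int-* : ∀ m n → int (m ℕ.* n) ≡ int m * int n
    int-* = ℤₚ.pos-*

  *-cancelˡ : ∀ k {i j} → k ≢ 0ℤ → k * i ≡ k * j → i ≡ j
  *-cancelˡ k {i} {j} k≢0 eq with i*j≡0⇒i≡0∨j≡0 k {i - j}
    (trans (*-distribˡ-- k i j) (trans (cong (_- k * j) eq) (-‿self (k * j))))
  ... | inj₁ k≡0   = contradiction k≡0 k≢0
  ... | inj₂ i-j≡0 = i-j≡0⇒i≡j i j i-j≡0

  -- Alternating sums, determinants and Lagrange interpolation

  module _ {A : Set} where

    -- Laplace expansion with an arbitrary summand. Both `det` and `lagrange` are instances, which
    -- is what links determinants to interpolation.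
    alternatingSum : (A → List A → ℤ) → List A → ℤ
    alternatingSum g []       = 0ℤ
    alternatingSum g (x ∷ xs) = g x xs - alternatingSum (λ y R → g y (x ∷ R)) xs

    data Pick (x : A) : List A → List A → Set where
      here  : ∀ {xs} → Pick x xs (x ∷ xs)
      there : ∀ {y R xs} → Pick x R xs → Pick x (y ∷ R) (y ∷ xs)

    pick-length : ∀ {x R xs} → Pick x R xs → length xs ≡ suc (length R)
    pick-length here      = refl
    pick-length (there p) = cong suc (pick-length p)

    pick-all : ∀ {P : A → Set} {x R xs} → Pick x R xs → All P xs → P x × All P R
    pick-all here      (px ∷ pxs) = px , pxs
    pick-all (there p) (py ∷ pxs) = proj₁ (pick-all p pxs) , py ∷ proj₂ (pick-all p pxs)

    alt-cong : ∀ {g h : A → List A → ℤ} xs → (∀ {x R} → Pick x R xs → g x R ≡ h x R) →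
      alternatingSum g xs ≡ alternatingSum h xs
    alt-cong []       eq = refl
    alt-cong (x ∷ xs) eq = cong₂ _-_ (eq here) (alt-cong xs (eq ∘ there))

    alt-zero : ∀ {g : A → List A → ℤ} xs → (∀ {x R} → Pick x R xs → g x R ≡ 0ℤ) →
      alternatingSum g xs ≡ 0ℤ
    alt-zero []       eq = refl
    alt-zero (x ∷ xs) eq = trans (cong₂ _-_ (eq here) (alt-zero xs (eq ∘ there))) (-‿self 0ℤ)

    alt-+ : ∀ (g h : A → List A → ℤ) xs →
      alternatingSum (λ x R → g x R + h x R) xs ≡ alternatingSum g xs + alternatingSum h xs
    alt-+ g h []       = sym (+-identityˡ 0ℤ)
    alt-+ g h (x ∷ xs) = trans
      (cong (λ s → g x xs + h x xs - s) (alt-+ (λ y R → g y (x ∷ R)) (λ y R → h y (x ∷ R)) xs))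
      ([a+b]-[c+d] _ _ _ _)

    alt-* : ∀ k (g : A → List A → ℤ) xs →
      alternatingSum (λ x R → k * g x R) xs ≡ k * alternatingSum g xs
    alt-* k g []       = sym (*-zeroʳ k)
    alt-* k g (x ∷ xs) = trans
      (cong (λ s → k * g x xs - s) (alt-* k (λ y R → g y (x ∷ R)) xs))
      (sym (*-distribˡ-- k _ _))

    alt-add : ∀ {x y z : A} (g : A → List A → ℤ) →
      (∀ R → g z R ≡ g x R + g y R) →
      (∀ c pre post → g c (pre ++ z ∷ post) ≡ g c (pre ++ x ∷ post) + g c (pre ++ y ∷ post)) →
      ∀ pre post → alternatingSum g (pre ++ z ∷ post) ≡
        alternatingSum g (pre ++ x ∷ post) + alternatingSum g (pre ++ y ∷ post)
    alt-add {x} {y} {z} g hd tl [] post = begin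
      g z post - alternatingSum (λ c R → g c (z ∷ R)) post
        ≡⟨ cong₂ _-_ (hd post) (trans (alt-cong post (λ {c} {R} _ → tl c [] R))
             (alt-+ (λ c R → g c (x ∷ R)) (λ c R → g c (y ∷ R)) post)) ⟩
      (g x post + g y post) -
        (alternatingSum (λ c R → g c (x ∷ R)) post + alternatingSum (λ c R → g c (y ∷ R)) post)
        ≡⟨ [a+b]-[c+d] _ _ _ _ ⟩
      _ ∎
    alt-add {x} {y} {z} g hd tl (c ∷ pre) post = trans
      (cong₂ _-_ (tl c pre post)
        (alt-add (λ y R → g y (c ∷ R)) (hd ∘ (c ∷_)) (λ d pre → tl d (c ∷ pre)) pre post))
      ([a+b]-[c+d] _ _ _ _)

    -- The two terms that choose one of the equal neighbours leave the same list and carry opposite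
    -- signs; every other term keeps both neighbours, where `g` vanishes.
    alt-alternating : ∀ {x : A} (g : A → List A → ℤ) →
      (∀ c pre post → g c (pre ++ x ∷ x ∷ post) ≡ 0ℤ) →
      ∀ pre post → alternatingSum g (pre ++ x ∷ x ∷ post) ≡ 0ℤ
    alt-alternating {x} g vanish [] post
      rewrite alt-zero {g = λ c R → g c (x ∷ x ∷ R)} post (λ {c} {R} _ → vanish c [] R)
      = lemma (g x (x ∷ post))
      where
      opaque
        unfolding _+_
        lemma : ∀ a → a - (a - 0ℤ) ≡ 0ℤ
        lemma = solve-∀
    alt-alternating g vanish (c ∷ pre) post
      = trans (cong₂ _-_ (vanish c pre post)
          (alt-alternating (λ y R → g y (c ∷ R)) (λ d pre → vanish d (c ∷ pre)) pre post))
        (-‿self 0ℤ)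

    alt-snoc : ∀ {P : A → Set} {x : A} (g : A → List A → ℤ) →
      (∀ R → All P R → g x R ≡ 0ℤ) → ∀ xs → All P xs →
      alternatingSum g (xs ++ [ x ]) ≡ alternatingSum (λ y R → g y (R ++ [ x ])) xs
    alt-snoc g vanish []       []         = trans (cong (_- 0ℤ) (vanish [] [])) (-‿self 0ℤ)
    alt-snoc g vanish (y ∷ xs) (py ∷ pxs) =
      cong (λ s → g y (xs ++ _) - s)
        (alt-snoc (λ z R → g z (y ∷ R)) (λ R pR → vanish (y ∷ R) (py ∷ pR)) xs pxs)

  alt-map : ∀ {A B : Set} (f : A → B) (g : B → List B → ℤ) xs →
    alternatingSum g (map f xs) ≡ alternatingSum (λ x R → g (f x) (map f R)) xs
  alt-map f g []       = refl
  alt-map f g (x ∷ xs) = cong (λ s → g (f x) (map f xs) - s) (alt-map f (λ y R → g y (f x ∷ R)) xs)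

  Column : Set
  Column = ℕ → ℤ

  -- The expansion starts from the last row with sign +, so that the Vandermonde
  -- determinant is the product of xᵢ - xⱼ over i < j.
  det : ℕ → List Column → ℤ
  det zero    []      = 1ℤ
  det zero    (_ ∷ _) = 0ℤ
  det (suc n) cs      = alternatingSum (λ c R → c n * det n R) cs

  -- `Φ` stays abstract because the induction over interlacing rows freezes leading columns, which
  -- turns a determinant into another multiadditive function.
  record Multiadditive (Φ : List Column → ℤ) : Set where
    constructor multiadditive
    field
      additive : ∀ {x y z} → (∀ k → z k ≡ x k + y k) → ∀ pre post →
        Φ (pre ++ z ∷ post) ≡ Φ (pre ++ x ∷ post) + Φ (pre ++ y ∷ post)

  record Alternating (Φ : List Column → ℤ) : Set where
    constructor alternating
    field
      vanishes : ∀ x pre post → Φ (pre ++ x ∷ x ∷ post) ≡ 0ℤ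

  open Multiadditive public
  open Alternating public

  det-multiadditive : ∀ n → Multiadditive (det n)
  det-multiadditive zero .additive eq []        post = sym (+-identityˡ 0ℤ)
  det-multiadditive zero .additive eq (_ ∷ pre) post = sym (+-identityˡ 0ℤ)
  det-multiadditive (suc n) .additive eq pre post = alt-add _
    (λ R → trans (cong (_* det n R) (eq n)) (*-distribʳ-+ (det n R) _ _))
    (λ c pre post → trans (cong (c n *_) (det-multiadditive n .additive eq pre post))
      (*-distribˡ-+ (c n) _ _))
    pre post

  det-alternating : ∀ n → Alternating (det n)
  det-alternating zero .vanishes x []        post = refl
  det-alternating zero .vanishes x (_ ∷ pre) post = refl
  det-alternating (suc n) .vanishes x = alt-alternating _
    λ c pre post → trans (cong (c n *_) (det-alternating n .vanishes x pre post)) (*-zeroʳ (c n))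

  module _ {Φ : List Column → ℤ} (add : Multiadditive Φ) where

    zeroColumn : ∀ {z} → (∀ k → z k ≡ 0ℤ) → ∀ pre post → Φ (pre ++ z ∷ post) ≡ 0ℤ
    zeroColumn z≡0 pre post =
      self (add .additive (λ k → trans (z≡0 k) (sym (trans (cong₂ _+_ (z≡0 k) (z≡0 k)) (+-identityˡ 0ℤ)))) pre post)
      where
      opaque
        unfolding _+_
        lemma : ∀ a → a + a - a ≡ a
        lemma = solve-∀
      self : ∀ {a} → a ≡ a + a → a ≡ 0ℤ
      self {a} eq = trans (sym (lemma a)) (trans (cong (_- a) (sym eq)) (-‿self a))

    subtractNext : Alternating Φ → ∀ {x y z} → (∀ k → z k ≡ x k - y k) → ∀ post →
      Φ (x ∷ y ∷ post) ≡ Φ (z ∷ y ∷ post)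
    subtractNext alt {x} {y} {z} eq post = begin
      Φ (x ∷ y ∷ post)
        ≡⟨ add .additive (λ k → trans (sym (lemma (x k) (y k))) (cong (_+ y k) (sym (eq k)))) [] (y ∷ post) ⟩
      Φ (z ∷ y ∷ post) + Φ (y ∷ y ∷ post)
        ≡⟨ cong (Φ (z ∷ y ∷ post) +_) (alt .vanishes y [] post) ⟩
      Φ (z ∷ y ∷ post) + 0ℤ
        ≡⟨ +-identityʳ _ ⟩
      Φ (z ∷ y ∷ post) ∎
      where
      opaque
        unfolding _+_
        lemma : ∀ a b → a - b + b ≡ a
        lemma = solve-∀

  -- Thanks to this, sums of determinants may run over all rows: those with a wrong number of marks
  -- drop out by themselves.
  det-wrongSize : ∀ n cs → length cs ≢ n → det n cs ≡ 0ℤ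
  det-wrongSize zero    []       l≢ = contradiction refl l≢
  det-wrongSize zero    (_ ∷ _)  l≢ = refl
  det-wrongSize (suc n) cs       l≢ = alt-zero cs λ {c} {R} p →
    trans (cong (c n *_) (det-wrongSize n R (λ eq → l≢ (trans (pick-length p) (cong suc eq)))))
      (*-zeroʳ (c n))

  det-zeroRow : ∀ n cs → All (λ c → c 0 ≡ 0ℤ) cs → det (suc n) cs ≡ 0ℤ
  det-zeroRow zero    cs zs = alt-zero cs λ {c} {R} p →
    trans (cong (_* det 0 R) (proj₁ (pick-all p zs))) (*-zeroˡ _)
  det-zeroRow (suc n) cs zs = alt-zero cs λ {c} {R} p →
    trans (cong (c (suc n) *_) (det-zeroRow n R (proj₂ (pick-all p zs)))) (*-zeroʳ (c (suc n)))

  -- Row 0 is expanded last, so a term survives only if `c` is the column left over. As `c` stands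
  -- at the end, removing it changes no sign.
  det-unitRow : ∀ n cs c → All (λ c → c 0 ≡ 0ℤ) cs → c 0 ≡ 1ℤ →
    det (suc n) (cs ++ [ c ]) ≡ det n (map (_∘ suc) cs)
  det-unitRow zero []       c []        c≡1 =
    trans (-‿identityʳ _) (trans (*-identityʳ (c 0)) c≡1)
  det-unitRow zero (x ∷ xs) c (x≡0 ∷ _) c≡1 = trans
    (cong₂ _-_ (trans (cong (_* det 0 (xs ++ [ c ])) x≡0) (*-zeroˡ _))
      (alt-zero (xs ++ [ c ]) λ {d} _ → *-zeroʳ (d 0)))
    (-‿self 0ℤ)
  det-unitRow (suc n) cs c zs c≡1 = begin
    alternatingSum (λ d R → d (suc n) * det (suc n) R) (cs ++ [ c ])
      ≡⟨ alt-snoc _ (λ R zR → trans (cong (c (suc n) *_) (det-zeroRow n R zR)) (*-zeroʳ (c (suc n)))) cs zs ⟩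
    alternatingSum (λ d R → d (suc n) * det (suc n) (R ++ [ c ])) cs
      ≡⟨ alt-cong cs (λ {d} {R} p → cong (d (suc n) *_) (det-unitRow n R c (proj₂ (pick-all p zs)) c≡1)) ⟩
    alternatingSum (λ d R → d (suc n) * det n (map (_∘ suc) R)) cs
      ≡⟨ alt-map (_∘ suc) (λ d R → d n * det n R) cs ⟨
    det (suc n) (map (_∘ suc) cs) ∎

  -- IsPoly d ℓ p: p is a polynomial function of degree at most d whose
  -- coefficient at x^d is ℓ, in the form of the factor theorem at every point.
  IsPoly : ℕ → ℤ → (ℤ → ℤ) → Set
  IsPoly zero    ℓ p = ∀ x → p x ≡ ℓ
  IsPoly (suc d) ℓ p = ∀ a → ∃ λ q → IsPoly d ℓ q × (∀ x → p x ≡ p a + (x - a) * q x)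

  isPoly-cong : ∀ d {ℓ p p′} → (∀ x → p x ≡ p′ x) → IsPoly d ℓ p → IsPoly d ℓ p′
  isPoly-cong zero    eq ip x = trans (sym (eq x)) (ip x)
  isPoly-cong (suc d) eq ip a =
    let q , iq , fac = ip a
    in  q , iq , λ x → trans (sym (eq x)) (trans (fac x) (cong (_+ _) (eq a)))

  isPoly-lift : ∀ d {ℓ p} → IsPoly d ℓ p → IsPoly (suc d) 0ℤ p
  isPoly-lift zero {ℓ} {p} ip a = (λ _ → 0ℤ) , (λ _ → refl) , λ x →
    trans (trans (ip x) (sym (ip a))) (lemma (p a) (x - a))
    where
    opaque
      unfolding _+_
      lemma : ∀ a b → a ≡ a + b * 0ℤ
      lemma = solve-∀
  isPoly-lift (suc d) ip a =
    let q , iq , fac = ip a in q , isPoly-lift d iq , fac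

  isPoly-+ : ∀ d {ℓ m p q} → IsPoly d ℓ p → IsPoly d m q → IsPoly d (ℓ + m) (λ x → p x + q x)
  isPoly-+ zero    ip iq x = cong₂ _+_ (ip x) (iq x)
  isPoly-+ (suc d) {p = p} {q} ip iq a =
    let p′ , ip′ , fp = ip a
        q′ , iq′ , fq = iq a
    in  (λ x → p′ x + q′ x) , isPoly-+ d ip′ iq′ , λ x →
        trans (cong₂ _+_ (fp x) (fq x)) (lemma (p a) (q a) (x - a) (p′ x) (q′ x))
    where
    opaque
      unfolding _+_
      lemma : ∀ a b c d e → (a + c * d) + (b + c * e) ≡ (a + b) + c * (d + e)
      lemma = solve-∀

  isPoly-scale : ∀ d k {ℓ p} → IsPoly d ℓ p → IsPoly d (k * ℓ) (λ x → k * p x)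
  isPoly-scale zero    k ip x = cong (k *_) (ip x)
  isPoly-scale (suc d) k {p = p} ip a =
    let q , iq , fac = ip a
    in  (λ x → k * q x) , isPoly-scale d k iq , λ x → trans (cong (k *_) (fac x)) (lemma k (p a) (x - a) (q x))
    where
    opaque
      unfolding _+_
      lemma : ∀ k a c d → k * (a + c * d) ≡ k * a + c * (k * d)
      lemma = solve-∀

  isPoly-*linear : ∀ d b {ℓ p} → IsPoly d ℓ p → IsPoly (suc d) ℓ (λ x → p x * (x - b))
  isPoly-*linear zero b {ℓ} {p} ip a = p , ip , λ x → begin
    p x * (x - b)                     ≡⟨ lemma (p x) x a b ⟩
    p x * (a - b) + (x - a) * p x     ≡⟨ cong (λ y → y * (a - b) + (x - a) * p x) (trans (ip x) (sym (ip a))) ⟩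
    p a * (a - b) + (x - a) * p x     ∎
    where
    opaque
      unfolding _+_
      lemma : ∀ p x a b → p * (x - b) ≡ p * (a - b) + (x - a) * p
      lemma = solve-∀
  isPoly-*linear (suc d) b {ℓ} {p} ip a =
    let q , iq , fac = ip a
    in  (λ x → p x + (a - b) * q x) ,
        subst (λ m → IsPoly (suc d) m (λ x → p x + (a - b) * q x)) (lead ℓ)
          (isPoly-+ (suc d) {p = p} ip (isPoly-lift d (isPoly-scale d (a - b) iq))) ,
        λ x → begin
          p x * (x - b)
            ≡⟨ lemma₁ (p x) x a b ⟩
          p x * (a - b) + (x - a) * p x
            ≡⟨ cong (λ y → y * (a - b) + (x - a) * p x) (fac x) ⟩
          (p a + (x - a) * q x) * (a - b) + (x - a) * p x
            ≡⟨ lemma₂ (p a) (p x) (q x) x a b ⟩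
          p a * (a - b) + (x - a) * (p x + (a - b) * q x) ∎
    where
    opaque
      unfolding _+_
      lead : ∀ ℓ → ℓ + 0ℤ ≡ ℓ
      lead = solve-∀
      lemma₁ : ∀ p x a b → p * (x - b) ≡ p * (a - b) + (x - a) * p
      lemma₁ = solve-∀
      lemma₂ : ∀ pa px q x a b → (pa + (x - a) * q) * (a - b) + (x - a) * px ≡
        pa * (a - b) + (x - a) * (px + (a - b) * q)
      lemma₂ = solve-∀

  -- Vandermonde products and interpolation without division

  productOver : (ℤ → ℤ) → List ℤ → ℤ
  productOver f []       = 1ℤ
  productOver f (x ∷ xs) = f x * productOver f xs

  vandermonde : List ℤ → ℤ
  vandermonde []       = 1ℤ
  vandermonde (x ∷ xs) = productOver (x -_) xs * vandermonde xs

  productOver-pick : ∀ f {x R xs} → Pick x R xs → productOver f xs ≡ f x * productOver f R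
  productOver-pick f here = refl
  productOver-pick f (there {y} {R} p) =
    trans (cong (f y *_) (productOver-pick f p)) (a*[b*c]≡b*[a*c] (f y) _ (productOver f R))

  -- The divided difference of `p` at the nodes, multiplied by their Vandermonde product to clear
  -- the denominators.
  lagrange : (ℤ → ℤ) → List ℤ → ℤ
  lagrange p = alternatingSum (λ x R → p x * vandermonde R)

  lagrange-cong : ∀ {p q} xs → (∀ x → p x ≡ q x) → lagrange p xs ≡ lagrange q xs
  lagrange-cong xs eq = alt-cong xs λ {x} {R} _ → cong (_* vandermonde R) (eq x)

  lagrange-+ : ∀ p q xs → lagrange (λ x → p x + q x) xs ≡ lagrange p xs + lagrange q xs
  lagrange-+ p q xs = trans
    (alt-cong xs λ {x} {R} _ → *-distribʳ-+ (vandermonde R) (p x) (q x))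
    (alt-+ _ _ xs)

  lagrange-* : ∀ k p xs → lagrange (λ x → k * p x) xs ≡ k * lagrange p xs
  lagrange-* k p xs = trans
    (alt-cong xs λ {x} {R} _ → *-assoc k (p x) (vandermonde R))
    (alt-* k _ xs)

  -- The node `a` contributes nothing. At any other node `x`, the factor `a - x` completes the
  -- product over the remaining nodes to the full product over `xs`, and the two sign changes
  -- cancel.
  lagrange-factor : ∀ a q xs →
    lagrange (λ x → (x - a) * q x) (a ∷ xs) ≡ productOver (a -_) xs * lagrange q xs
  lagrange-factor a q xs = begin
    (a - a) * q a * vandermonde xs - alternatingSum (λ x R → (x - a) * q x * (productOver (a -_) R * vandermonde R)) xs
      ≡⟨ cong (λ s → (a - a) * q a * vandermonde xs - s) (alt-cong xs λ {x} {R} pk →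
           trans (lemma₁ x a (q x) (productOver (a -_) R) (vandermonde R))
             (cong (λ z → -1ℤ * z * (q x * vandermonde R)) (sym (productOver-pick (a -_) pk)))) ⟩
    (a - a) * q a * vandermonde xs - alternatingSum (λ x R → -1ℤ * productOver (a -_) xs * (q x * vandermonde R)) xs
      ≡⟨ cong (λ s → (a - a) * q a * vandermonde xs - s) (alt-* (-1ℤ * productOver (a -_) xs) _ xs) ⟩
    (a - a) * q a * vandermonde xs - (-1ℤ * productOver (a -_) xs) * lagrange q xs
      ≡⟨ lemma₂ a (q a) (vandermonde xs) (productOver (a -_) xs) (lagrange q xs) ⟩
    productOver (a -_) xs * lagrange q xs ∎
    where
    opaque
      unfolding _+_
      lemma₁ : ∀ x a q π v → (x - a) * q * (π * v) ≡ -1ℤ * ((a - x) * π) * (q * v)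
      lemma₁ = solve-∀
      lemma₂ : ∀ a q v π l → (a - a) * q * v - (-1ℤ * π) * l ≡ π * l
      lemma₂ = solve-∀

  vandermonde-swap : ∀ a b xs → vandermonde (b ∷ a ∷ xs) ≡ -1ℤ * vandermonde (a ∷ b ∷ xs)
  vandermonde-swap a b xs = lemma a b (productOver (a -_) xs) (productOver (b -_) xs) (vandermonde xs)
    where
    opaque
      unfolding _+_
      lemma : ∀ a b p q v → ((b - a) * q) * (p * v) ≡ -1ℤ * (((a - b) * p) * (q * v))
      lemma = solve-∀

  lagrange-swap : ∀ p a b xs → lagrange p (b ∷ a ∷ xs) ≡ -1ℤ * lagrange p (a ∷ b ∷ xs)
  lagrange-swap p a b xs = begin
    p b * vandermonde (a ∷ xs) - (p a * vandermonde (b ∷ xs) - alternatingSum (λ x R → p x * vandermonde (b ∷ a ∷ R)) xs)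
      ≡⟨ cong (λ s → p b * vandermonde (a ∷ xs) - (p a * vandermonde (b ∷ xs) - s))
           (trans (alt-cong xs λ {x} {R} _ → trans (cong (p x *_) (vandermonde-swap a b R)) (lemma₁ (p x) _))
                  (alt-* -1ℤ _ xs)) ⟩
    p b * vandermonde (a ∷ xs) - (p a * vandermonde (b ∷ xs) - (-1ℤ * alternatingSum (λ x R → p x * vandermonde (a ∷ b ∷ R)) xs))
      ≡⟨ lemma₂ (p b * vandermonde (a ∷ xs)) (p a * vandermonde (b ∷ xs)) _ ⟩
    -1ℤ * lagrange p (a ∷ b ∷ xs) ∎
    where
    opaque
      unfolding _+_
      lemma₁ : ∀ p v → p * (-1ℤ * v) ≡ -1ℤ * (p * v)
      lemma₁ = solve-∀
      lemma₂ : ∀ x y z → x - (y - (-1ℤ * z)) ≡ -1ℤ * (y - (x - z))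
      lemma₂ = solve-∀

  -- Writing `x` as `a + (x - a)` shows, by induction, that the identity function gives `a` times
  -- the value `E` in question. Exchanging the first two nodes gives `b` times it, so `(a - b) * E`
  -- vanishes. If `a` equals `b`, antisymmetry alone suffices.
  lagrange-one : ∀ a b xs → lagrange (λ _ → 1ℤ) (a ∷ b ∷ xs) ≡ 0ℤ
  lagrange-one a b []       = lemma
    where
    opaque
      unfolding _+_
      lemma : 1ℤ * (1ℤ * 1ℤ) - (1ℤ * (1ℤ * 1ℤ) - 0ℤ) ≡ 0ℤ
      lemma = refl
  lagrange-one a b (c ∷ xs) with a ℤₚ.≟ b
  ... | yes refl = self (lagrange-swap (λ _ → 1ℤ) a a (c ∷ xs))
    where
    self : ∀ {x} → x ≡ -1ℤ * x → x ≡ 0ℤ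
    self {x} eq with i*j≡0⇒i≡0∨j≡0 (int 2) {x} (trans (lemma₁ x) (trans (cong (x +_) eq) (lemma₂ x)))
      where
      opaque
        unfolding _+_
        lemma₁ : ∀ x → int 2 * x ≡ x + x
        lemma₁ = solve-∀
        lemma₂ : ∀ x → x + (-1ℤ * x) ≡ 0ℤ
        lemma₂ = solve-∀
    ... | inj₂ x≡0 = x≡0
  ... | no a≢b with i*j≡0⇒i≡0∨j≡0 (a - b) {E} difference
    where
    one : ℤ → ℤ
    one _ = 1ℤ
    E E′ : ℤ
    E  = lagrange one (a ∷ b ∷ c ∷ xs)
    E′ = lagrange one (b ∷ a ∷ c ∷ xs)
    at : ∀ a b → lagrange (λ x → x) (a ∷ b ∷ c ∷ xs) ≡ a * lagrange one (a ∷ b ∷ c ∷ xs)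
    at a b = begin
      lagrange (λ x → x) (a ∷ b ∷ c ∷ xs)
        ≡⟨ lagrange-cong (a ∷ b ∷ c ∷ xs) (λ x → lemma x a) ⟩
      lagrange (λ x → a * 1ℤ + (x - a) * 1ℤ) (a ∷ b ∷ c ∷ xs)
        ≡⟨ lagrange-+ (λ _ → a * 1ℤ) (λ x → (x - a) * 1ℤ) (a ∷ b ∷ c ∷ xs) ⟩
      lagrange (λ _ → a * 1ℤ) (a ∷ b ∷ c ∷ xs) + lagrange (λ x → (x - a) * 1ℤ) (a ∷ b ∷ c ∷ xs)
        ≡⟨ cong₂ _+_ (lagrange-* a one (a ∷ b ∷ c ∷ xs))
             (trans (lagrange-factor a one (b ∷ c ∷ xs))
               (trans (cong (productOver (a -_) (b ∷ c ∷ xs) *_) (lagrange-one b c xs))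
                 (*-zeroʳ (productOver (a -_) (b ∷ c ∷ xs))))) ⟩
      a * lagrange one (a ∷ b ∷ c ∷ xs) + 0ℤ
        ≡⟨ +-identityʳ _ ⟩
      a * lagrange one (a ∷ b ∷ c ∷ xs) ∎
      where
      opaque
        unfolding _+_
        lemma : ∀ x a → x ≡ a * 1ℤ + (x - a) * 1ℤ
        lemma = solve-∀
    difference : (a - b) * E ≡ 0ℤ
    difference = begin
      (a - b) * E                                ≡⟨ lemma₁ a b E ⟩
      a * E + b * (-1ℤ * E)                     ≡⟨ cong (λ e → a * E + b * e) (sym (lagrange-swap one a b (c ∷ xs))) ⟩
      a * E + b * E′                             ≡⟨ cong₂ _+_ (sym (at a b)) (sym (at b a)) ⟩
      lagrange (λ x → x) (a ∷ b ∷ c ∷ xs) + lagrange (λ x → x) (b ∷ a ∷ c ∷ xs)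
        ≡⟨ cong (lagrange (λ x → x) (a ∷ b ∷ c ∷ xs) +_) (lagrange-swap (λ x → x) a b (c ∷ xs)) ⟩
      lagrange (λ x → x) (a ∷ b ∷ c ∷ xs) + (-1ℤ * lagrange (λ x → x) (a ∷ b ∷ c ∷ xs))
        ≡⟨ lemma₂ (lagrange (λ x → x) (a ∷ b ∷ c ∷ xs)) ⟩
      0ℤ ∎
      where
      opaque
        unfolding _+_
        lemma₁ : ∀ a b e → (a - b) * e ≡ a * e + b * (-1ℤ * e)
        lemma₁ = solve-∀
        lemma₂ : ∀ x → x + (-1ℤ * x) ≡ 0ℤ
        lemma₂ = solve-∀
  ... | inj₁ a-b≡0 = contradiction (i-j≡0⇒i≡j a b a-b≡0) a≢b
  ... | inj₂ E≡0   = E≡0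

  -- The divided difference of order `d` reads off the leading coefficient. Splitting off the factor
  -- at the first node removes this node and lowers the degree by one.
  lagrange-interpolation : ∀ d {ℓ p} → IsPoly d ℓ p → ∀ xs → length xs ≡ suc d →
    lagrange p xs ≡ ℓ * vandermonde xs
  lagrange-interpolation zero {ℓ} {p} ip (a ∷ []) refl =
    trans (cong (λ y → y * 1ℤ - 0ℤ) (ip a)) (lemma ℓ)
    where
    opaque
      unfolding _+_
      lemma : ∀ ℓ → ℓ * 1ℤ - 0ℤ ≡ ℓ * (1ℤ * 1ℤ)
      lemma = solve-∀
  lagrange-interpolation (suc d) {ℓ} {p} ip (a ∷ b ∷ xs) len = let q , iq , fac = ip a in begin
    lagrange p (a ∷ b ∷ xs)
      ≡⟨ lagrange-cong (a ∷ b ∷ xs) (λ x → trans (fac x) (cong (_+ (x - a) * q x) (sym (*-identityʳ (p a))))) ⟩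
    lagrange (λ x → p a * 1ℤ + (x - a) * q x) (a ∷ b ∷ xs)
      ≡⟨ lagrange-+ (λ _ → p a * 1ℤ) (λ x → (x - a) * q x) (a ∷ b ∷ xs) ⟩
    lagrange (λ x → p a * 1ℤ) (a ∷ b ∷ xs) + lagrange (λ x → (x - a) * q x) (a ∷ b ∷ xs)
      ≡⟨ cong₂ _+_
           (trans (lagrange-* (p a) (λ _ → 1ℤ) (a ∷ b ∷ xs))
             (trans (cong (p a *_) (lagrange-one a b xs)) (*-zeroʳ (p a))))
           (lagrange-factor a q (b ∷ xs)) ⟩
    0ℤ + productOver (a -_) (b ∷ xs) * lagrange q (b ∷ xs)
      ≡⟨ cong (λ s → 0ℤ + productOver (a -_) (b ∷ xs) * s) (lagrange-interpolation d iq (b ∷ xs) (ℕₚ.suc-injective len)) ⟩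
    0ℤ + productOver (a -_) (b ∷ xs) * (ℓ * vandermonde (b ∷ xs))
      ≡⟨ lemma ℓ (productOver (a -_) (b ∷ xs)) (vandermonde (b ∷ xs)) ⟩
    ℓ * vandermonde (a ∷ b ∷ xs) ∎
    where
    opaque
      unfolding _+_
      lemma : ∀ ℓ p v → 0ℤ + p * (ℓ * v) ≡ ℓ * (p * v)
      lemma = solve-∀

  falling : ℕ → ℤ → ℤ
  falling zero    x = 1ℤ
  falling (suc n) x = falling n x * (x - int n)

  falling-isPoly : ∀ n → IsPoly n 1ℤ (falling n)
  falling-isPoly zero    x = refl
  falling-isPoly (suc n)   = isPoly-*linear n (int n) (falling-isPoly n)

  power : ℤ → Column
  power x k = falling k x

  -- Once the minors are Vandermonde products, the expansion along the last row is interpolation of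
  -- the monic polynomial `falling n`.
  det-powers : ∀ xs n → length xs ≡ n → det n (map power xs) ≡ vandermonde xs
  det-powers []       zero    refl = refl
  det-powers xs       (suc n) len  = begin
    det (suc n) (map power xs)
      ≡⟨ alt-map power (λ c R → c n * det n R) xs ⟩
    alternatingSum (λ x R → falling n x * det n (map power R)) xs
      ≡⟨ alt-cong xs (λ {x} {R} p → cong (falling n x *_)
           (det-powers R n (ℕₚ.suc-injective (trans (sym (pick-length p)) len)))) ⟩
    lagrange (falling n) xs
      ≡⟨ lagrange-interpolation n (falling-isPoly n) xs len ⟩
    1ℤ * vandermonde xs
      ≡⟨ *-identityˡ _ ⟩
    vandermonde xs ∎

  -- Interlacing rows

  sumOver : {A : Set} → (A → ℤ) → List A → ℤ
  sumOver f []       = 0ℤ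
  sumOver f (x ∷ xs) = f x + sumOver f xs

  module _ {A : Set} where

    sumOver-++ : ∀ (f : A → ℤ) xs ys → sumOver f (xs ++ ys) ≡ sumOver f xs + sumOver f ys
    sumOver-++ f []       ys = sym (+-identityˡ _)
    sumOver-++ f (x ∷ xs) ys = trans (cong (f x +_) (sumOver-++ f xs ys)) (sym (+-assoc _ _ _))

    sumOver-map : ∀ {B : Set} (g : B → A) (f : A → ℤ) xs → sumOver f (map g xs) ≡ sumOver (f ∘ g) xs
    sumOver-map g f []       = refl
    sumOver-map g f (x ∷ xs) = cong (f (g x) +_) (sumOver-map g f xs)

    sumOver-cong : ∀ {f g : A → ℤ} xs → (∀ x → f x ≡ g x) → sumOver f xs ≡ sumOver g xs
    sumOver-cong []       eq = refl
    sumOver-cong (x ∷ xs) eq = cong₂ _+_ (eq x) (sumOver-cong xs eq)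

    sumOver-* : ∀ k (f : A → ℤ) xs → sumOver (λ x → k * f x) xs ≡ k * sumOver f xs
    sumOver-* k f []       = sym (*-zeroʳ k)
    sumOver-* k f (x ∷ xs) = trans (cong (k * f x +_) (sumOver-* k f xs)) (sym (*-distribˡ-+ k _ _))

    length-concatMap : ∀ {B : Set} (f : A → List B) xs →
      int (length (concatMap f xs)) ≡ sumOver (int ∘ length ∘ f) xs
    length-concatMap f []       = refl
    length-concatMap f (x ∷ xs) = begin
      int (length (f x ++ concatMap f xs))          ≡⟨ cong int (length-++ (f x)) ⟩
      int (length (f x) ℕ.+ length (concatMap f xs)) ≡⟨ int-+ (length (f x)) _ ⟩
      int (length (f x)) + int (length (concatMap f xs)) ≡⟨ cong (int (length (f x)) +_) (length-concatMap f xs) ⟩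
      int (length (f x)) + sumOver (int ∘ length ∘ f) xs ∎

  -- preds false u lists the rows d whose entries interlace with those of u: reading
  -- from the left, the entries of u and d alternate, beginning and ending with u.
  -- The flag tells whether the last entry read belongs to u.
  preds : Bool → ∀ {n} → Vec Bool (suc n) → List (Vec Bool n)
  preds false {zero}  (false ∷ []) = []
  preds false {zero}  (true  ∷ []) = [] ∷ []
  preds true  {zero}  (false ∷ []) = [] ∷ []
  preds true  {zero}  (true  ∷ []) = []
  preds false {suc n} (false ∷ u)  = map (false ∷_) (preds false u)
  preds false {suc n} (true  ∷ u)  = map (false ∷_) (preds true u) ++ map (true ∷_) (preds false u)
  preds true  {suc n} (false ∷ u)  = map (false ∷_) (preds true u) ++ map (true ∷_) (preds false u)
  preds true  {suc n} (true  ∷ u)  = []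

  -- Positions are counted from the right end of the row, hence listed in
  -- decreasing order.
  positions : ∀ {n} → Vec Bool n → List ℤ
  positions {zero}  []          = []
  positions {suc n} (false ∷ u) = positions u
  positions {suc n} (true  ∷ u) = int n ∷ positions u

  -- The forward difference of the falling factorial of degree `k + 1`; see `gap-suc`.
  scaledPower : ℤ → Column
  scaledPower x k = int (suc k) * power x k

  gap : ℤ → ℤ → Column
  gap x y k = power x (suc k) - power y (suc k)

  gaps : List ℤ → List Column
  gaps []           = []
  gaps (x ∷ [])     = []
  gaps (x ∷ y ∷ xs) = gap x y ∷ gaps (y ∷ xs)

  gap-self : ∀ x k → gap x x k ≡ 0ℤ
  gap-self x k = -‿self (power x (suc k))

  falling-shift : ∀ k x → falling (suc k) (1ℤ + x) ≡ (1ℤ + x) * falling k x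
  falling-shift zero    x = lemma x
    where
    opaque
      unfolding _+_
      lemma : ∀ x → 1ℤ * (1ℤ + x - int 0) ≡ (1ℤ + x) * 1ℤ
      lemma = solve-∀
  falling-shift (suc k) x = begin
    falling (suc k) (1ℤ + x) * (1ℤ + x - int (suc k))
      ≡⟨ cong₂ (λ y z → y * (1ℤ + x - z)) (falling-shift k x) (int-+ 1 k) ⟩
    (1ℤ + x) * falling k x * (1ℤ + x - (1ℤ + int k))
      ≡⟨ lemma x (falling k x) (int k) ⟩
    (1ℤ + x) * (falling k x * (x - int k)) ∎
    where
    opaque
      unfolding _+_
      lemma : ∀ x f k → (1ℤ + x) * f * (1ℤ + x - (1ℤ + k)) ≡ (1ℤ + x) * (f * (x - k))
      lemma = solve-∀

  gap-suc : ∀ m y k → gap (int (suc m)) y k ≡ gap (int m) y k + scaledPower (int m) k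
  gap-suc m y k = begin
    power (int (suc m)) (suc k) - power y (suc k)
      ≡⟨ cong (λ z → power z (suc k) - power y (suc k)) (int-+ 1 m) ⟩
    falling (suc k) (1ℤ + int m) - power y (suc k)
      ≡⟨ cong (_- power y (suc k)) (falling-shift k (int m)) ⟩
    (1ℤ + int m) * falling k (int m) - power y (suc k)
      ≡⟨ lemma (int m) (falling k (int m)) (int k) (power y (suc k)) ⟩
    falling k (int m) * (int m - int k) - power y (suc k) + (1ℤ + int k) * falling k (int m)
      ≡⟨ cong (λ z → gap (int m) y k + z * falling k (int m)) (int-+ 1 k) ⟨
    gap (int m) y k + scaledPower (int m) k ∎
    where
    opaque
      unfolding _+_
      lemma : ∀ m f k p → (1ℤ + m) * f - p ≡ f * (m - k) - p + (1ℤ + k) * f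
      lemma = solve-∀

  cons-multiadditive : ∀ {Φ} c → Multiadditive Φ → Multiadditive (Φ ∘ (c ∷_))
  cons-multiadditive c add .additive eq pre post = add .additive eq (c ∷ pre) post

  cons-alternating : ∀ {Φ} c → Alternating Φ → Alternating (Φ ∘ (c ∷_))
  cons-alternating c alt .vanishes x pre post = alt .vanishes x (c ∷ pre) post

  preds-empty : ∀ {n} (u : Vec Bool (suc n)) → positions u ≡ [] → preds false u ≡ []
  preds-empty {zero}  (false ∷ []) eq = refl
  preds-empty {suc n} (false ∷ u)  eq = cong (map (false ∷_)) (preds-empty u eq)

  -- A row interlacing u has one entry in each gap of positions u, and the powers
  -- at the entries of a gap sum up telescopically.
  mutual
    sum-preds-false : ∀ {Φ} → Multiadditive Φ → ∀ {n} (u : Vec Bool (suc n)) {x xs} →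
      positions u ≡ x ∷ xs →
      sumOver (λ d → Φ (map scaledPower (positions d))) (preds false u) ≡ Φ (gaps (positions u))
    sum-preds-false     add {zero}  (true ∷ [])  eq = +-identityʳ _
    sum-preds-false     add {suc n} (false ∷ u)  eq =
      trans (sumOver-map (false ∷_) _ (preds false u)) (sum-preds-false add u eq)
    sum-preds-false     add {suc n} (true ∷ u)   eq = sum-preds-open add u

    -- An entry of `d` is still due. The extra position `int n` is the exclusive upper bound of the
    -- places left to it: the last mark of the upper row may lie further to the left, but the places
    -- in between have already been passed over.
    sum-preds-true : ∀ {Φ} → Multiadditive Φ → ∀ {n} (u : Vec Bool (suc n)) →
      sumOver (λ d → Φ (map scaledPower (positions d))) (preds true u) ≡ Φ (gaps (int n ∷ positions u))
    sum-preds-true add {zero}  (false ∷ []) = +-identityʳ _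
    sum-preds-true add {zero}  (true ∷ [])  = sym (zeroColumn add (gap-self (int 0)) [] [])
    sum-preds-true add {suc n} (false ∷ u)  = sum-preds-open add u
    sum-preds-true add {suc n} (true ∷ u)   = sym (zeroColumn add (gap-self (int (suc n))) [] _)

    sum-preds-open : ∀ {Φ} → Multiadditive Φ → ∀ {n} (u : Vec Bool (suc n)) →
      sumOver (λ d → Φ (map scaledPower (positions d)))
        (map (false ∷_) (preds true u) ++ map (true ∷_) (preds false u))
      ≡ Φ (gaps (int (suc n) ∷ positions u))
    sum-preds-open {Φ} add {n} u = begin
      sumOver φ (map (false ∷_) (preds true u) ++ map (true ∷_) (preds false u))
        ≡⟨ sumOver-++ φ (map (false ∷_) (preds true u)) _ ⟩
      sumOver φ (map (false ∷_) (preds true u)) + sumOver φ (map (true ∷_) (preds false u))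
        ≡⟨ cong₂ _+_ (sumOver-map (false ∷_) φ (preds true u)) (sumOver-map (true ∷_) φ (preds false u)) ⟩
      sumOver (φ ∘ (false ∷_)) (preds true u) + sumOver (φ ∘ (true ∷_)) (preds false u)
        ≡⟨ cong (_+ sumOver (φ ∘ (true ∷_)) (preds false u)) (sum-preds-true add u) ⟩
      Φ (gaps (int n ∷ positions u)) + sumOver (φ ∘ (true ∷_)) (preds false u)
        ≡⟨ rest (positions u) refl ⟩
      Φ (gaps (int (suc n) ∷ positions u)) ∎
      where
      φ = λ d → Φ (map scaledPower (positions d))
      rest : ∀ ps → positions u ≡ ps →
        Φ (gaps (int n ∷ ps)) + sumOver (φ ∘ (true ∷_)) (preds false u) ≡ Φ (gaps (int (suc n) ∷ ps))
      rest []       eq rewrite preds-empty u eq = +-identityʳ _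
      -- The entry due either avoids the place `n` or sits there; this splits the gap between `y`
      -- and `n + 1`.
      rest (y ∷ ps) eq = begin
        Φ (gap (int n) y ∷ gaps (y ∷ ps)) + sumOver (φ ∘ (true ∷_)) (preds false u)
          ≡⟨ cong (Φ (gap (int n) y ∷ gaps (y ∷ ps)) +_)
               (trans (sum-preds-false (cons-multiadditive (scaledPower (int n)) add) u eq)
                 (cong (λ l → Φ (scaledPower (int n) ∷ gaps l)) eq)) ⟩
        Φ (gap (int n) y ∷ gaps (y ∷ ps)) + Φ (scaledPower (int n) ∷ gaps (y ∷ ps))
          ≡⟨ add .additive (gap-suc n y) [] (gaps (y ∷ ps)) ⟨
        Φ (gap (int (suc n)) y ∷ gaps (y ∷ ps)) ∎

  rowGaps : List ℤ → List Column
  rowGaps []           = []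
  rowGaps (x ∷ [])     = []
  rowGaps (x ∷ y ∷ xs) = (λ k → power x k - power y k) ∷ rowGaps (y ∷ xs)

  rowGaps-suc : ∀ xs → map (_∘ suc) (rowGaps xs) ≡ gaps xs
  rowGaps-suc []           = refl
  rowGaps-suc (x ∷ [])     = refl
  rowGaps-suc (x ∷ y ∷ xs) = cong (gap x y ∷_) (rowGaps-suc (y ∷ xs))

  rowGaps-zero : ∀ xs → All (λ c → c 0 ≡ 0ℤ) (rowGaps xs)
  rowGaps-zero []           = []
  rowGaps-zero (x ∷ [])     = []
  rowGaps-zero (x ∷ y ∷ xs) = -‿self 1ℤ ∷ rowGaps-zero (y ∷ xs)

  lastOf : ℤ → List ℤ → ℤ
  lastOf x []       = x
  lastOf x (y ∷ xs) = lastOf y xs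

  differenceColumns : ∀ {Φ} → Multiadditive Φ → Alternating Φ → ∀ x xs →
    Φ (map power (x ∷ xs)) ≡ Φ (rowGaps (x ∷ xs) ++ [ power (lastOf x xs) ])
  differenceColumns add alt x []       = refl
  differenceColumns {Φ} add alt x (y ∷ xs) = trans
    (subtractNext {Φ} add alt (λ k → refl) (map power xs))
    (differenceColumns (cons-multiadditive (λ k → power x k - power y k) add)
      (cons-alternating {Φ} (λ k → power x k - power y k) alt) y xs)

  -- Row 0 is constantly 1. Subtracting neighbouring columns makes it 0, ..., 0, 1, and expanding
  -- along it leaves the matrix of gaps.
  det-powers-gaps : ∀ n x xs → det (suc n) (map power (x ∷ xs)) ≡ det n (gaps (x ∷ xs))
  det-powers-gaps n x xs = begin
    det (suc n) (map power (x ∷ xs))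
      ≡⟨ differenceColumns (det-multiadditive (suc n)) (det-alternating (suc n)) x xs ⟩
    det (suc n) (rowGaps (x ∷ xs) ++ [ power (lastOf x xs) ])
      ≡⟨ det-unitRow n (rowGaps (x ∷ xs)) _ (rowGaps-zero (x ∷ xs)) refl ⟩
    det n (map (_∘ suc) (rowGaps (x ∷ xs)))
      ≡⟨ cong (det n) (rowGaps-suc (x ∷ xs)) ⟩
    det n (gaps (x ∷ xs)) ∎

  det-scaledPowers : ∀ n xs → det n (map scaledPower xs) ≡ int (n !) * det n (map power xs)
  det-scaledPowers zero    []       = sym (*-identityʳ 1ℤ)
  det-scaledPowers zero    (x ∷ xs) = sym (*-zeroʳ 1ℤ)
  det-scaledPowers (suc n) xs = begin
    det (suc n) (map scaledPower xs)
      ≡⟨ alt-map scaledPower _ xs ⟩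
    alternatingSum (λ x R → scaledPower x n * det n (map scaledPower R)) xs
      ≡⟨ alt-cong xs (λ {x} {R} _ → trans (cong (scaledPower x n *_) (det-scaledPowers n R))
           (lemma (int (suc n)) (power x n) (int (n !)) _)) ⟩
    alternatingSum (λ x R → int (suc n) * int (n !) * (power x n * det n (map power R))) xs
      ≡⟨ alt-* (int (suc n) * int (n !)) _ xs ⟩
    int (suc n) * int (n !) * alternatingSum (λ x R → power x n * det n (map power R)) xs
      ≡⟨ cong₂ _*_ (int-* (suc n) (n !)) (alt-map power (λ c R → c n * det n R) xs) ⟨
    int (suc n !) * det (suc n) (map power xs) ∎
    where
    opaque
      unfolding _+_
      lemma : ∀ a b c d → a * b * (c * d) ≡ a * c * (b * d)
      lemma = solve-∀

  sum-preds-det : ∀ h {n} (u : Vec Bool (suc n)) →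
    int (h !) * sumOver (λ d → det h (map power (positions d))) (preds false u)
    ≡ det (suc h) (map power (positions u))
  sum-preds-det h u = begin
    int (h !) * sumOver (λ d → det h (map power (positions d))) (preds false u)
      ≡⟨ sumOver-* (int (h !)) _ (preds false u) ⟨
    sumOver (λ d → int (h !) * det h (map power (positions d))) (preds false u)
      ≡⟨ sumOver-cong (preds false u) (λ d → sym (det-scaledPowers h (positions d))) ⟩
    sumOver (λ d → det h (map scaledPower (positions d))) (preds false u)
      ≡⟨ rest (positions u) refl ⟩
    det (suc h) (map power (positions u)) ∎
    where
    rest : ∀ ps → positions u ≡ ps →
      sumOver (λ d → det h (map scaledPower (positions d))) (preds false u) ≡ det (suc h) (map power ps)
    rest []       eq rewrite preds-empty u eq = refl
    rest (x ∷ ps) eq = begin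
      sumOver (λ d → det h (map scaledPower (positions d))) (preds false u)
        ≡⟨ sum-preds-false (det-multiadditive h) u eq ⟩
      det h (gaps (positions u))
        ≡⟨ cong (det h ∘ gaps) eq ⟩
      det h (gaps (x ∷ ps))
        ≡⟨ det-powers-gaps h x ps ⟨
      det (suc h) (map power (x ∷ ps)) ∎

  module _ (c : ℕ) where

    Rows : ℕ → Set
    Rows zero    = ⊤
    Rows (suc h) = Vec Bool (h ℕ.+ c) × Rows h

    -- Row 0 belongs to the bottom side of the hexagon, which no lozenge crosses; a chain may only
    -- end in an unmarked row.
    emptyOnly : List ℤ → List ⊤
    emptyOnly []      = tt ∷ []
    emptyOnly (_ ∷ _) = []

    chains : ∀ h → Vec Bool (h ℕ.+ c) → List (Rows h)
    chains zero    u = emptyOnly (positions u)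
    chains (suc h) u = concatMap (λ d → map (d ,_) (chains h d)) (preds false u)

  superfactorial : ℕ → ℤ
  superfactorial zero    = 1ℤ
  superfactorial (suc h) = int (h !) * superfactorial h

  -- Each row contributes the factorial of `sum-preds-det`, which comes from the factors `k + 1` of
  -- `scaledPower`; together they form the superfactorial.
  chains-det : ∀ c h (u : Vec Bool (h ℕ.+ c)) →
    superfactorial h * int (length (chains c h u)) ≡ det h (map power (positions u))
  chains-det c zero    u = base (positions u)
    where
    base : ∀ ps → 1ℤ * int (length (emptyOnly c ps)) ≡ det 0 (map power ps)
    base []      = *-identityʳ 1ℤ
    base (_ ∷ _) = *-zeroʳ 1ℤ
  chains-det c (suc h) u = begin
    int (h !) * superfactorial h * int (length (chains c (suc h) u))
      ≡⟨ cong (int (h !) * superfactorial h *_)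
           (trans (length-concatMap (λ d → map (d ,_) (chains c h d)) (preds false u))
             (sumOver-cong (preds false u) (λ d → cong int (length-map (d ,_) (chains c h d))))) ⟩
    int (h !) * superfactorial h * sumOver (λ d → int (length (chains c h d))) (preds false u)
      ≡⟨ *-assoc _ _ _ ⟩
    int (h !) * (superfactorial h * sumOver (λ d → int (length (chains c h d))) (preds false u))
      ≡⟨ cong (int (h !) *_) (sumOver-* (superfactorial h) _ (preds false u)) ⟨
    int (h !) * sumOver (λ d → superfactorial h * int (length (chains c h d))) (preds false u)
      ≡⟨ cong (int (h !) *_) (sumOver-cong (preds false u) (chains-det c h)) ⟩
    int (h !) * sumOver (λ d → det h (map power (positions d))) (preds false u)
      ≡⟨ sum-preds-det h u ⟩
    det (suc h) (map power (positions u)) ∎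

  palindromes : ∀ n → List (Vec Bool n)
  palindromes zero          = [] ∷ []
  palindromes (suc zero)    = (true ∷ []) ∷ (false ∷ []) ∷ []
  palindromes (suc (suc n)) =
    map (λ w → true ∷ (w ∷ʳ true)) (palindromes n) ++ map (λ w → false ∷ (w ∷ʳ false)) (palindromes n)

  patterns : ∀ a c → List (Rows c (suc a))
  patterns a c = concatMap (λ u → map (u ,_) (chains c a u)) (palindromes (a ℕ.+ c))

  length-patterns : ∀ a c → superfactorial a * int (length (patterns a c)) ≡
    sumOver (λ u → det a (map power (positions u))) (palindromes (a ℕ.+ c))
  length-patterns a c = begin
    superfactorial a * int (length (patterns a c))
      ≡⟨ cong (superfactorial a *_)
           (trans (length-concatMap (λ u → map (u ,_) (chains c a u)) (palindromes (a ℕ.+ c)))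
             (sumOver-cong (palindromes (a ℕ.+ c)) (λ u → cong int (length-map (u ,_) (chains c a u))))) ⟩
    superfactorial a * sumOver (λ u → int (length (chains c a u))) (palindromes (a ℕ.+ c))
      ≡⟨ sumOver-* (superfactorial a) _ (palindromes (a ℕ.+ c)) ⟨
    sumOver (λ u → superfactorial a * int (length (chains c a u))) (palindromes (a ℕ.+ c))
      ≡⟨ sumOver-cong (palindromes (a ℕ.+ c)) (chains-det c a) ⟩
    sumOver (λ u → det a (map power (positions u))) (palindromes (a ℕ.+ c)) ∎

  -- Palindromic rows

  choose : {A : Set} → ℕ → List A → List (List A)
  choose zero    xs       = [] ∷ []
  choose (suc n) []       = []
  choose (suc n) (x ∷ xs) = map (x ∷_) (choose n xs) ++ choose (suc n) xs

  words : ∀ n → List (Vec Bool n)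
  words zero    = [] ∷ []
  words (suc n) = map (true ∷_) (words n) ++ map (false ∷_) (words n)

  support : ∀ {n} → Vec Bool n → List ℕ
  support {zero}  []          = []
  support {suc n} (true ∷ m)  = n ∷ support m
  support {suc n} (false ∷ m) = support m

  sumOver-zero : ∀ {A : Set} {f : A → ℤ} xs → (∀ x → f x ≡ 0ℤ) → sumOver f xs ≡ 0ℤ
  sumOver-zero []       eq = refl
  sumOver-zero (x ∷ xs) eq = trans (cong₂ _+_ (eq x) (sumOver-zero xs eq)) (+-identityˡ 0ℤ)

  sumOver-words : ∀ n (φ : Vec Bool (suc n) → ℤ) → sumOver φ (words (suc n)) ≡
    sumOver (φ ∘ (true ∷_)) (words n) + sumOver (φ ∘ (false ∷_)) (words n)
  sumOver-words n φ = trans (sumOver-++ φ (map (true ∷_) (words n)) _)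
    (cong₂ _+_ (sumOver-map (true ∷_) φ (words n)) (sumOver-map (false ∷_) φ (words n)))

  sum-words : ∀ N n (φ : Vec Bool N → ℤ) (E : List ℕ → ℤ) →
    (∀ m → length (support m) ≡ n → φ m ≡ E (support m)) →
    (∀ m → length (support m) ≢ n → φ m ≡ 0ℤ) →
    sumOver φ (words N) ≡ sumOver E (choose n (downFrom N))
  sum-words zero    zero    φ E eq eq₀ = cong (_+ 0ℤ) (eq [] refl)
  sum-words zero    (suc n) φ E eq eq₀ = trans (cong (_+ 0ℤ) (eq₀ [] λ ())) (+-identityʳ 0ℤ)
  sum-words (suc N) zero    φ E eq eq₀ = trans (sumOver-words N φ) (trans
    (cong₂ _+_ (sumOver-zero (words N) (λ m → eq₀ (true ∷ m) λ ()))
      (sum-words N zero (φ ∘ (false ∷_)) E (eq ∘ (false ∷_)) (eq₀ ∘ (false ∷_))))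
    (+-identityˡ _))
  sum-words (suc N) (suc n) φ E eq eq₀ = begin
    sumOver φ (words (suc N))
      ≡⟨ sumOver-words N φ ⟩
    sumOver (φ ∘ (true ∷_)) (words N) + sumOver (φ ∘ (false ∷_)) (words N)
      ≡⟨ cong₂ _+_
           (sum-words N n (φ ∘ (true ∷_)) (E ∘ (N ∷_)) (λ m l → eq (true ∷ m) (cong suc l))
             (λ m l → eq₀ (true ∷ m) (l ∘ ℕₚ.suc-injective)))
           (sum-words N (suc n) (φ ∘ (false ∷_)) E (eq ∘ (false ∷_)) (eq₀ ∘ (false ∷_))) ⟩
    sumOver (E ∘ (N ∷_)) (choose n (downFrom N)) + sumOver E (choose (suc n) (downFrom N))
      ≡⟨ cong (_+ sumOver E (choose (suc n) (downFrom N))) (sumOver-map (N ∷_) E (choose n (downFrom N))) ⟨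
    sumOver E (map (N ∷_) (choose n (downFrom N))) + sumOver E (choose (suc n) (downFrom N))
      ≡⟨ sumOver-++ E (map (N ∷_) (choose n (downFrom N))) _ ⟨
    sumOver E (choose (suc n) (downFrom (suc N))) ∎

  -- The number `N + N + k`, defined so that adding one entry at each end of a vector changes its
  -- length by computation alone.
  pad : ℕ → ℕ → ℕ
  pad zero    k = k
  pad (suc N) k = suc (suc (pad N k))

  int-pad : ∀ N k → int (pad N k) ≡ int N + int N + int k
  int-pad zero    k = sym (trans (cong (_+ int k) (+-identityˡ (int 0))) (+-identityˡ (int k)))
  int-pad (suc N) k = begin
    int (2 ℕ.+ pad N k)                 ≡⟨ int-+ 2 (pad N k) ⟩
    int 2 + int (pad N k)               ≡⟨ cong (int 2 +_) (int-pad N k) ⟩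
    int 2 + (int N + int N + int k)     ≡⟨ lemma (int N) (int k) ⟩
    1ℤ + int N + (1ℤ + int N) + int k   ≡⟨ cong (λ x → x + x + int k) (int-+ 1 N) ⟨
    int (suc N) + int (suc N) + int k   ∎
    where
    opaque
      unfolding _+_
      lemma : ∀ n k → int 2 + (n + n + k) ≡ 1ℤ + n + (1ℤ + n) + k
      lemma = solve-∀

  wrap : ∀ {k N} → Vec Bool k → Vec Bool N → Vec Bool (pad N k)
  wrap c []      = c
  wrap c (b ∷ m) = b ∷ (wrap c m ∷ʳ b)

  sumOver-palindromes : ∀ n (φ : Vec Bool (suc (suc n)) → ℤ) → sumOver φ (palindromes (suc (suc n))) ≡
    sumOver (λ w → φ (true ∷ (w ∷ʳ true))) (palindromes n) +
    sumOver (λ w → φ (false ∷ (w ∷ʳ false))) (palindromes n)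
  sumOver-palindromes n φ = trans (sumOver-++ φ (map (λ w → true ∷ (w ∷ʳ true)) (palindromes n)) _)
    (cong₂ _+_ (sumOver-map _ φ (palindromes n)) (sumOver-map _ φ (palindromes n)))

  sum-evenPalindromes : ∀ N (φ : Vec Bool (pad N 0) → ℤ) →
    sumOver φ (palindromes (pad N 0)) ≡ sumOver (φ ∘ wrap []) (words N)
  sum-evenPalindromes zero    φ = refl
  sum-evenPalindromes (suc N) φ = begin
    sumOver φ (palindromes (pad (suc N) 0))
      ≡⟨ sumOver-palindromes (pad N 0) φ ⟩
    sumOver (λ w → φ (true ∷ (w ∷ʳ true))) (palindromes (pad N 0)) +
    sumOver (λ w → φ (false ∷ (w ∷ʳ false))) (palindromes (pad N 0))
      ≡⟨ cong₂ _+_ (sum-evenPalindromes N _) (sum-evenPalindromes N _) ⟩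
    sumOver (φ ∘ wrap [] ∘ (true ∷_)) (words N) + sumOver (φ ∘ wrap [] ∘ (false ∷_)) (words N)
      ≡⟨ sumOver-words N (φ ∘ wrap []) ⟨
    sumOver (φ ∘ wrap []) (words (suc N)) ∎

  sum-oddPalindromes : ∀ N (φ : Vec Bool (pad N 1) → ℤ) →
    sumOver φ (palindromes (pad N 1)) ≡
    sumOver (φ ∘ wrap (true ∷ [])) (words N) + sumOver (φ ∘ wrap (false ∷ [])) (words N)
  sum-oddPalindromes zero    φ = trans (cong (φ (true ∷ []) +_) refl) (lemma _ _)
    where
    opaque
      unfolding _+_
      lemma : ∀ a b → a + (b + 0ℤ) ≡ a + 0ℤ + (b + 0ℤ)
      lemma = solve-∀
  sum-oddPalindromes (suc N) φ = begin
    sumOver φ (palindromes (pad (suc N) 1))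
      ≡⟨ sumOver-palindromes (pad N 1) φ ⟩
    sumOver (λ w → φ (true ∷ (w ∷ʳ true))) (palindromes (pad N 1)) +
    sumOver (λ w → φ (false ∷ (w ∷ʳ false))) (palindromes (pad N 1))
      ≡⟨ cong₂ _+_ (sum-oddPalindromes N _) (sum-oddPalindromes N _) ⟩
    (sumOver (φ ∘ wrap (true ∷ []) ∘ (true ∷_)) (words N) + sumOver (φ ∘ wrap (false ∷ []) ∘ (true ∷_)) (words N)) +
    (sumOver (φ ∘ wrap (true ∷ []) ∘ (false ∷_)) (words N) + sumOver (φ ∘ wrap (false ∷ []) ∘ (false ∷_)) (words N))
      ≡⟨ lemma _ _ _ _ ⟩
    (sumOver (φ ∘ wrap (true ∷ []) ∘ (true ∷_)) (words N) + sumOver (φ ∘ wrap (true ∷ []) ∘ (false ∷_)) (words N)) +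
    (sumOver (φ ∘ wrap (false ∷ []) ∘ (true ∷_)) (words N) + sumOver (φ ∘ wrap (false ∷ []) ∘ (false ∷_)) (words N))
      ≡⟨ cong₂ _+_ (sumOver-words N (φ ∘ wrap (true ∷ []))) (sumOver-words N (φ ∘ wrap (false ∷ []))) ⟨
    sumOver (φ ∘ wrap (true ∷ [])) (words (suc N)) + sumOver (φ ∘ wrap (false ∷ [])) (words (suc N)) ∎
    where
    opaque
      unfolding _+_
      lemma : ∀ a b c d → a + b + (c + d) ≡ a + c + (b + d)
      lemma = solve-∀

  positions-snoc-false : ∀ {n} (w : Vec Bool n) → positions (w ∷ʳ false) ≡ map (1ℤ +_) (positions w)
  positions-snoc-false []          = refl
  positions-snoc-false (false ∷ w) = positions-snoc-false w
  positions-snoc-false {suc n} (true ∷ w) = cong₂ _∷_ (int-+ 1 n) (positions-snoc-false w)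

  positions-snoc-true : ∀ {n} (w : Vec Bool n) →
    positions (w ∷ʳ true) ≡ map (1ℤ +_) (positions w) ++ [ 0ℤ ]
  positions-snoc-true []          = refl
  positions-snoc-true (false ∷ w) = positions-snoc-true w
  positions-snoc-true {suc n} (true ∷ w) = cong₂ _∷_ (int-+ 1 n) (positions-snoc-true w)

  productOver-++ : ∀ f xs ys → productOver f (xs ++ ys) ≡ productOver f xs * productOver f ys
  productOver-++ f []       ys = sym (*-identityˡ _)
  productOver-++ f (x ∷ xs) ys = trans (cong (f x *_) (productOver-++ f xs ys)) (sym (*-assoc _ _ _))

  productOver-map : ∀ f (g : ℤ → ℤ) xs → productOver f (map g xs) ≡ productOver (f ∘ g) xs
  productOver-map f g []       = refl
  productOver-map f g (x ∷ xs) = cong (f (g x) *_) (productOver-map f g xs)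

  productOver-cong : ∀ {f g} xs → (∀ x → f x ≡ g x) → productOver f xs ≡ productOver g xs
  productOver-cong []       eq = refl
  productOver-cong (x ∷ xs) eq = cong₂ _*_ (eq x) (productOver-cong xs eq)

  productOver-* : ∀ f g xs → productOver (λ x → f x * g x) xs ≡ productOver f xs * productOver g xs
  productOver-* f g []       = sym (*-identityˡ 1ℤ)
  productOver-* f g (x ∷ xs) = trans (cong (f x * g x *_) (productOver-* f g xs)) (lemma _ _ _ _)
    where
    opaque
      unfolding _+_
      lemma : ∀ a b c d → a * b * (c * d) ≡ a * c * (b * d)
      lemma = solve-∀

  vandermonde-shift : ∀ xs → vandermonde (map (1ℤ +_) xs) ≡ vandermonde xs
  vandermonde-shift []       = refl
  vandermonde-shift (x ∷ xs) = cong₂ _*_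
    (trans (productOver-map _ (1ℤ +_) xs) (productOver-cong xs (lemma x)))
    (vandermonde-shift xs)
    where
    opaque
      unfolding _+_
      lemma : ∀ x y → 1ℤ + x - (1ℤ + y) ≡ x - y
      lemma = solve-∀

  vandermonde-snoc : ∀ xs y → vandermonde (xs ++ [ y ]) ≡ vandermonde xs * productOver (_- y) xs
  vandermonde-snoc []       y = refl
  vandermonde-snoc (x ∷ xs) y = trans
    (cong₂ _*_ (productOver-++ (x -_) xs [ y ]) (vandermonde-snoc xs y))
    (lemma _ _ _ _)
    where
    opaque
      unfolding _+_
      lemma : ∀ p x v q → p * (x * 1ℤ) * (v * q) ≡ p * v * (x * q)
      lemma = solve-∀

  squared : ℤ → ℤ
  squared x = x * x

  -- The row wrap c m is a palindrome with centre c.  Its two entries given by the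
  -- element s of support m are 2s + γ apart; node s is, up to a constant, the square
  -- of their distance from the centre.
  module Palindrome {k : ℕ} (c : Vec Bool k) where

    γ : ℤ
    γ = 1ℤ + int k

    node : ℤ → ℤ
    node s = s * (s + γ)

    -- The product of the distances from position `t` of a row of length `n` to a symmetric pair of
    -- places outside the row, at `n + r` and `-1 - r`.
    reflected : ℤ → ℤ → ℤ → ℤ
    reflected n r t = (n + r - t) * (t + 1ℤ + r)

    centre : ℤ → ℤ
    centre r = productOver (reflected (int k) r) (positions c)

    weight : ℤ → ℤ
    weight s = (s + s + γ) * centre s

    energy : List ℕ → ℤ
    energy S = productOver weight (map int S) * squared (vandermonde (map node (map int S)))

    reflected-inner : ∀ n r ps → productOver (reflected (int 2 + n) r) (map (1ℤ +_) ps) ≡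
      productOver (reflected n (1ℤ + r)) ps
    reflected-inner n r ps = trans (productOver-map _ (1ℤ +_) ps) (productOver-cong ps (lemma n r))
      where
      opaque
        unfolding _+_
        lemma : ∀ n r t → (int 2 + n + r - (1ℤ + t)) * (1ℤ + t + 1ℤ + r) ≡ (n + (1ℤ + r) - t) * (t + 1ℤ + (1ℤ + r))
        lemma = solve-∀

    -- Between two symmetric pairs, with parameters `z` and `s`, there are four distances: `z - s`
    -- and `z + s + γ`, each twice. Their product is the squared difference of the nodes. The
    -- induction peels off the outer layer of the row, which moves the outside pair one place
    -- further away and raises `r`.
    reflected-wrap : ∀ {N} (m : Vec Bool N) r →
      productOver (reflected (int (pad N k)) r) (positions (wrap c m)) ≡
      centre (int N + r) * productOver (λ s → squared (node (int N + r) - node s)) (map int (support m))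
    reflected-wrap [] r = trans
      (cong centre (sym (+-identityˡ r)))
      (sym (*-identityʳ _))
    reflected-wrap {suc N} (false ∷ m) r
      rewrite positions-snoc-false (wrap c m) | int-+ 2 (pad N k) = begin
      productOver (reflected (int 2 + int (pad N k)) r) (map (1ℤ +_) (positions (wrap c m)))
        ≡⟨ reflected-inner (int (pad N k)) r (positions (wrap c m)) ⟩
      productOver (reflected (int (pad N k)) (1ℤ + r)) (positions (wrap c m))
        ≡⟨ reflected-wrap m (1ℤ + r) ⟩
      centre (int N + (1ℤ + r)) * productOver (λ s → squared (node (int N + (1ℤ + r)) - node s)) (map int (support m))
        ≡⟨ cong (λ x → centre x * productOver (λ s → squared (node x - node s)) (map int (support m)))
             (trans (lemma (int N) r) (cong (_+ r) (sym (int-+ 1 N)))) ⟩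
      centre (int (suc N) + r) * productOver (λ s → squared (node (int (suc N) + r) - node s)) (map int (support m)) ∎
      where
      opaque
        unfolding _+_
        lemma : ∀ n r → n + (1ℤ + r) ≡ 1ℤ + n + r
        lemma = solve-∀
    reflected-wrap {suc N} (true ∷ m) r
      rewrite positions-snoc-true (wrap c m) | int-+ 2 (pad N k) | int-+ 1 (pad N k) = begin
      (int 2 + n + r - (1ℤ + n)) * (1ℤ + n + 1ℤ + r) *
        productOver (reflected (int 2 + n) r) (map (1ℤ +_) ps ++ [ 0ℤ ])
        ≡⟨ cong ((int 2 + n + r - (1ℤ + n)) * (1ℤ + n + 1ℤ + r) *_)
             (trans (productOver-++ _ (map (1ℤ +_) ps) [ 0ℤ ])
               (cong (_* ((int 2 + n + r - 0ℤ) * (0ℤ + 1ℤ + r) * 1ℤ))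
                 (trans (reflected-inner n r ps) (reflected-wrap m (1ℤ + r))))) ⟩
      (int 2 + n + r - (1ℤ + n)) * (1ℤ + n + 1ℤ + r) *
        (centre (int N + (1ℤ + r)) * Π (int N + (1ℤ + r)) * ((int 2 + n + r - 0ℤ) * (0ℤ + 1ℤ + r) * 1ℤ))
        ≡⟨ cong₂ (λ x y → (int 2 + y + r - (1ℤ + y)) * (1ℤ + y + 1ℤ + r) *
             (centre x * Π x * ((int 2 + y + r - 0ℤ) * (0ℤ + 1ℤ + r) * 1ℤ)))
             (trans (lemma₁ (int N) r) (cong (_+ r) (sym (int-+ 1 N)))) (int-pad N k) ⟩
      (int 2 + n′ + r - (1ℤ + n′)) * (1ℤ + n′ + 1ℤ + r) *
        (centre z * Π z * ((int 2 + n′ + r - 0ℤ) * (0ℤ + 1ℤ + r) * 1ℤ))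
        ≡⟨ lemma₂ (int N) (int k) r (centre z) (Π z) ⟩
      centre z * (squared (node (1ℤ + int N + r) - node (int N)) * Π z)
        ≡⟨ cong (λ y → centre z * (squared (node (y + r) - node (int N)) * Π z)) (sym (int-+ 1 N)) ⟩
      centre z * (squared (node z - node (int N)) * Π z) ∎
      where
      n = int (pad N k)
      n′ = int N + int N + int k
      z = int (suc N) + r
      ps = positions (wrap c m)
      Π : ℤ → ℤ
      Π x = productOver (λ s → squared (node x - node s)) (map int (support m))
      opaque
        unfolding _+_
        lemma₁ : ∀ n r → n + (1ℤ + r) ≡ 1ℤ + n + r
        lemma₁ = solve-∀
        lemma₂ : ∀ n k r c p →
          (int 2 + (n + n + k) + r - (1ℤ + (n + n + k))) * (1ℤ + (n + n + k) + 1ℤ + r) *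
            (c * p * ((int 2 + (n + n + k) + r - 0ℤ) * (0ℤ + 1ℤ + r) * 1ℤ)) ≡
          c * (((1ℤ + n + r) * (1ℤ + n + r + (1ℤ + k)) - n * (n + (1ℤ + k))) *
               ((1ℤ + n + r) * (1ℤ + n + r + (1ℤ + k)) - n * (n + (1ℤ + k))) * p)
        lemma₂ = solve-∀

    squared-product : ∀ f xs → productOver (squared ∘ f) xs ≡ squared (productOver f xs)
    squared-product f xs = productOver-* f f xs

    -- A new outer pair brings its own distance `N + N + γ`, its distances to the centre, and
    -- squared node differences to the other pairs: exactly the new factors of `energy`.
    vandermonde-wrap : vandermonde (positions c) ≡ 1ℤ → ∀ {N} (m : Vec Bool N) →
      vandermonde (positions (wrap c m)) ≡ energy (support m)
    vandermonde-wrap base [] = trans base (lemma)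
      where
      lemma : 1ℤ ≡ 1ℤ * (1ℤ * 1ℤ)
      lemma = sym (trans (*-identityˡ _) (*-identityˡ 1ℤ))
    vandermonde-wrap base (false ∷ m) rewrite positions-snoc-false (wrap c m) =
      trans (vandermonde-shift (positions (wrap c m))) (vandermonde-wrap base m)
    vandermonde-wrap base {suc N} (true ∷ m) rewrite positions-snoc-true (wrap c m) = begin
      productOver (int (suc (pad N k)) -_) (map (1ℤ +_) ps ++ [ 0ℤ ]) * vandermonde (map (1ℤ +_) ps ++ [ 0ℤ ])
        ≡⟨ cong₂ _*_ (productOver-++ _ (map (1ℤ +_) ps) [ 0ℤ ]) (vandermonde-snoc (map (1ℤ +_) ps) 0ℤ) ⟩
      (productOver (int (suc (pad N k)) -_) (map (1ℤ +_) ps) * ((int (suc (pad N k)) - 0ℤ) * 1ℤ)) *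
      (vandermonde (map (1ℤ +_) ps) * productOver (_- 0ℤ) (map (1ℤ +_) ps))
        ≡⟨ cong₂ (λ x y → (x * ((int (suc (pad N k)) - 0ℤ) * 1ℤ)) * (vandermonde (map (1ℤ +_) ps) * y))
             (trans (productOver-map _ (1ℤ +_) ps) (productOver-cong ps (λ t → trans (cong (_- (1ℤ + t)) (int-+ 1 (pad N k))) (lemma₁ n t))))
             (trans (productOver-map _ (1ℤ +_) ps) (productOver-cong ps lemma₂)) ⟩
      (productOver (λ t → n + 0ℤ - t) ps * ((int (suc (pad N k)) - 0ℤ) * 1ℤ)) *
      (vandermonde (map (1ℤ +_) ps) * productOver (λ t → t + 1ℤ + 0ℤ) ps)
        ≡⟨ lemma₃ _ (int (suc (pad N k))) _ _ ⟩
      int (suc (pad N k)) * (productOver (λ t → n + 0ℤ - t) ps * productOver (λ t → t + 1ℤ + 0ℤ) ps) * vandermonde (map (1ℤ +_) ps)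
        ≡⟨ cong₂ (λ x y → int (suc (pad N k)) * x * y)
             (trans (sym (productOver-* _ _ ps)) (reflected-wrap m 0ℤ))
             (trans (vandermonde-shift ps) (vandermonde-wrap base m)) ⟩
      int (suc (pad N k)) * (centre (int N + 0ℤ) * productOver (λ s → squared (node (int N + 0ℤ) - node s)) S) *
        (productOver weight S * squared (vandermonde (map node S)))
        ≡⟨ cong₂ (λ x y → x * (centre y * productOver (λ s → squared (node y - node s)) S) *
             (productOver weight S * squared (vandermonde (map node S))))
             (trans (int-+ 1 (pad N k)) (trans (cong (1ℤ +_) (int-pad N k)) (lemma₄ (int N) (int k))))
             (+-identityʳ (int N)) ⟩
      (int N + int N + γ) * (centre (int N) * productOver (λ s → squared (node (int N) - node s)) S) *
        (productOver weight S * squared (vandermonde (map node S)))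
        ≡⟨ cong (λ x → (int N + int N + γ) * (centre (int N) * x) * (productOver weight S * squared (vandermonde (map node S))))
             (trans (squared-product (λ s → node (int N) - node s) S)
                    (cong squared (sym (productOver-map (node (int N) -_) node S)))) ⟩
      (int N + int N + γ) * (centre (int N) * squared (productOver (node (int N) -_) (map node S))) *
        (productOver weight S * squared (vandermonde (map node S)))
        ≡⟨ lemma₅ (int N + int N + γ) (centre (int N)) _ _ _ ⟩
      weight (int N) * productOver weight S *
        squared (productOver (node (int N) -_) (map node S) * vandermonde (map node S)) ∎
      where
      n = int (pad N k)
      ps = positions (wrap c m)
      S = map int (support m)
      opaque
        unfolding _+_
        lemma₁ : ∀ n t → 1ℤ + n - (1ℤ + t) ≡ n + 0ℤ - t
        lemma₁ = solve-∀
        lemma₂ : ∀ t → 1ℤ + t - 0ℤ ≡ t + 1ℤ + 0ℤ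
        lemma₂ = solve-∀
        lemma₃ : ∀ a b c d → a * ((b - 0ℤ) * 1ℤ) * (c * d) ≡ b * (a * d) * c
        lemma₃ = solve-∀
        lemma₄ : ∀ n k → 1ℤ + (n + n + k) ≡ n + n + (1ℤ + k)
        lemma₄ = solve-∀
        lemma₅ : ∀ a c p w v → a * (c * (p * p)) * (w * (v * v)) ≡ a * c * w * ((p * v) * (p * v))
        lemma₅ = solve-∀

    length-wrap : ∀ {N} (m : Vec Bool N) →
      length (positions (wrap c m)) ≡ pad (length (support m)) (length (positions c))
    length-wrap []          = refl
    length-wrap (false ∷ m) rewrite positions-snoc-false (wrap c m) =
      trans (length-map (1ℤ +_) (positions (wrap c m))) (length-wrap m)
    length-wrap (true ∷ m)  rewrite positions-snoc-true (wrap c m) =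
      cong suc (trans (length-++ (map (1ℤ +_) (positions (wrap c m))))
        (trans (ℕₚ.+-comm _ 1)
          (cong suc (trans (length-map (1ℤ +_) (positions (wrap c m))) (length-wrap m)))))

    pad-injective : ∀ m n j → pad m j ≡ pad n j → m ≡ n
    pad-injective m n j eq = halve m n (trans (sym (pad-+ m)) (trans eq (pad-+ n)))
      where
      pad-+ : ∀ m → pad m j ≡ (m ℕ.+ m) ℕ.+ j
      pad-+ zero    = refl
      pad-+ (suc m) = cong suc (trans (cong suc (pad-+ m)) (cong (ℕ._+ j) (sym (ℕₚ.+-suc m m))))
      halve : ∀ m n → (m ℕ.+ m) ℕ.+ j ≡ (n ℕ.+ n) ℕ.+ j → m ≡ n
      halve m n eq = double m n (ℕₚ.+-cancelʳ-≡ j _ _ eq)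
        where
        double : ∀ m n → m ℕ.+ m ≡ n ℕ.+ n → m ≡ n
        double zero    zero    eq = refl
        double (suc m) (suc n) eq = cong suc (double m n (ℕₚ.suc-injective (ℕₚ.suc-injective
          (trans (cong suc (sym (ℕₚ.+-suc m m))) (trans eq (cong suc (ℕₚ.+-suc n n)))))))

    sum-wrap : vandermonde (positions c) ≡ 1ℤ → ∀ N n →
      sumOver (λ m → det (pad n (length (positions c))) (map power (positions (wrap c m)))) (words N) ≡
      sumOver energy (choose n (downFrom N))
    sum-wrap base N n = sum-words N n _ energy
      (λ m l → trans
        (det-powers _ _ (trans (length-wrap m) (cong (λ j → pad j _) l)))
        (vandermonde-wrap base m))
      (λ m l≢ → det-wrongSize _ _ λ eq → l≢ (pad-injective _ _ _
        (trans (sym (length-wrap m)) (trans (sym (length-map power (positions (wrap c m)))) eq))))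

    sum-wrap-parity : ∀ N a → (∀ n → pad n (length (positions c)) ≢ a) →
      sumOver (λ m → det a (map power (positions (wrap c m)))) (words N) ≡ 0ℤ
    sum-wrap-parity N a ≢a = sumOver-zero (words N) λ m → det-wrongSize a _ λ eq →
      ≢a (length (support m)) (trans (sym (length-wrap m))
        (trans (sym (length-map power (positions (wrap c m)))) eq))

  -- Integrating out one variable

  sumOver-+ : ∀ {A : Set} (f g : A → ℤ) xs → sumOver (λ x → f x + g x) xs ≡ sumOver f xs + sumOver g xs
  sumOver-+ f g []       = sym (+-identityˡ 0ℤ)
  sumOver-+ f g (x ∷ xs) = trans (cong (f x + g x +_) (sumOver-+ f g xs)) (lemma _ _ _ _)
    where
    opaque
      unfolding _+_
      lemma : ∀ a b c d → a + b + (c + d) ≡ a + c + (b + d)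
      lemma = solve-∀

  module _ {A : Set} where

    sumOver-choose : ∀ {f g : List A → ℤ} n xs → (∀ S → length S ≡ n → f S ≡ g S) →
      sumOver f (choose n xs) ≡ sumOver g (choose n xs)
    sumOver-choose         zero    xs       eq = cong (_+ 0ℤ) (eq [] refl)
    sumOver-choose         (suc n) []       eq = refl
    sumOver-choose {f} {g} (suc n) (x ∷ xs) eq = begin
      sumOver f (map (x ∷_) (choose n xs) ++ choose (suc n) xs)
        ≡⟨ sumOver-++ f (map (x ∷_) (choose n xs)) _ ⟩
      sumOver f (map (x ∷_) (choose n xs)) + sumOver f (choose (suc n) xs)
        ≡⟨ cong₂ _+_
             (trans (sumOver-map (x ∷_) f (choose n xs))
               (trans (sumOver-choose n xs (λ S l → eq (x ∷ S) (cong suc l)))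
                 (sym (sumOver-map (x ∷_) g (choose n xs)))))
             (sumOver-choose (suc n) xs eq) ⟩
      sumOver g (map (x ∷_) (choose n xs)) + sumOver g (choose (suc n) xs)
        ≡⟨ sumOver-++ g (map (x ∷_) (choose n xs)) _ ⟨
      sumOver g (map (x ∷_) (choose n xs) ++ choose (suc n) xs) ∎

    pickSum : (A → List A → ℤ) → List A → ℤ
    pickSum g []       = 0ℤ
    pickSum g (x ∷ xs) = g x xs + pickSum (λ y R → g y (x ∷ R)) xs

    pickSum-cong : ∀ {g h : A → List A → ℤ} xs → (∀ {x R} → Pick x R xs → g x R ≡ h x R) →
      pickSum g xs ≡ pickSum h xs
    pickSum-cong []       eq = refl
    pickSum-cong (x ∷ xs) eq = cong₂ _+_ (eq here) (pickSum-cong xs (eq ∘ there))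

    pickSum-* : ∀ k (g : A → List A → ℤ) xs → pickSum (λ x R → k * g x R) xs ≡ k * pickSum g xs
    pickSum-* k g []       = sym (*-zeroʳ k)
    pickSum-* k g (x ∷ xs) = trans (cong (k * g x xs +_) (pickSum-* k (λ y R → g y (x ∷ R)) xs))
      (sym (*-distribˡ-+ k _ _))

    -- Distinguishing an element of an `(n + 1)`-subset means choosing an `n`-subset and an element
    -- outside it. Since `G` vanishes on elements of the subset, that element may run freely over
    -- `xs`.
    pickSum-choose : ∀ n xs (G : A → List A → ℤ) → (∀ {x S} → x ∈ S → G x S ≡ 0ℤ) →
      sumOver (pickSum G) (choose (suc n) xs) ≡
      sumOver (λ S → sumOver (λ x → G x S) xs) (choose n xs)
    pickSum-choose n []       G G0 = sym (sumOver-zero (choose n []) λ _ → refl)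
    pickSum-choose n (x ∷ xs) G G0 = begin
      sumOver (pickSum G) (map (x ∷_) (choose n xs) ++ choose (suc n) xs)
        ≡⟨ sumOver-++ (pickSum G) (map (x ∷_) (choose n xs)) _ ⟩
      sumOver (pickSum G) (map (x ∷_) (choose n xs)) + sumOver (pickSum G) (choose (suc n) xs)
        ≡⟨ cong₂ _+_
             (trans (sumOver-map (x ∷_) (pickSum G) (choose n xs))
               (sumOver-+ (G x) (pickSum (λ y R → G y (x ∷ R))) (choose n xs)))
             (pickSum-choose n xs G G0) ⟩
      (sumOver (G x) (choose n xs) + sumOver (pickSum (λ y R → G y (x ∷ R))) (choose n xs)) +
        sumOver (λ S → sumOver (λ y → G y S) xs) (choose n xs)
        ≡⟨ rest n ⟩
      sumOver (λ S → G x S + sumOver (λ y → G y S) xs) (choose n (x ∷ xs)) ∎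
      where
      rest : ∀ n →
        (sumOver (G x) (choose n xs) + sumOver (pickSum (λ y R → G y (x ∷ R))) (choose n xs)) +
          sumOver (λ S → sumOver (λ y → G y S) xs) (choose n xs)
        ≡ sumOver (λ S → G x S + sumOver (λ y → G y S) xs) (choose n (x ∷ xs))
      rest zero    = lemma _ _
        where
        opaque
          unfolding _+_
          lemma : ∀ a b → a + 0ℤ + (0ℤ + 0ℤ) + (b + 0ℤ) ≡ a + b + 0ℤ
          lemma = solve-∀
      rest (suc n) = begin
        (sumOver (G x) (choose (suc n) xs) + sumOver (pickSum (λ y R → G y (x ∷ R))) (choose (suc n) xs)) +
          sumOver (λ S → sumOver (λ y → G y S) xs) (choose (suc n) xs)
          ≡⟨ cong (λ z → sumOver (G x) (choose (suc n) xs) + z + sumOver (λ S → sumOver (λ y → G y S) xs) (choose (suc n) xs))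
               (trans (pickSum-choose n xs (λ y R → G y (x ∷ R)) (G0 ∘ there))
                 (sumOver-cong (choose n xs) λ R →
                   sym (trans (cong (_+ sumOver (λ y → G y (x ∷ R)) xs) (G0 (here refl))) (+-identityˡ _)))) ⟩
        (sumOver (G x) (choose (suc n) xs) + sumOver (λ R → G x (x ∷ R) + sumOver (λ y → G y (x ∷ R)) xs) (choose n xs)) +
          sumOver (λ S → sumOver (λ y → G y S) xs) (choose (suc n) xs)
          ≡⟨ lemma _ _ _ ⟩
        sumOver (λ R → G x (x ∷ R) + sumOver (λ y → G y (x ∷ R)) xs) (choose n xs) +
          (sumOver (G x) (choose (suc n) xs) + sumOver (λ S → sumOver (λ y → G y S) xs) (choose (suc n) xs))
          ≡⟨ cong₂ _+_ (sumOver-map (x ∷_) _ (choose n xs)) (sumOver-+ (G x) _ (choose (suc n) xs)) ⟨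
        sumOver (λ S → G x S + sumOver (λ y → G y S) xs) (map (x ∷_) (choose n xs)) +
          sumOver (λ S → G x S + sumOver (λ y → G y S) xs) (choose (suc n) xs)
          ≡⟨ sumOver-++ _ (map (x ∷_) (choose n xs)) _ ⟨
        sumOver (λ S → G x S + sumOver (λ y → G y S) xs) (map (x ∷_) (choose n xs) ++ choose (suc n) xs) ∎
        where
        opaque
          unfolding _+_
          lemma : ∀ a b c → a + b + c ≡ b + (a + c)
          lemma = solve-∀

    pick-map : ∀ {B : Set} (f : A → B) {x R xs} → Pick x R xs → Pick (f x) (map f R) (map f xs)
    pick-map f here      = here
    pick-map f (there p) = there (pick-map f p)

  productOver-zero : ∀ {x} {xs : List ℤ} → x ∈ xs → productOver (x -_) xs ≡ 0ℤ
  productOver-zero {x} {_ ∷ xs} (here refl) = trans (cong (_* productOver (x -_) xs) (-‿self x)) (*-zeroˡ _)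
  productOver-zero {x} {y ∷ xs} (there x∈)  = trans (cong ((x - y) *_) (productOver-zero x∈)) (*-zeroʳ (x - y))

  -- Up to sign, `vandermonde S` is the product of the differences `x - r` times `vandermonde R`.
  -- This sign is the one with which `x` is expanded, so the alternating sum becomes an ordinary
  -- one.
  vandermonde-expand : ∀ (g : ℤ → List ℤ → ℤ) S →
    vandermonde S * alternatingSum (λ x R → g x R * vandermonde R) S ≡
    pickSum (λ x R → g x R * (productOver (x -_) R * squared (vandermonde R))) S
  vandermonde-expand g []       = *-zeroʳ 1ℤ
  vandermonde-expand g (a ∷ S) = begin
    P S * V S * (g a S * V S - alternatingSum (λ x R → g x (a ∷ R) * (P R * V R)) S)
      ≡⟨ cong (λ z → P S * V S * (g a S * V S - z))
           (alt-cong S λ {x} {R} _ → sym (*-assoc (g x (a ∷ R)) (P R) (V R))) ⟩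
    P S * V S * (g a S * V S - alternatingSum (λ x R → g x (a ∷ R) * P R * V R) S)
      ≡⟨ lemma₁ _ _ _ _ ⟩
    g a S * (P S * squared (V S)) + (0ℤ - P S) * (V S * alternatingSum (λ x R → g x (a ∷ R) * P R * V R) S)
      ≡⟨ cong (λ z → g a S * (P S * squared (V S)) + (0ℤ - P S) * z)
           (vandermonde-expand (λ x R → g x (a ∷ R) * P R) S) ⟩
    g a S * (P S * squared (V S)) +
      (0ℤ - P S) * pickSum (λ x R → g x (a ∷ R) * P R * (productOver (x -_) R * squared (V R))) S
      ≡⟨ cong (g a S * (P S * squared (V S)) +_) (pickSum-* (0ℤ - P S) _ S) ⟨
    g a S * (P S * squared (V S)) +
      pickSum (λ x R → (0ℤ - P S) * (g x (a ∷ R) * P R * (productOver (x -_) R * squared (V R)))) S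
      ≡⟨ cong (g a S * (P S * squared (V S)) +_) (pickSum-cong S λ {x} {R} p →
           trans (cong (λ z → (0ℤ - z) * (g x (a ∷ R) * P R * (productOver (x -_) R * squared (V R))))
                    (productOver-pick (a -_) p))
             (lemma₂ a x (P R) (g x (a ∷ R)) (productOver (x -_) R) (V R))) ⟩
    g a S * (P S * squared (V S)) +
      pickSum (λ x R → g x (a ∷ R) * ((x - a) * productOver (x -_) R * squared (P R * V R))) S ∎
    where
    P V : List ℤ → ℤ
    P = productOver (a -_)
    V = vandermonde
    opaque
      unfolding _+_
      lemma₁ : ∀ p v g s → p * v * (g * v - s) ≡ g * (p * (v * v)) + (0ℤ - p) * (v * s)
      lemma₁ = solve-∀
      lemma₂ : ∀ a x p g q v → (0ℤ - (a - x) * p) * (g * p * (q * (v * v))) ≡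
        g * ((x - a) * q * ((p * v) * (p * v)))
      lemma₂ = solve-∀

  pickSum-map : ∀ {A B : Set} (f : A → B) (g : B → List B → ℤ) xs →
    pickSum g (map f xs) ≡ pickSum (λ x R → g (f x) (map f R)) xs
  pickSum-map f g []       = refl
  pickSum-map f g (x ∷ xs) = cong (g (f x) (map f xs) +_) (pickSum-map f (λ y R → g y (f x ∷ R)) xs)

  module Contraction (weight node : ℤ → ℤ) where

    energy : List ℕ → ℤ
    energy S = productOver weight (map int S) * squared (vandermonde (map node (map int S)))

    -- Expanding one of the two Vandermonde factors along its last row, in the
    -- form of Lagrange interpolation for p, integrates out one variable.
    contraction : ∀ {p ℓ h} n xs → IsPoly n ℓ p →
      (∀ S → length S ≡ n →
        sumOver (λ s → weight (int s) * (p (node (int s)) * productOver (node (int s) -_) S)) xs ≡ h) →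
      ℓ * sumOver energy (choose (suc n) xs) ≡ h * sumOver energy (choose n xs)
    contraction {p} {ℓ} {h} n xs ip integral = begin
      ℓ * sumOver energy (choose (suc n) xs)
        ≡⟨ sumOver-* ℓ energy (choose (suc n) xs) ⟨
      sumOver (λ S → ℓ * energy S) (choose (suc n) xs)
        ≡⟨ sumOver-choose (suc n) xs expand ⟩
      sumOver (pickSum G) (choose (suc n) xs)
        ≡⟨ pickSum-choose n xs G G-zero ⟩
      sumOver (λ S → sumOver (λ s → G s S) xs) (choose n xs)
        ≡⟨ sumOver-choose n xs (λ S l → begin
             sumOver (λ s → G s S) xs
               ≡⟨ sumOver-cong xs (λ s → *-comm _ (energy S)) ⟩
             sumOver (λ s → energy S * (weight (int s) * (p (node (int s)) * productOver (node (int s) -_) (nodes S)))) xs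
               ≡⟨ sumOver-* (energy S) _ xs ⟩
             energy S * sumOver (λ s → weight (int s) * (p (node (int s)) * productOver (node (int s) -_) (nodes S))) xs
               ≡⟨ cong (energy S *_) (integral (nodes S) (trans (length-map node (map int S)) (trans (length-map int S) l))) ⟩
             energy S * h
               ≡⟨ *-comm (energy S) h ⟩
             h * energy S ∎) ⟩
      sumOver (λ S → h * energy S) (choose n xs)
        ≡⟨ sumOver-* h energy (choose n xs) ⟩
      h * sumOver energy (choose n xs) ∎
      where
      nodes : List ℕ → List ℤ
      nodes S = map node (map int S)
      G : ℕ → List ℕ → ℤ
      G s R = weight (int s) * (p (node (int s)) * productOver (node (int s) -_) (nodes R)) * energy R
      ∈-nodes : ∀ {s S} → s ∈ S → node (int s) ∈ nodes S
      ∈-nodes (here refl) = here refl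
      ∈-nodes (there s∈)  = there (∈-nodes s∈)
      G-zero : ∀ {s S} → s ∈ S → G s S ≡ 0ℤ
      G-zero {s} {S} s∈ = trans
        (cong (λ z → weight (int s) * (p (node (int s)) * z) * energy S) (productOver-zero (∈-nodes s∈)))
        (lemma (weight (int s)) (p (node (int s))) (energy S))
        where
        opaque
          unfolding _+_
          lemma : ∀ a b c → a * (b * 0ℤ) * c ≡ 0ℤ
          lemma = solve-∀
      expand : ∀ S → length S ≡ suc n → ℓ * energy S ≡ pickSum G S
      expand S l = begin
        ℓ * (W * squared V)
          ≡⟨ lemma₁ ℓ W V ⟩
        W * (V * (ℓ * V))
          ≡⟨ cong (λ z → W * (V * z)) (lagrange-interpolation n ip (nodes S)
               (trans (length-map node (map int S)) (trans (length-map int S) l))) ⟨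
        W * (V * lagrange p (nodes S))
          ≡⟨ cong (W *_) (vandermonde-expand (λ x _ → p x) (nodes S)) ⟩
        W * pickSum (λ x R → p x * (productOver (x -_) R * squared (vandermonde R))) (nodes S)
          ≡⟨ cong (W *_) (trans (pickSum-map node _ (map int S)) (pickSum-map int _ S)) ⟩
        W * pickSum (λ s R → p (node (int s)) * (productOver (node (int s) -_) (nodes R) * squared (vandermonde (nodes R)))) S
          ≡⟨ pickSum-* W _ S ⟨
        pickSum (λ s R → W * (p (node (int s)) * (productOver (node (int s) -_) (nodes R) * squared (vandermonde (nodes R))))) S
          ≡⟨ pickSum-cong S (λ {s} {R} pk → trans
               (cong (_* (p (node (int s)) * (productOver (node (int s) -_) (nodes R) * squared (vandermonde (nodes R)))))
                 (productOver-pick weight (pick-map int pk)))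
               (lemma₂ (weight (int s)) _ (p (node (int s))) _ _)) ⟩
        pickSum G S ∎
        where
        W = productOver weight (map int S)
        V = vandermonde (nodes S)
        opaque
          unfolding _+_
          lemma₁ : ∀ l w v → l * (w * (v * v)) ≡ w * (v * (l * v))
          lemma₁ = solve-∀
          lemma₂ : ∀ a w p q v → a * w * (p * (q * v)) ≡ a * (p * q) * (w * v)
          lemma₂ = solve-∀

  -- Finite differences, rising and falling factorials

  difference : ℕ → (ℕ → ℤ) → ℤ
  difference zero    g = g 0
  difference (suc k) g = difference k g - difference k (g ∘ suc)

  difference-cong : ∀ k {g h} → (∀ j → j ≤ k → g j ≡ h j) → difference k g ≡ difference k h
  difference-cong zero    eq = eq 0 z≤n
  difference-cong (suc k) eq = cong₂ _-_
    (difference-cong k (λ j j≤k → eq j (ℕₚ.m≤n⇒m≤1+n j≤k)))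
    (difference-cong k (λ j j≤k → eq (suc j) (s≤s j≤k)))

  difference-- : ∀ k g h → difference k (λ j → g j - h j) ≡ difference k g - difference k h
  difference-- zero    g h = refl
  difference-- (suc k) g h = trans
    (cong₂ _-_ (difference-- k g h) (difference-- k (g ∘ suc) (h ∘ suc)))
    (lemma _ _ _ _)
    where
    opaque
      unfolding _+_
      lemma : ∀ a b c d → a - b - (c - d) ≡ a - c - (b - d)
      lemma = solve-∀

  difference-* : ∀ k c g → difference k (λ j → c * g j) ≡ c * difference k g
  difference-* zero    c g = refl
  difference-* (suc k) c g = trans
    (cong₂ _-_ (difference-* k c g) (difference-* k c (g ∘ suc)))
    (sym (*-distribˡ-- c _ _))

  difference-zero : ∀ k {g} → (∀ j → g j ≡ 0ℤ) → difference k g ≡ 0ℤ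
  difference-zero zero    eq = eq 0
  difference-zero (suc k) eq = trans (cong₂ _-_ (difference-zero k eq) (difference-zero k (eq ∘ suc))) (-‿self 0ℤ)

  sgn : ℕ → ℤ
  sgn zero    = 1ℤ
  sgn (suc k) = 0ℤ - sgn k

  sgn² : ∀ k → sgn k * sgn k ≡ 1ℤ
  sgn² zero    = *-identityˡ 1ℤ
  sgn² (suc k) = trans (lemma (sgn k)) (sgn² k)
    where
    opaque
      unfolding _+_
      lemma : ∀ s → (0ℤ - s) * (0ℤ - s) ≡ s * s
      lemma = solve-∀

  isPoly-- : ∀ d {ℓ m p q} → IsPoly d ℓ p → IsPoly d m q → IsPoly d (ℓ + -1ℤ * m) (λ x → p x - q x)
  isPoly-- d {p = p} {q} ip iq = isPoly-cong d (λ x → lemma (p x) (q x))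
    (isPoly-+ d ip (isPoly-scale d -1ℤ iq))
    where
    opaque
      unfolding _+_
      lemma : ∀ a b → a + -1ℤ * b ≡ a - b
      lemma = solve-∀

  -- The difference is the sum of the `g j` with binomial coefficients and signs `sgn j`; only
  -- `j = k` reaches the full degree. The offset `o` is needed in the induction, where the shifted
  -- family starts one degree higher.
  difference-isPoly : ∀ k o (ℓ : ℕ → ℤ) (g : ℕ → ℤ → ℤ) → (∀ j → IsPoly (o ℕ.+ j) (ℓ j) (g j)) →
    IsPoly (o ℕ.+ k) (sgn k * ℓ k) (λ x → difference k (λ j → g j x))
  difference-isPoly zero    o ℓ g ip =
    subst (λ l → IsPoly (o ℕ.+ 0) l (g 0)) (sym (*-identityˡ (ℓ 0))) (ip 0)
  difference-isPoly (suc k) o ℓ g ip rewrite ℕₚ.+-suc o k =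
    subst (λ l → IsPoly (suc (o ℕ.+ k)) l (λ x → difference (suc k) (λ j → g j x))) (lemma (sgn k) (ℓ (suc k)))
      (isPoly-- (suc (o ℕ.+ k))
        (isPoly-lift (o ℕ.+ k) (difference-isPoly k o ℓ g ip))
        (difference-isPoly k (suc o) (ℓ ∘ suc) (g ∘ suc)
          (λ j → subst (λ d → IsPoly d (ℓ (suc j)) (g (suc j))) (ℕₚ.+-suc o j) (ip (suc j)))))
    where
    opaque
      unfolding _+_
      lemma : ∀ s l → 0ℤ + -1ℤ * (s * l) ≡ (0ℤ - s) * l
      lemma = solve-∀

  isPoly-shift : ∀ d {ℓ p} → IsPoly d ℓ p → IsPoly d ℓ (λ x → p (1ℤ + x))
  isPoly-shift zero    ip x = ip (1ℤ + x)
  isPoly-shift (suc d) {p = p} ip a =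
    let q , iq , fac = ip (1ℤ + a)
    in  (λ x → q (1ℤ + x)) , isPoly-shift d iq , λ x →
        trans (fac (1ℤ + x)) (cong (λ z → p (1ℤ + a) + z * q (1ℤ + x)) (lemma x a))
    where
    opaque
      unfolding _+_
      lemma : ∀ x a → 1ℤ + x - (1ℤ + a) ≡ x - a
      lemma = solve-∀

  -- With `p x = p 0 + x * q x`, the difference becomes `x * (q x - q (1 + x)) - q (1 + x)`, where
  -- the bracket has smaller degree than `q` by induction.
  isPoly-delta : ∀ d {ℓ p} → IsPoly (suc d) ℓ p → ∃ λ m → IsPoly d m (λ x → p x - p (1ℤ + x))
  isPoly-delta d {ℓ} {p} ip with ip 0ℤ
  ... | q , iq , fac = go d iq
    where
    rewritten : ∀ x → (q x - q (1ℤ + x)) * (x - 0ℤ) - q (1ℤ + x) ≡ p x - p (1ℤ + x)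
    rewritten x = trans (lemma (p 0ℤ) (q x) (q (1ℤ + x)) x) (sym (cong₂ _-_ (fac x) (fac (1ℤ + x))))
      where
      opaque
        unfolding _+_
        lemma : ∀ c a b x → (a - b) * (x - 0ℤ) - b ≡ c + (x - 0ℤ) * a - (c + (1ℤ + x - 0ℤ) * b)
        lemma = solve-∀
    go : ∀ d → IsPoly d ℓ q → ∃ λ m → IsPoly d m (λ x → p x - p (1ℤ + x))
    go zero iq = 0ℤ - ℓ , λ x → trans (sym (rewritten x))
      (trans (cong₂ (λ a b → (a - b) * (x - 0ℤ) - b) (iq x) (iq (1ℤ + x))) (lemma ℓ x))
      where
      opaque
        unfolding _+_
        lemma : ∀ l x → (l - l) * (x - 0ℤ) - l ≡ 0ℤ - l
        lemma = solve-∀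
    go (suc d) iq with isPoly-delta d iq
    ... | m , im = _ , isPoly-cong (suc d) rewritten
      (isPoly-- (suc d) (isPoly-*linear d 0ℤ im) (isPoly-shift (suc d) iq))

  difference-poly : ∀ k d {ℓ p} → IsPoly d ℓ p → d < k → difference k (p ∘ int) ≡ 0ℤ
  difference-poly (suc k) d {ℓ} {p} ip d<k = trans (sym (difference-- k (p ∘ int) (p ∘ int ∘ suc))) (go d ip d<k)
    where
    go : ∀ d → IsPoly d ℓ p → d < suc k → difference k (λ j → p (int j) - p (int (suc j))) ≡ 0ℤ
    go zero    ip _         = difference-zero k λ j →
      trans (cong₂ _-_ (ip (int j)) (ip (int (suc j)))) (-‿self ℓ)
    go (suc d) ip (s≤s d<k) = trans
      (difference-cong k (λ j _ → cong (λ z → p (int j) - p z) (int-+ 1 j)))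
      (difference-poly k d (proj₂ (isPoly-delta d ip)) d<k)

  rising : ℕ → ℤ → ℤ
  rising zero    x = 1ℤ
  rising (suc n) x = rising n x * (x + int n)

  rising-suc : ∀ n x → rising (suc n) x ≡ x * rising n (1ℤ + x)
  rising-suc zero    x = lemma x
    where
    opaque
      unfolding _+_
      lemma : ∀ x → 1ℤ * (x + int 0) ≡ x * 1ℤ
      lemma = solve-∀
  rising-suc (suc n) x = begin
    rising (suc n) x * (x + int (suc n))
      ≡⟨ cong₂ (λ a b → a * (x + b)) (rising-suc n x) (int-+ 1 n) ⟩
    x * rising n (1ℤ + x) * (x + (1ℤ + int n))
      ≡⟨ lemma x _ (int n) ⟩
    x * (rising n (1ℤ + x) * (1ℤ + x + int n)) ∎
    where
    opaque
      unfolding _+_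
      lemma : ∀ x r n → x * r * (x + (1ℤ + n)) ≡ x * (r * (1ℤ + x + n))
      lemma = solve-∀

  rising-+ : ∀ m n x → rising (m ℕ.+ n) x ≡ rising m x * rising n (x + int m)
  rising-+ zero    n x = sym (trans (*-identityˡ _) (cong (rising n) (+-identityʳ x)))
  rising-+ (suc m) n x = begin
    rising (suc (m ℕ.+ n)) x
      ≡⟨ rising-suc (m ℕ.+ n) x ⟩
    x * rising (m ℕ.+ n) (1ℤ + x)
      ≡⟨ cong (x *_) (rising-+ m n (1ℤ + x)) ⟩
    x * (rising m (1ℤ + x) * rising n (1ℤ + x + int m))
      ≡⟨ cong (λ z → x * (rising m (1ℤ + x) * rising n z))
           (trans (lemma x (int m)) (cong (x +_) (sym (int-+ 1 m)))) ⟩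
    x * (rising m (1ℤ + x) * rising n (x + int (suc m)))
      ≡⟨ *-assoc _ _ _ ⟨
    x * rising m (1ℤ + x) * rising n (x + int (suc m))
      ≡⟨ cong (_* rising n (x + int (suc m))) (rising-suc m x) ⟨
    rising (suc m) x * rising n (x + int (suc m)) ∎
    where
    opaque
      unfolding _+_
      lemma : ∀ x m → 1ℤ + x + m ≡ x + (1ℤ + m)
      lemma = solve-∀

  falling-suc : ∀ n x → falling (suc n) x ≡ x * falling n (x - 1ℤ)
  falling-suc n x = begin
    falling (suc n) x                          ≡⟨ cong (falling (suc n)) (lemma x) ⟨
    falling (suc n) (1ℤ + (x - 1ℤ))            ≡⟨ falling-shift n (x - 1ℤ) ⟩
    (1ℤ + (x - 1ℤ)) * falling n (x - 1ℤ)       ≡⟨ cong (_* falling n (x - 1ℤ)) (lemma x) ⟩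
    x * falling n (x - 1ℤ)                     ∎
    where
    opaque
      unfolding _+_
      lemma : ∀ x → 1ℤ + (x - 1ℤ) ≡ x
      lemma = solve-∀

  falling-+ : ∀ m n x → falling (m ℕ.+ n) x ≡ falling m x * falling n (x - int m)
  falling-+ zero    n x = sym (trans (*-identityˡ _) (cong (falling n) (-‿identityʳ x)))
  falling-+ (suc m) n x = begin
    falling (suc (m ℕ.+ n)) x
      ≡⟨ falling-suc (m ℕ.+ n) x ⟩
    x * falling (m ℕ.+ n) (x - 1ℤ)
      ≡⟨ cong (x *_) (falling-+ m n (x - 1ℤ)) ⟩
    x * (falling m (x - 1ℤ) * falling n (x - 1ℤ - int m))
      ≡⟨ cong (λ z → x * (falling m (x - 1ℤ) * falling n z))
           (trans (lemma x (int m)) (cong (x -_) (sym (int-+ 1 m)))) ⟩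
    x * (falling m (x - 1ℤ) * falling n (x - int (suc m)))
      ≡⟨ *-assoc _ _ _ ⟨
    x * falling m (x - 1ℤ) * falling n (x - int (suc m))
      ≡⟨ cong (_* falling n (x - int (suc m))) (falling-suc m x) ⟨
    falling (suc m) x * falling n (x - int (suc m)) ∎
    where
    opaque
      unfolding _+_
      lemma : ∀ x m → x - 1ℤ - m ≡ x - (1ℤ + m)
      lemma = solve-∀

  falling-rising : ∀ k x → falling k (x + int k) ≡ rising k (1ℤ + x)
  falling-rising zero    x = refl
  falling-rising (suc k) x = begin
    falling (suc k) (x + int (suc k))
      ≡⟨ cong (λ z → falling (suc k) (x + z)) (int-+ 1 k) ⟩
    falling (suc k) (x + (1ℤ + int k))
      ≡⟨ falling-suc k _ ⟩
    (x + (1ℤ + int k)) * falling k (x + (1ℤ + int k) - 1ℤ)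
      ≡⟨ cong (λ z → (x + (1ℤ + int k)) * falling k z) (lemma₁ x (int k)) ⟩
    (x + (1ℤ + int k)) * falling k (x + int k)
      ≡⟨ cong ((x + (1ℤ + int k)) *_) (falling-rising k x) ⟩
    (x + (1ℤ + int k)) * rising k (1ℤ + x)
      ≡⟨ lemma₂ x (int k) _ ⟩
    rising k (1ℤ + x) * (1ℤ + x + int k) ∎
    where
    opaque
      unfolding _+_
      lemma₁ : ∀ x k → x + (1ℤ + k) - 1ℤ ≡ x + k
      lemma₁ = solve-∀
      lemma₂ : ∀ x k r → (x + (1ℤ + k)) * r ≡ r * (1ℤ + x + k)
      lemma₂ = solve-∀

  isPoly-*rising : ∀ n c d {ℓ p} → IsPoly d ℓ p → IsPoly (n ℕ.+ d) ℓ (λ x → p x * rising n (x + c))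
  isPoly-*rising zero    c d {p = p} ip = isPoly-cong d (λ x → sym (*-identityʳ (p x))) ip
  isPoly-*rising (suc n) c d {p = p} ip = isPoly-cong (suc n ℕ.+ d)
    (λ x → lemma (p x) (rising n (x + c)) x c (int n))
    (isPoly-*linear (n ℕ.+ d) (0ℤ - c - int n) (isPoly-*rising n c d ip))
    where
    opaque
      unfolding _+_
      lemma : ∀ p r x c n → p * r * (x - (0ℤ - c - n)) ≡ p * (r * (x + c + n))
      lemma = solve-∀

  falling-reflected-isPoly : ∀ n z → ∃ λ ℓ → IsPoly n ℓ (λ x → falling n (z - x))
  falling-reflected-isPoly zero    z = 1ℤ , λ x → refl
  falling-reflected-isPoly (suc n) z with falling-reflected-isPoly n z
  ... | ℓ , ip = -1ℤ * ℓ , isPoly-cong (suc n) (λ x → lemma (falling n (z - x)) z x (int n))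
    (isPoly-scale (suc n) -1ℤ (isPoly-*linear n (z - int n) ip))
    where
    opaque
      unfolding _+_
      lemma : ∀ f z x n → -1ℤ * (f * (x - (z - n))) ≡ f * (z - x - n)
      lemma = solve-∀

  -- The partial fraction expansion of the reciprocal of a rising factorial: the alternating
  -- binomial sum of `1 / (j + A)` is `k !` divided by `A (A + 1) … (A + k)`. Here `z j` stands for
  -- `F / (j + A)`.
  difference-reciprocal : ∀ k A F z → (∀ j → j ≤ k → (int j + A) * z j ≡ F) →
    difference k z * rising (suc k) A ≡ int (k !) * F
  difference-reciprocal zero A F z eq = trans (lemma (z 0) A) (cong (1ℤ *_) (eq 0 z≤n))
    where
    opaque
      unfolding _+_
      lemma : ∀ z a → z * (1ℤ * (a + int 0)) ≡ 1ℤ * ((int 0 + a) * z)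
      lemma = solve-∀
  difference-reciprocal (suc k) A F z eq = begin
    (D - D′) * rising (suc (suc k)) A
      ≡⟨ lemma₁ D D′ _ ⟩
    D * (rising (suc k) A * (A + int (suc k))) - D′ * rising (suc (suc k)) A
      ≡⟨ cong₂ _-_ (sym (*-assoc D _ _)) (cong (D′ *_) (rising-suc (suc k) A)) ⟩
    D * rising (suc k) A * (A + int (suc k)) - D′ * (A * rising (suc k) (1ℤ + A))
      ≡⟨ lemma₂ _ _ D′ A _ ⟩
    D * rising (suc k) A * (A + int (suc k)) - A * (D′ * rising (suc k) (1ℤ + A))
      ≡⟨ cong₂ (λ x y → x * (A + int (suc k)) - A * y)
           (difference-reciprocal k A F z (λ j j≤k → eq j (ℕₚ.m≤n⇒m≤1+n j≤k)))
           (difference-reciprocal k (1ℤ + A) F (z ∘ suc) λ j j≤k →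
             trans (cong (_* z (suc j)) (trans (lemma₃ (int j) A) (cong (_+ A) (sym (int-+ 1 j))))) (eq (suc j) (s≤s j≤k))) ⟩
    int (k !) * F * (A + int (suc k)) - A * (int (k !) * F)
      ≡⟨ lemma₄ (int (k !)) F A (int (suc k)) ⟩
    int (suc k) * int (k !) * F
      ≡⟨ cong (_* F) (int-* (suc k) (k !)) ⟨
    int (suc k !) * F ∎
    where
    D = difference k z
    D′ = difference k (z ∘ suc)
    opaque
      unfolding _+_
      lemma₁ : ∀ a b c → (a - b) * c ≡ a * c - b * c
      lemma₁ = solve-∀
      lemma₂ : ∀ x y d a r → x * y - d * (a * r) ≡ x * y - a * (d * r)
      lemma₂ = solve-∀
      lemma₃ : ∀ j a → j + (1ℤ + a) ≡ 1ℤ + j + a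
      lemma₃ = solve-∀
      lemma₄ : ∀ f F a s → f * F * (a + s) - a * (f * F) ≡ s * f * F
      lemma₄ = solve-∀

  -- Orthogonal polynomials on a quadratic lattice

  int-suc-nonzero : ∀ n → int (suc n) ≢ 0ℤ
  int-suc-nonzero n ()

  factorial-nonzero : ∀ n → int (n !) ≢ 0ℤ
  factorial-nonzero zero    ()
  factorial-nonzero (suc n) eq with i*j≡0⇒i≡0∨j≡0 (int (suc n)) {int (n !)} (trans (sym (int-* (suc n) (n !))) eq)
  ... | inj₂ n!≡0 = factorial-nonzero n n!≡0

  int-! : ∀ n → int (suc n !) ≡ (1ℤ + int n) * int (n !)
  int-! n = trans (int-* (suc n) (n !)) (cong (_* int (n !)) (int-+ 1 n))

  factorial-rising : ∀ m n → int ((m ℕ.+ n) !) ≡ int (m !) * rising n (1ℤ + int m)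
  factorial-rising m zero    = trans (cong (λ z → int (z !)) (ℕₚ.+-identityʳ m)) (sym (*-identityʳ _))
  factorial-rising m (suc n) = begin
    int ((m ℕ.+ suc n) !)
      ≡⟨ cong (λ z → int (z !)) (ℕₚ.+-suc m n) ⟩
    int (suc (m ℕ.+ n) !)
      ≡⟨ int-! (m ℕ.+ n) ⟩
    (1ℤ + int (m ℕ.+ n)) * int ((m ℕ.+ n) !)
      ≡⟨ cong₂ (λ x y → (1ℤ + x) * y) (int-+ m n) (factorial-rising m n) ⟩
    (1ℤ + (int m + int n)) * (int (m !) * rising n (1ℤ + int m))
      ≡⟨ lemma (int m) (int n) (int (m !)) _ ⟩
    int (m !) * (rising n (1ℤ + int m) * (1ℤ + int m + int n)) ∎
    where
    opaque
      unfolding _+_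
      lemma : ∀ m n f r → (1ℤ + (m + n)) * (f * r) ≡ f * (r * (1ℤ + m + n))
      lemma = solve-∀

  -- The pairing of the Newton bases at the two ends of 0, …, N-1 has a product
  -- formula; finite differences turn it into orthogonal polynomials.
  module QuadraticLattice (γ : ℤ) (e : ℕ) (weight κ κ′ : ℤ → ℤ)
    (mass-step : ∀ n → (1ℤ + n) * κ (1ℤ + n) ≡ (n + γ) * κ′ n)
    (telescope : ∀ n j → κ′ n * (n + γ + j) - κ n * (n - j) ≡ (j + 1ℤ + int e) * weight n) where

    node : ℤ → ℤ
    node s = s * (s + γ)

    open Contraction weight node

    -- The root shift that makes the recurrence of `pairing-product` close; see the factor
    -- `n - η - m` gained there.
    η : ℤ
    η = int 2 + int e - γ

    integral : ℕ → (ℤ → ℤ) → ℤ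
    integral N f = sumOver (λ s → weight (int s) * f (int s)) (downFrom N)

    integral-cong : ∀ N {f g} → (∀ s → f s ≡ g s) → integral N f ≡ integral N g
    integral-cong N eq = sumOver-cong (downFrom N) λ s → cong (weight (int s) *_) (eq (int s))

    integral-+ : ∀ N f g → integral N (λ s → f s + g s) ≡ integral N f + integral N g
    integral-+ N f g = trans
      (sumOver-cong (downFrom N) λ s → *-distribˡ-+ (weight (int s)) (f (int s)) (g (int s)))
      (sumOver-+ _ _ (downFrom N))

    integral-* : ∀ N c f → integral N (λ s → c * f s) ≡ c * integral N f
    integral-* N c f = trans
      (sumOver-cong (downFrom N) λ s → a*[b*c]≡b*[a*c] (weight (int s)) c (f (int s)))
      (sumOver-* c _ (downFrom N))

    integral-- : ∀ N f g → integral N (λ s → f s - g s) ≡ integral N f - integral N g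
    integral-- N f g = begin
      integral N (λ s → f s - g s)             ≡⟨ integral-cong N (λ s → lemma (f s) (g s)) ⟩
      integral N (λ s → f s + -1ℤ * g s)       ≡⟨ integral-+ N f (λ s → -1ℤ * g s) ⟩
      integral N f + integral N (λ s → -1ℤ * g s) ≡⟨ cong (integral N f +_) (integral-* N -1ℤ g) ⟩
      integral N f + -1ℤ * integral N g        ≡⟨ lemma _ _ ⟨
      integral N f - integral N g              ∎
      where
      opaque
        unfolding _+_
        lemma : ∀ a b → a - b ≡ a + -1ℤ * b
        lemma = solve-∀

    integral-difference : ∀ N k (g : ℕ → ℤ → ℤ) →
      integral N (λ s → difference k (λ j → g j s)) ≡ difference k (λ j → integral N (g j))
    integral-difference N zero    g = refl
    integral-difference N (suc k) g = trans
      (integral-- N (λ s → difference k (λ j → g j s)) (λ s → difference k (λ j → g (suc j) s)))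
      (cong₂ _-_ (integral-difference N k g) (integral-difference N k (g ∘ suc)))

    lower : ℕ → ℤ → ℤ
    lower zero    x = 1ℤ
    lower (suc j) x = lower j x * (x - node (int j))

    lower-node : ∀ j s → lower j (node s) ≡ falling j s * rising j (s + γ)
    lower-node zero    s = sym (*-identityˡ 1ℤ)
    lower-node (suc j) s = trans (cong (_* (node s - node (int j))) (lower-node j s))
      (lemma (falling j s) (rising j (s + γ)) s γ (int j))
      where
      opaque
        unfolding _+_
        lemma : ∀ f r s g j → f * r * (s * (s + g) - j * (j + g)) ≡ f * (s - j) * (r * (s + g + j))
        lemma = solve-∀

    lower-isPoly : ∀ j → IsPoly j 1ℤ (lower j)
    lower-isPoly zero    x = refl
    lower-isPoly (suc j)   = isPoly-*linear j (node (int j)) (lower-isPoly j)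

    -- By `integral-lower` with `j = 0`, this is `1 + e` times the total weight of the first `n`
    -- places.
    mass : ℤ → ℤ
    mass n = n * κ n

    -- The right-hand side is an antidifference of the weighted Newton polynomial: `telescope` gives
    -- the increment, and `mass-step` turns `κ′` at one place into `κ` at the next.
    integral-lower : ∀ N j → (int j + 1ℤ + int e) * integral N (lower j ∘ node) ≡
      mass (int N) * falling j (int N - 1ℤ) * rising j (int N + γ)
    integral-lower zero    j = lemma (int j + 1ℤ + int e) (κ 0ℤ) _ _
      where
      opaque
        unfolding _+_
        lemma : ∀ a k f r → a * 0ℤ ≡ 0ℤ * k * f * r
        lemma = solve-∀
    integral-lower (suc N) j = begin
      c * (weight n * lower j (node n) + integral N (lower j ∘ node))
        ≡⟨ lemma₁ c (weight n) _ _ ⟩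
      c * weight n * lower j (node n) + c * integral N (lower j ∘ node)
        ≡⟨ cong₂ _+_ (cong₂ _*_ (sym (telescope n (int j))) (lower-node j n)) (integral-lower N j) ⟩
      (κ′ n * (n + γ + int j) - κ n * (n - int j)) * (falling j n * rising j (n + γ)) +
        n * κ n * falling j (n - 1ℤ) * rising j (n + γ)
        ≡⟨ lemma₂ (κ′ n) (κ n) n γ (int j) (falling j n) (rising j (n + γ)) (falling j (n - 1ℤ)) ⟩
      κ′ n * falling j n * (rising j (n + γ) * (n + γ + int j)) -
        κ n * rising j (n + γ) * (falling j n * (n - int j)) + κ n * rising j (n + γ) * (n * falling j (n - 1ℤ))
        ≡⟨ cong₂ (λ x y → κ′ n * falling j n * x - κ n * rising j (n + γ) * y + κ n * rising j (n + γ) * (n * falling j (n - 1ℤ)))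
             (rising-suc j (n + γ)) (falling-suc j n) ⟩
      κ′ n * falling j n * ((n + γ) * rising j (1ℤ + (n + γ))) -
        κ n * rising j (n + γ) * (n * falling j (n - 1ℤ)) + κ n * rising j (n + γ) * (n * falling j (n - 1ℤ))
        ≡⟨ lemma₃ (κ′ n) (falling j n) (n + γ) _ _ ⟩
      (n + γ) * κ′ n * falling j n * rising j (1ℤ + (n + γ))
        ≡⟨ cong (λ x → x * falling j n * rising j (1ℤ + (n + γ))) (sym (mass-step n)) ⟩
      mass (1ℤ + n) * falling j n * rising j (1ℤ + (n + γ))
        ≡⟨ cong₂ (λ x y → mass (1ℤ + n) * falling j x * rising j y) (lemma₄ n) (sym (+-assoc 1ℤ n γ)) ⟩
      mass (1ℤ + n) * falling j (1ℤ + n - 1ℤ) * rising j (1ℤ + n + γ)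
        ≡⟨ cong (λ x → mass x * falling j (x - 1ℤ) * rising j (x + γ)) (int-+ 1 N) ⟨
      mass (int (suc N)) * falling j (int (suc N) - 1ℤ) * rising j (int (suc N) + γ) ∎
      where
      n = int N
      c = int j + 1ℤ + int e
      opaque
        unfolding _+_
        lemma₁ : ∀ c w l i → c * (w * l + i) ≡ c * w * l + c * i
        lemma₁ = solve-∀
        lemma₂ : ∀ k′ k n g j f r f′ → (k′ * (n + g + j) - k * (n - j)) * (f * r) + n * k * f′ * r ≡
          k′ * f * (r * (n + g + j)) - k * r * (f * (n - j)) + k * r * (n * f′)
        lemma₂ = solve-∀
        lemma₃ : ∀ k f g r z → k * f * (g * r) - z + z ≡ g * k * f * r
        lemma₃ = solve-∀
        lemma₄ : ∀ n → n ≡ 1ℤ + n - 1ℤ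
        lemma₄ = solve-∀

    module _ (N : ℕ) where

      n : ℤ
      n = int N

      upper : ℕ → ℤ → ℤ
      upper zero    x = 1ℤ
      upper (suc m) x = upper m x * (node (n - 1ℤ - int m) - x)

      pairing : ℕ → ℕ → ℤ
      pairing j m = integral N (λ s → lower j (node s) * upper m (node s))

      -- With `b` the next node index from the right, the new factor `node b - x` is split as
      -- `(node b - node j) - (x - node j)`; the first part is constant, the second extends
      -- `lower j`.
      pairing-step : ∀ j m → pairing j (suc m) ≡
        (n - 1ℤ - int m - int j) * (n - 1ℤ - int m + int j + γ) * pairing j m - pairing (suc j) m
      pairing-step j m = begin
        integral N (λ s → lower j (node s) * (upper m (node s) * (node b - node s)))
          ≡⟨ integral-cong N (λ s → lemma (lower j (node s)) (upper m (node s)) b γ (int j) (node s)) ⟩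
        integral N (λ s → (b - int j) * (b + int j + γ) * (lower j (node s) * upper m (node s)) -
          lower (suc j) (node s) * upper m (node s))
          ≡⟨ integral-- N (λ s → (b - int j) * (b + int j + γ) * (lower j (node s) * upper m (node s)))
               (λ s → lower (suc j) (node s) * upper m (node s)) ⟩
        integral N (λ s → (b - int j) * (b + int j + γ) * (lower j (node s) * upper m (node s))) - pairing (suc j) m
          ≡⟨ cong (_- pairing (suc j) m)
               (integral-* N _ (λ s → lower j (node s) * upper m (node s))) ⟩
        (b - int j) * (b + int j + γ) * pairing j m - pairing (suc j) m ∎
        where
        b = n - 1ℤ - int m
        opaque
          unfolding _+_
          lemma : ∀ l u b g j x → l * (u * (b * (b + g) - x)) ≡
            (b - j) * (b + j + g) * (l * u) - l * (x - j * (j + g)) * u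
          lemma = solve-∀

      -- Both terms of `pairing-step` share all but two linear factors. With `a = 1 + j + e` and
      -- `b = n + γ + j`, what remains is `(a + 1 + m) * (b - 1 - m) - a * b`, which equals
      -- `(1 + m) * (n - η - m)`.
      pairing-product : ∀ m j → int ((j ℕ.+ m ℕ.+ suc e) !) * pairing j m ≡
        mass n * int ((j ℕ.+ e) !) * int (m !) *
        (falling (j ℕ.+ m) (n - 1ℤ) * rising j (n + γ) * falling m (n - η))
      pairing-product zero j = begin
        int ((j ℕ.+ 0 ℕ.+ suc e) !) * pairing j 0
          ≡⟨ cong₂ _*_ (cong (λ i → int (i !)) (trans (cong (ℕ._+ suc e) (ℕₚ.+-identityʳ j)) (ℕₚ.+-suc j e)))
               (integral-cong N λ s → *-identityʳ (lower j (node s))) ⟩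
        int (suc (j ℕ.+ e) !) * integral N (lower j ∘ node)
          ≡⟨ cong (_* integral N (lower j ∘ node)) (trans (int-! (j ℕ.+ e)) (cong (λ x → (1ℤ + x) * int ((j ℕ.+ e) !)) (int-+ j e))) ⟩
        (1ℤ + (int j + int e)) * int ((j ℕ.+ e) !) * integral N (lower j ∘ node)
          ≡⟨ lemma₁ (int j) (int e) _ _ ⟩
        int ((j ℕ.+ e) !) * ((int j + 1ℤ + int e) * integral N (lower j ∘ node))
          ≡⟨ cong (int ((j ℕ.+ e) !) *_) (integral-lower N j) ⟩
        int ((j ℕ.+ e) !) * (mass n * falling j (n - 1ℤ) * rising j (n + γ))
          ≡⟨ lemma₂ _ _ _ _ ⟩
        mass n * int ((j ℕ.+ e) !) * 1ℤ * (falling j (n - 1ℤ) * rising j (n + γ) * 1ℤ)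
          ≡⟨ cong (λ i → mass n * int ((j ℕ.+ e) !) * 1ℤ * (falling i (n - 1ℤ) * rising j (n + γ) * 1ℤ)) (ℕₚ.+-identityʳ j) ⟨
        mass n * int ((j ℕ.+ e) !) * 1ℤ * (falling (j ℕ.+ 0) (n - 1ℤ) * rising j (n + γ) * 1ℤ) ∎
        where
        opaque
          unfolding _+_
          lemma₁ : ∀ j e f i → (1ℤ + (j + e)) * f * i ≡ f * ((j + 1ℤ + e) * i)
          lemma₁ = solve-∀
          lemma₂ : ∀ f k a r → f * (k * a * r) ≡ k * f * 1ℤ * (a * r * 1ℤ)
          lemma₂ = solve-∀
      pairing-product (suc m) j = begin
        int ((j ℕ.+ suc m ℕ.+ suc e) !) * pairing j (suc m)
          ≡⟨ cong₂ _*_ (cong (λ i → int ((i ℕ.+ suc e) !)) (ℕₚ.+-suc j m)) (pairing-step j m) ⟩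
        int (suc J !) * (A * pairing j m - pairing (suc j) m)
          ≡⟨ *-distribˡ-- (int (suc J !)) _ _ ⟩
        int (suc J !) * (A * pairing j m) - int (suc J !) * pairing (suc j) m
          ≡⟨ cong₂ _-_ (trans (cong (_* (A * pairing j m)) (int-! J)) (lemma₁ _ _ _ _)) (pairing-product m (suc j)) ⟩
        (1ℤ + int J) * A * (int (J !) * pairing j m) -
          mass n * int (suc (j ℕ.+ e) !) * int (m !) * (f * (n - 1ℤ - int (j ℕ.+ m)) * (r * (n + γ + int j)) * falling m (n - η))
          ≡⟨ cong₂ (λ x y → (1ℤ + int J) * A * x - y) (pairing-product m j)
               (cong₂ (λ x y → mass n * x * int (m !) * (f * (n - 1ℤ - y) * (r * (n + γ + int j)) * falling m (n - η)))
                 (trans (int-! (j ℕ.+ e)) (cong (λ x → (1ℤ + x) * int ((j ℕ.+ e) !)) (int-+ j e))) (int-+ j m)) ⟩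
        (1ℤ + int J) * A * (mass n * F * int (m !) * (f * r * falling m (n - η))) -
          mass n * ((1ℤ + (int j + int e)) * F) * int (m !) * (f * (n - 1ℤ - (int j + int m)) * (r * (n + γ + int j)) * falling m (n - η))
          ≡⟨ cong (λ x → (1ℤ + x) * A * (mass n * F * int (m !) * (f * r * falling m (n - η))) -
               mass n * ((1ℤ + (int j + int e)) * F) * int (m !) * (f * (n - 1ℤ - (int j + int m)) * (r * (n + γ + int j)) * falling m (n - η)))
               (trans (int-+ (j ℕ.+ m) (suc e)) (cong₂ _+_ (int-+ j m) (int-+ 1 e))) ⟩
        (1ℤ + (int j + int m + (1ℤ + int e))) * A * (mass n * F * int (m !) * (f * r * falling m (n - η))) -
          mass n * ((1ℤ + (int j + int e)) * F) * int (m !) * (f * (n - 1ℤ - (int j + int m)) * (r * (n + γ + int j)) * falling m (n - η))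
          ≡⟨ lemma₂ n γ (int j) (int m) (int e) (mass n) F (int (m !)) f r (falling m (n - η)) ⟩
        mass n * F * ((1ℤ + int m) * int (m !)) * (f * (n - 1ℤ - (int j + int m)) * r * (falling m (n - η) * (n - η - int m)))
          ≡⟨ cong₂ (λ x y → mass n * F * x * (f * (n - 1ℤ - y) * r * (falling m (n - η) * (n - η - int m)))) (int-! m) (int-+ j m) ⟨
        mass n * F * int (suc m !) * (falling (suc (j ℕ.+ m)) (n - 1ℤ) * r * falling (suc m) (n - η))
          ≡⟨ cong (λ i → mass n * F * int (suc m !) * (falling i (n - 1ℤ) * r * falling (suc m) (n - η))) (ℕₚ.+-suc j m) ⟨
        mass n * F * int (suc m !) * (falling (j ℕ.+ suc m) (n - 1ℤ) * r * falling (suc m) (n - η)) ∎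
        where
        J = j ℕ.+ m ℕ.+ suc e
        A = (n - 1ℤ - int m - int j) * (n - 1ℤ - int m + int j + γ)
        F = int ((j ℕ.+ e) !)
        f = falling (j ℕ.+ m) (n - 1ℤ)
        r = rising j (n + γ)
        opaque
          unfolding _+_
          lemma₁ : ∀ a b c d → a * b * (c * d) ≡ a * c * (b * d)
          lemma₁ = solve-∀
          lemma₂ : ∀ n g j m e k F M f r h →
            (1ℤ + (j + m + (1ℤ + e))) * ((n - 1ℤ - m - j) * (n - 1ℤ - m + j + g)) * (k * F * M * (f * r * h)) -
            k * ((1ℤ + (j + e)) * F) * M * (f * (n - 1ℤ - (j + m)) * (r * (n + g + j)) * h) ≡
            k * F * ((1ℤ + m) * M) * (f * (n - 1ℤ - (j + m)) * r * (h * (n - (int 2 + e - g) - m)))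
          lemma₂ = solve-∀

      module _ (k : ℕ) where

        -- Completes `falling j (n - 1)` and `rising j (n + γ)` from `pairing-product` to the
        -- products of `k` factors, which no longer depend on `j` and move into `constant`.
        tail : ℕ → ℤ
        tail j = falling (k ∸ j) (n - 1ℤ - int j) * rising (k ∸ j) (n + γ + int j)

        -- Chosen so that coefficient j * pairing j m is, for m < k, a polynomial in j
        -- of degree less than k.
        coefficient : ℕ → ℤ
        coefficient j = rising k (1ℤ + int (j ℕ.+ e)) * tail j

        orthogonal : ℤ → ℤ
        orthogonal x = difference k (λ j → coefficient j * lower j x)

        orthogonal-isPoly : IsPoly k (sgn k * rising k (1ℤ + int (k ℕ.+ e))) orthogonal
        orthogonal-isPoly = subst (λ l → IsPoly k l orthogonal)
          (cong (sgn k *_) (trans (*-identityʳ _) (trans (cong (rising k (1ℤ + int (k ℕ.+ e)) *_) tail-k) (*-identityʳ _))))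
          (difference-isPoly k 0 (λ j → coefficient j * 1ℤ) (λ j x → coefficient j * lower j x)
            (λ j → isPoly-scale j (coefficient j) (lower-isPoly j)))
          where
          tail-k : tail k ≡ 1ℤ
          tail-k rewrite ℕₚ.n∸n≡0 k = *-identityˡ 1ℤ

        constant : ℕ → ℤ
        constant m = mass n * int (m !) * falling m (n - η) * (falling k (n - 1ℤ) * rising k (n + γ))

        coefficient-pairing : ∀ m j → j ≤ k → int ((j ℕ.+ m ℕ.+ suc e) !) * (coefficient j * pairing j m) ≡
          constant m * (int ((j ℕ.+ e ℕ.+ k) !) * falling m (n - 1ℤ - int j))
        coefficient-pairing m j j≤k = begin
          int ((j ℕ.+ m ℕ.+ suc e) !) * (coefficient j * pairing j m)
            ≡⟨ a*[b*c]≡b*[a*c] _ (coefficient j) _ ⟩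
          coefficient j * (int ((j ℕ.+ m ℕ.+ suc e) !) * pairing j m)
            ≡⟨ cong (coefficient j *_) (pairing-product m j) ⟩
          coefficient j * (mass n * int ((j ℕ.+ e) !) * int (m !) *
            (falling (j ℕ.+ m) (n - 1ℤ) * rising j (n + γ) * falling m (n - η)))
            ≡⟨ cong (λ x → coefficient j * (mass n * int ((j ℕ.+ e) !) * int (m !) * (x * rising j (n + γ) * falling m (n - η))))
                 (falling-+ j m (n - 1ℤ)) ⟩
          coefficient j * (mass n * int ((j ℕ.+ e) !) * int (m !) *
            (falling j (n - 1ℤ) * falling m (n - 1ℤ - int j) * rising j (n + γ) * falling m (n - η)))
            ≡⟨ lemma (rising k (1ℤ + int (j ℕ.+ e))) (falling (k ∸ j) (n - 1ℤ - int j)) (rising (k ∸ j) (n + γ + int j))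
                 (mass n) (int ((j ℕ.+ e) !)) (int (m !)) (falling j (n - 1ℤ)) (falling m (n - 1ℤ - int j))
                 (rising j (n + γ)) (falling m (n - η)) ⟩
          mass n * int (m !) * falling m (n - η) *
            ((falling j (n - 1ℤ) * falling (k ∸ j) (n - 1ℤ - int j)) * (rising j (n + γ) * rising (k ∸ j) (n + γ + int j))) *
            ((int ((j ℕ.+ e) !) * rising k (1ℤ + int (j ℕ.+ e))) * falling m (n - 1ℤ - int j))
            ≡⟨ cong₂ (λ x y → mass n * int (m !) * falling m (n - η) * x * (y * falling m (n - 1ℤ - int j)))
                 (cong₂ _*_
                   (trans (sym (falling-+ j (k ∸ j) (n - 1ℤ))) (cong (λ i → falling i (n - 1ℤ)) (ℕₚ.m+[n∸m]≡n j≤k)))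
                   (trans (sym (rising-+ j (k ∸ j) (n + γ))) (cong (λ i → rising i (n + γ)) (ℕₚ.m+[n∸m]≡n j≤k))))
                 (sym (factorial-rising (j ℕ.+ e) k)) ⟩
          constant m * (int ((j ℕ.+ e ℕ.+ k) !) * falling m (n - 1ℤ - int j)) ∎
          where
          opaque
            unfolding _+_
            lemma : ∀ a t u k e m f g r h → a * (t * u) * (k * e * m * (f * g * r * h)) ≡
              k * m * h * ((f * t) * (r * u)) * ((e * a) * g)
            lemma = solve-∀

        integral-orthogonal : ∀ m → integral N (λ s → orthogonal (node s) * upper m (node s)) ≡
          difference k (λ j → coefficient j * pairing j m)
        integral-orthogonal m = begin
          integral N (λ s → orthogonal (node s) * upper m (node s))
            ≡⟨ integral-cong N (λ s → trans (*-comm _ (upper m (node s))) (sym (difference-* k (upper m (node s)) (λ j → coefficient j * lower j (node s))))) ⟩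
          integral N (λ s → difference k (λ j → upper m (node s) * (coefficient j * lower j (node s))))
            ≡⟨ integral-difference N k (λ j s → upper m (node s) * (coefficient j * lower j (node s))) ⟩
          difference k (λ j → integral N (λ s → upper m (node s) * (coefficient j * lower j (node s))))
            ≡⟨ difference-cong k (λ j _ → trans
                 (integral-cong N λ s → lemma (upper m (node s)) (coefficient j) (lower j (node s)))
                 (integral-* N (coefficient j) (λ s → lower j (node s) * upper m (node s)))) ⟩
          difference k (λ j → coefficient j * pairing j m) ∎
          where
          opaque
            unfolding _+_
            lemma : ∀ u c l → u * (c * l) ≡ c * (l * u)
            lemma = solve-∀

        -- The quotient of `(j + e + k) !` by `(j + m + e + 1) !` is a polynomial in `j` of degree
        -- `k - m - 1`. Multiplied by a falling factorial of degree `m`, it has degree `k - 1`,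
        -- which the `k`-th difference annihilates.
        orthogonality : ∀ m → m < k → integral N (λ s → orthogonal (node s) * upper m (node s)) ≡ 0ℤ
        orthogonality m m<k with ℕₚ.m≤n⇒∃[o]m+o≡n m<k
        ... | d , eq = begin
          integral N (λ s → orthogonal (node s) * upper m (node s))
            ≡⟨ integral-orthogonal m ⟩
          difference k (λ j → coefficient j * pairing j m)
            ≡⟨ difference-cong k polynomial ⟩
          difference k (λ j → constant m * (falling m (n - 1ℤ - int j) * rising d (int j + c)))
            ≡⟨ difference-* k (constant m) _ ⟩
          constant m * difference k (λ j → falling m (n - 1ℤ - int j) * rising d (int j + c))
            ≡⟨ cong (constant m *_) (difference-poly k (d ℕ.+ m)
                 (isPoly-*rising d c m (proj₂ (falling-reflected-isPoly m (n - 1ℤ))))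
                 (ℕₚ.≤-reflexive (trans (cong suc (ℕₚ.+-comm d m)) eq))) ⟩
          constant m * 0ℤ
            ≡⟨ *-zeroʳ (constant m) ⟩
          0ℤ ∎
          where
          c = int 2 + int m + int e
          polynomial : ∀ j → j ≤ k → coefficient j * pairing j m ≡
            constant m * (falling m (n - 1ℤ - int j) * rising d (int j + c))
          polynomial j j≤k = *-cancelˡ (int ((j ℕ.+ m ℕ.+ suc e) !)) (factorial-nonzero (j ℕ.+ m ℕ.+ suc e)) (begin
            int ((j ℕ.+ m ℕ.+ suc e) !) * (coefficient j * pairing j m)
              ≡⟨ coefficient-pairing m j j≤k ⟩
            constant m * (int ((j ℕ.+ e ℕ.+ k) !) * falling m (n - 1ℤ - int j))
              ≡⟨ cong (λ x → constant m * (x * falling m (n - 1ℤ - int j)))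
                   (trans (cong (λ i → int (i !)) index) (factorial-rising (j ℕ.+ m ℕ.+ suc e) d)) ⟩
            constant m * (int ((j ℕ.+ m ℕ.+ suc e) !) * rising d (1ℤ + int (j ℕ.+ m ℕ.+ suc e)) * falling m (n - 1ℤ - int j))
              ≡⟨ lemma₁ _ _ _ _ ⟩
            int ((j ℕ.+ m ℕ.+ suc e) !) * (constant m * (falling m (n - 1ℤ - int j) * rising d (1ℤ + int (j ℕ.+ m ℕ.+ suc e))))
              ≡⟨ cong (λ x → int ((j ℕ.+ m ℕ.+ suc e) !) * (constant m * (falling m (n - 1ℤ - int j) * rising d x)))
                   (trans (cong (1ℤ +_) (trans (int-+ (j ℕ.+ m) (suc e)) (cong₂ _+_ (int-+ j m) (int-+ 1 e))))
                     (lemma₂ (int j) (int m) (int e))) ⟩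
            int ((j ℕ.+ m ℕ.+ suc e) !) * (constant m * (falling m (n - 1ℤ - int j) * rising d (int j + c))) ∎)
            where
            index : j ℕ.+ e ℕ.+ k ≡ j ℕ.+ m ℕ.+ suc e ℕ.+ d
            index = trans (cong (j ℕ.+ e ℕ.+_) (sym eq)) (arrange j e m d)
              where
              arrange : ∀ j e m d → j ℕ.+ e ℕ.+ suc (m ℕ.+ d) ≡ j ℕ.+ m ℕ.+ suc e ℕ.+ d
              arrange = solveℕ
            opaque
              unfolding _+_
              lemma₁ : ∀ c f r g → c * (f * r * g) ≡ f * (c * (g * r))
              lemma₁ = solve-∀
              lemma₂ : ∀ j m e → 1ℤ + (j + m + (1ℤ + e)) ≡ j + (int 2 + m + e)
              lemma₂ = solve-∀

        norm : ℤ
        norm = integral N (λ s → orthogonal (node s) * upper k (node s))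

        reciprocalShift : ℤ
        reciprocalShift = 1ℤ + int (k ℕ.+ e)

        -- At `m = k` the quotient of factorials is no longer a polynomial but `1 / (j + A)`. The
        -- difference then sees only the value of the falling factorial at the pole `j = -A`.
        norm-product : norm * rising (suc k) reciprocalShift ≡
          int (k !) * (constant k * rising k (n + int e + 1ℤ))
        norm-product = begin
          norm * rising (suc k) A
            ≡⟨ cong (_* rising (suc k) A) (integral-orthogonal k) ⟩
          difference k y * rising (suc k) A
            ≡⟨ remove-polynomial k refl ⟩
          int (k !) * (constant k * falling k (n - 1ℤ - (0ℤ - A)))
            ≡⟨ cong (λ x → int (k !) * (constant k * x))
                 (trans (cong (falling k) (trans (cong (λ x → n - 1ℤ - (0ℤ - (1ℤ + x))) (int-+ k e)) (lemma₁ n (int k) (int e))))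
                   (trans (falling-rising k (n + int e)) (cong (rising k) (+-comm 1ℤ (n + int e))))) ⟩
          int (k !) * (constant k * rising k (n + int e + 1ℤ)) ∎
          where
          A = reciprocalShift
          y : ℕ → ℤ
          y j = coefficient j * pairing j k
          f : ℤ → ℤ
          f x = falling k (n - 1ℤ - x)
          opaque
            unfolding _+_
            lemma₁ : ∀ n k e → n - 1ℤ - (0ℤ - (1ℤ + (k + e))) ≡ n + e + k
            lemma₁ = solve-∀
          y-reciprocal : ∀ j → j ≤ k → (int j + A) * y j ≡ constant k * f (int j)
          y-reciprocal j j≤k = *-cancelˡ (int ((j ℕ.+ e ℕ.+ k) !)) (factorial-nonzero (j ℕ.+ e ℕ.+ k)) (begin
            int ((j ℕ.+ e ℕ.+ k) !) * ((int j + A) * y j)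
              ≡⟨ *-assoc _ _ _ ⟨
            int ((j ℕ.+ e ℕ.+ k) !) * (int j + A) * y j
              ≡⟨ cong (_* y j) (trans (*-comm _ (int j + A)) (trans
                   (cong (_* int ((j ℕ.+ e ℕ.+ k) !))
                     (trans (lemma₂ (int j) (int (k ℕ.+ e))) (cong (1ℤ +_) (sym (trans (cong int (arrange j e k)) (int-+ j (k ℕ.+ e)))))))
                   (trans (sym (int-! (j ℕ.+ e ℕ.+ k))) (cong (λ i → int (i !)) (arrange′ j e k))))) ⟩
            int ((j ℕ.+ k ℕ.+ suc e) !) * y j
              ≡⟨ coefficient-pairing k j j≤k ⟩
            constant k * (int ((j ℕ.+ e ℕ.+ k) !) * f (int j))
              ≡⟨ a*[b*c]≡b*[a*c] (constant k) _ _ ⟩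
            int ((j ℕ.+ e ℕ.+ k) !) * (constant k * f (int j)) ∎)
            where
            arrange : ∀ j e k → j ℕ.+ e ℕ.+ k ≡ j ℕ.+ (k ℕ.+ e)
            arrange = solveℕ
            arrange′ : ∀ j e k → suc (j ℕ.+ e ℕ.+ k) ≡ j ℕ.+ k ℕ.+ suc e
            arrange′ = solveℕ
            opaque
              unfolding _+_
              lemma₂ : ∀ j a → j + (1ℤ + a) ≡ 1ℤ + (j + a)
              lemma₂ = solve-∀
          -- f agrees with f (-A) up to a multiple of x + A, whose cofactor has
          -- degree below k and is annihilated by the difference.
          remove-polynomial : ∀ k′ → k′ ≡ k →
            difference k y * rising (suc k) A ≡ int (k !) * (constant k * f (0ℤ - A))
          remove-polynomial zero refl = difference-reciprocal 0 A _ y λ j j≤0 →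
            trans (y-reciprocal j j≤0) refl
          remove-polynomial (suc k′) refl =
            let q , iq , fac = proj₂ (falling-reflected-isPoly k (n - 1ℤ)) (0ℤ - A) in begin
            difference k y * rising (suc k) A
              ≡⟨ cong (_* rising (suc k) A) (begin
                   difference k y
                     ≡⟨ lemma₃ (difference k y) (constant k) ⟩
                   difference k y - constant k * 0ℤ
                     ≡⟨ cong (λ x → difference k y - constant k * x) (difference-poly k k′ iq (ℕₚ.n<1+n k′)) ⟨
                   difference k y - constant k * difference k (q ∘ int)
                     ≡⟨ cong (difference k y -_) (difference-* k (constant k) (q ∘ int)) ⟨
                   difference k y - difference k (λ j → constant k * q (int j))
                     ≡⟨ difference-- k y _ ⟨
                   difference k (λ j → y j - constant k * q (int j)) ∎) ⟩
            difference k (λ j → y j - constant k * q (int j)) * rising (suc k) A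
              ≡⟨ difference-reciprocal k A (constant k * f (0ℤ - A)) _ (λ j j≤k → begin
                   (int j + A) * (y j - constant k * q (int j))
                     ≡⟨ *-distribˡ-- _ _ _ ⟩
                   (int j + A) * y j - (int j + A) * (constant k * q (int j))
                     ≡⟨ cong (_- (int j + A) * (constant k * q (int j))) (trans (y-reciprocal j j≤k) (cong (constant k *_) (fac (int j)))) ⟩
                   constant k * (f (0ℤ - A) + (int j - (0ℤ - A)) * q (int j)) - (int j + A) * (constant k * q (int j))
                     ≡⟨ lemma₄ (constant k) (f (0ℤ - A)) (int j) A (q (int j)) ⟩
                   constant k * f (0ℤ - A) ∎) ⟩
            int (k !) * (constant k * f (0ℤ - A)) ∎
            where
            opaque
              unfolding _+_
              lemma₃ : ∀ d c → d ≡ d - c * 0ℤ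
              lemma₃ = solve-∀
              lemma₄ : ∀ c f j a q → c * (f + (j - (0ℤ - a)) * q) - (j + a) * (c * q) ≡ c * f
              lemma₄ = solve-∀

        -- Dividing `g` at the next right-hand node trades one degree for one factor of `upper`, and
        -- the constant part dies by orthogonality. Each trade changes the sign, since `upper` is
        -- built from `ρ - x` and not `x - ρ`.
        newton-integral : ∀ d m {ℓ g} → m ℕ.+ d ≡ k → IsPoly d ℓ g →
          integral N (λ s → orthogonal (node s) * upper m (node s) * g (node s)) ≡ sgn d * ℓ * norm
        newton-integral zero    m {ℓ} {g} eq ig with trans (sym (ℕₚ.+-identityʳ m)) eq
        ... | refl = begin
          integral N (λ s → orthogonal (node s) * upper k (node s) * g (node s))
            ≡⟨ integral-cong N (λ s → trans (cong (orthogonal (node s) * upper k (node s) *_) (ig (node s))) (*-comm _ ℓ)) ⟩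
          integral N (λ s → ℓ * (orthogonal (node s) * upper k (node s)))
            ≡⟨ integral-* N ℓ (λ s → orthogonal (node s) * upper k (node s)) ⟩
          ℓ * norm
            ≡⟨ cong (_* norm) (*-identityˡ ℓ) ⟨
          1ℤ * ℓ * norm ∎
        newton-integral (suc d) m {ℓ} {g} eq ig with ig (node (n - 1ℤ - int m))
        ... | q , iq , fac = begin
          integral N (λ s → orthogonal (node s) * upper m (node s) * g (node s))
            ≡⟨ integral-cong N (λ s → trans (cong (orthogonal (node s) * upper m (node s) *_) (fac (node s)))
                 (lemma₁ (orthogonal (node s)) (upper m (node s)) (g ρ) (node s) ρ (q (node s)))) ⟩
          integral N (λ s → g ρ * (orthogonal (node s) * upper m (node s)) -
            orthogonal (node s) * upper (suc m) (node s) * q (node s))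
            ≡⟨ integral-- N (λ s → g ρ * (orthogonal (node s) * upper m (node s)))
                 (λ s → orthogonal (node s) * upper (suc m) (node s) * q (node s)) ⟩
          integral N (λ s → g ρ * (orthogonal (node s) * upper m (node s))) -
            integral N (λ s → orthogonal (node s) * upper (suc m) (node s) * q (node s))
            ≡⟨ cong₂ _-_
                 (trans (integral-* N (g ρ) (λ s → orthogonal (node s) * upper m (node s))) (cong (g ρ *_)
                   (orthogonality m (ℕₚ.≤-trans (ℕₚ.m≤m+n (suc m) d) (ℕₚ.≤-reflexive eq′)))))
                 (newton-integral d (suc m) eq′ iq) ⟩
          g ρ * 0ℤ - sgn d * ℓ * norm
            ≡⟨ lemma₂ (g ρ) (sgn d) ℓ norm ⟩
          sgn (suc d) * ℓ * norm ∎
          where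
          ρ = node (n - 1ℤ - int m)
          eq′ : suc m ℕ.+ d ≡ k
          eq′ = trans (sym (ℕₚ.+-suc m d)) eq
          opaque
            unfolding _+_
            lemma₁ : ∀ o u g x r q → o * u * (g + (x - r) * q) ≡ g * (o * u) - o * (u * (r - x)) * q
            lemma₁ = solve-∀
            lemma₂ : ∀ g s l h → g * 0ℤ - s * l * h ≡ (0ℤ - s) * l * h
            lemma₂ = solve-∀

        product-isPoly : ∀ S → IsPoly (length S) 1ℤ (λ x → productOver (x -_) S)
        product-isPoly []      x = refl
        product-isPoly (r ∷ S)   = isPoly-cong (suc (length S)) (λ x → *-comm _ (x - r))
          (isPoly-*linear (length S) r (product-isPoly S))

        -- `contraction` applied to `orthogonal`: the quotient of consecutive sums is the norm over
        -- the leading coefficient. Both carry the sign `sgn k`, which is removed by multiplying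
        -- with it once more.
        selberg-step :
          rising k reciprocalShift * rising (suc k) reciprocalShift * sumOver energy (choose (suc k) (downFrom N)) ≡
          int (k !) * int (k !) * mass n * (rising k (n + γ) * falling k (n - 1ℤ) * falling k (n - η) * rising k (n + int e + 1ℤ)) *
            sumOver energy (choose k (downFrom N))
        selberg-step = begin
          L * rising (suc k) A * E′
            ≡⟨ *-identityˡ (L * rising (suc k) A * E′) ⟨
          1ℤ * (L * rising (suc k) A * E′)
            ≡⟨ cong (_* (L * rising (suc k) A * E′)) (sgn² k) ⟨
          sgn k * sgn k * (L * rising (suc k) A * E′)
            ≡⟨ lemma₂ (sgn k) L _ E′ ⟩
          sgn k * rising (suc k) A * (sgn k * L * E′)
            ≡⟨ cong (sgn k * rising (suc k) A *_) (contraction k (downFrom N) orthogonal-isPoly integrate) ⟩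
          sgn k * rising (suc k) A * (sgn k * 1ℤ * norm * E)
            ≡⟨ lemma₃ (sgn k) (rising (suc k) A) norm E ⟩
          sgn k * sgn k * (norm * rising (suc k) A) * E
            ≡⟨ cong₂ (λ x y → x * y * E) (sgn² k) norm-product ⟩
          1ℤ * (int (k !) * (constant k * rising k (n + int e + 1ℤ))) * E
            ≡⟨ lemma₄ (int (k !)) (mass n) (falling k (n - η)) (falling k (n - 1ℤ)) (rising k (n + γ)) _ E ⟩
          int (k !) * int (k !) * mass n * (rising k (n + γ) * falling k (n - 1ℤ) * falling k (n - η) * rising k (n + int e + 1ℤ)) * E ∎
          where
          A = reciprocalShift
          L = rising k A
          E = sumOver energy (choose k (downFrom N))
          E′ = sumOver energy (choose (suc k) (downFrom N))
          integrate : ∀ S → length S ≡ k →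
            sumOver (λ s → weight (int s) * (orthogonal (node (int s)) * productOver (node (int s) -_) S)) (downFrom N) ≡
            sgn k * 1ℤ * norm
          integrate S l = trans
            (integral-cong N (λ s → cong (_* productOver (node s -_) S) (sym (*-identityʳ (orthogonal (node s))))))
            (newton-integral k 0 refl (subst (λ d → IsPoly d 1ℤ (λ x → productOver (x -_) S)) l (product-isPoly S)))
          opaque
            unfolding _+_
            lemma₂ : ∀ s l r e → s * s * (l * r * e) ≡ s * r * (s * l * e)
            lemma₂ = solve-∀
            lemma₃ : ∀ s r h e → s * r * (s * 1ℤ * h * e) ≡ s * s * (h * r) * e
            lemma₃ = solve-∀
            lemma₄ : ∀ f k h a r c e → 1ℤ * (f * (k * f * h * (a * r) * c)) * e ≡ f * f * k * (r * a * h * c) * e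
            lemma₄ = solve-∀

  -- Product formulas

  -- The product of `z + i + j` over `i < a` and `j < b`. As the innermost products of `PP a b c`
  -- telescope, it is the quotient of the grids at `1 + c` and at `1`.
  grid : ℕ → ℕ → ℤ → ℤ
  grid zero    b z = 1ℤ
  grid (suc a) b z = grid a b z * rising b (z + int a)

  grid-firstRow : ∀ a b z → grid (suc a) b z ≡ rising b z * grid a b (1ℤ + z)
  grid-firstRow zero    b z = trans (*-comm 1ℤ _) (cong (λ x → rising b x * 1ℤ) (+-identityʳ z))
  grid-firstRow (suc a) b z = trans
    (cong₂ _*_ (grid-firstRow a b z) (cong (rising b) (trans (cong (z +_) (int-+ 1 a)) (lemma z (int a)))))
    (*-assoc _ _ _)
    where
    opaque
      unfolding _+_
      lemma : ∀ z a → z + (1ℤ + a) ≡ 1ℤ + z + a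
      lemma = solve-∀

  grid-lastColumn : ∀ a b z → grid a (suc b) z ≡ grid a b z * rising a (z + int b)
  grid-lastColumn zero    b z = sym (*-identityˡ 1ℤ)
  grid-lastColumn (suc a) b z = trans (cong (_* rising (suc b) (z + int a)) (grid-lastColumn a b z))
    (lemma (grid a b z) (rising a (z + int b)) (rising b (z + int a)) z (int a) (int b))
    where
    opaque
      unfolding _+_
      lemma : ∀ g r s z a b → g * r * (s * (z + a + b)) ≡ g * s * (r * (z + b + a))
      lemma = solve-∀

  rising-join : ∀ k n → rising (suc (k ℕ.+ k)) (n - int k) ≡ falling k (n - 1ℤ) * (n * rising k (n + 1ℤ))
  rising-join k n = begin
    rising (suc (k ℕ.+ k)) (n - int k)
      ≡⟨ cong (λ i → rising i (n - int k)) (ℕₚ.+-suc k k) ⟨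
    rising (k ℕ.+ suc k) (n - int k)
      ≡⟨ rising-+ k (suc k) (n - int k) ⟩
    rising k (n - int k) * rising (suc k) (n - int k + int k)
      ≡⟨ cong₂ _*_
           (trans (cong (rising k) (lemma₁ n (int k)))
             (trans (sym (falling-rising k (n - 1ℤ - int k))) (cong (falling k) (lemma₂ (n - 1ℤ) (int k)))))
           (trans (cong (rising (suc k)) (lemma₂ n (int k)))
             (trans (rising-suc k n) (cong (λ x → n * rising k x) (+-comm 1ℤ n)))) ⟩
    falling k (n - 1ℤ) * (n * rising k (n + 1ℤ)) ∎
    where
    opaque
      unfolding _+_
      lemma₁ : ∀ n k → n - k ≡ 1ℤ + (n - 1ℤ - k)
      lemma₁ = solve-∀
      lemma₂ : ∀ n k → n - k + k ≡ n
      lemma₂ = solve-∀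

  -- The first row and last column form a hook with the consecutive entries `n - k`, ..., `n + k`;
  -- removing it leaves a square grid starting one higher.
  grid-square-suc : ∀ k n → grid (suc k) (suc k) (n - int k) ≡
    rising (suc (k ℕ.+ k)) (n - int k) * grid k k (1ℤ + (n - int k))
  grid-square-suc k n = begin
    grid (suc k) (suc k) w
      ≡⟨ grid-firstRow k (suc k) w ⟩
    rising (suc k) w * grid k (suc k) (1ℤ + w)
      ≡⟨ cong (rising (suc k) w *_) (grid-lastColumn k k (1ℤ + w)) ⟩
    rising (suc k) w * (grid k k (1ℤ + w) * rising k (1ℤ + w + int k))
      ≡⟨ lemma₁ _ _ _ ⟩
    rising (suc k) w * rising k (1ℤ + w + int k) * grid k k (1ℤ + w)
      ≡⟨ cong (λ x → rising (suc k) w * rising k x * grid k k (1ℤ + w))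
           (trans (lemma₂ w (int k)) (cong (w +_) (sym (int-+ 1 k)))) ⟩
    rising (suc k) w * rising k (w + int (suc k)) * grid k k (1ℤ + w)
      ≡⟨ cong (_* grid k k (1ℤ + w)) (rising-+ (suc k) k w) ⟨
    rising (suc (k ℕ.+ k)) w * grid k k (1ℤ + w) ∎
    where
    w = n - int k
    opaque
      unfolding _+_
      lemma₁ : ∀ a b c → a * (b * c) ≡ a * c * b
      lemma₁ = solve-∀
      lemma₂ : ∀ w k → 1ℤ + w + k ≡ w + (1ℤ + k)
      lemma₂ = solve-∀

  grid-oblong-suc : ∀ k n → grid (suc k) (suc (suc k)) (n - int k) ≡
    rising (suc (k ℕ.+ k)) (n - int k) * (n + int k + 1ℤ) * grid k (suc k) (1ℤ + (n - int k))
  grid-oblong-suc k n = begin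
    grid (suc k) (suc (suc k)) w
      ≡⟨ grid-lastColumn (suc k) (suc k) w ⟩
    grid (suc k) (suc k) w * rising (suc k) (w + int (suc k))
      ≡⟨ cong (_* rising (suc k) (w + int (suc k))) (grid-square-suc k n) ⟩
    rising (suc (k ℕ.+ k)) w * grid k k (1ℤ + w) * rising (suc k) (w + int (suc k))
      ≡⟨ cong (λ x → rising (suc (k ℕ.+ k)) w * grid k k (1ℤ + w) * rising (suc k) x)
           (trans (cong (w +_) (int-+ 1 k)) (lemma₂ w (int k))) ⟩
    rising (suc (k ℕ.+ k)) w * grid k k (1ℤ + w) * (rising k (1ℤ + w + int k) * (1ℤ + w + int k + int k))
      ≡⟨ lemma₁ (rising (suc (k ℕ.+ k)) w) (grid k k (1ℤ + w)) (rising k (1ℤ + w + int k)) n (int k) ⟩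
    rising (suc (k ℕ.+ k)) w * (n + int k + 1ℤ) * (grid k k (1ℤ + w) * rising k (1ℤ + w + int k))
      ≡⟨ cong (rising (suc (k ℕ.+ k)) w * (n + int k + 1ℤ) *_) (grid-lastColumn k k (1ℤ + w)) ⟨
    rising (suc (k ℕ.+ k)) w * (n + int k + 1ℤ) * grid k (suc k) (1ℤ + w) ∎
    where
    w = n - int k
    opaque
      unfolding _+_
      lemma₁ : ∀ r g s n k → r * g * (s * (1ℤ + (n - k) + k + k)) ≡ r * (n + k + 1ℤ) * (g * s)
      lemma₁ = solve-∀
      lemma₂ : ∀ w k → w + (1ℤ + k) ≡ 1ℤ + w + k
      lemma₂ = solve-∀

  grid-one-suc : ∀ k b → grid (suc k) (suc b) 1ℤ ≡
    grid k b 1ℤ * rising k (1ℤ + int b) * rising (suc b) (1ℤ + int k)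
  grid-one-suc k b = cong (_* rising (suc b) (1ℤ + int k)) (grid-lastColumn k b 1ℤ)

  pad-+ : ∀ x j → pad x j ≡ x ℕ.+ x ℕ.+ j
  pad-+ zero    j = refl
  pad-+ (suc x) j = cong suc (trans (cong suc (pad-+ x j)) (sym (cong (ℕ._+ j) (ℕₚ.+-suc x x))))

  superfactorial-pad : ∀ k → superfactorial (pad (suc k) 0) ≡
    int (k !) * rising (suc k) (1ℤ + int k) * (int (k !) * rising k (1ℤ + int k)) * superfactorial (pad k 0)
  superfactorial-pad k = begin
    int (suc (pad k 0) !) * (int (pad k 0 !) * superfactorial (pad k 0))
      ≡⟨ *-assoc _ _ _ ⟨
    int (suc (pad k 0) !) * int (pad k 0 !) * superfactorial (pad k 0)
      ≡⟨ cong (_* superfactorial (pad k 0)) (cong₂ _*_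
           (trans (cong (λ i → int (i !)) (trans (cong suc double) (sym (ℕₚ.+-suc k k)))) (factorial-rising k (suc k)))
           (trans (cong (λ i → int (i !)) double) (factorial-rising k k))) ⟩
    _ ∎
    where
    double : pad k 0 ≡ k ℕ.+ k
    double = trans (pad-+ k 0) (ℕₚ.+-identityʳ (k ℕ.+ k))

  superfactorial-pad₁ : ∀ k → superfactorial (pad (suc k) 1) ≡
    int (suc k !) * rising (suc k) (1ℤ + int (suc k)) * (int (suc k !) * rising k (1ℤ + int (suc k))) * superfactorial (pad k 1)
  superfactorial-pad₁ k = begin
    int (suc (pad k 1) !) * (int (pad k 1 !) * superfactorial (pad k 1))
      ≡⟨ *-assoc _ _ _ ⟨
    int (suc (pad k 1) !) * int (pad k 1 !) * superfactorial (pad k 1)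
      ≡⟨ cong (_* superfactorial (pad k 1)) (cong₂ _*_
           (trans (cong (λ i → int (i !)) (trans (cong suc double) (cong suc (sym (ℕₚ.+-suc k k))))) (factorial-rising (suc k) (suc k)))
           (trans (cong (λ i → int (i !)) double) (factorial-rising (suc k) k))) ⟩
    _ ∎
    where
    double : pad k 1 ≡ suc (k ℕ.+ k)
    double = trans (pad-+ k 1) (ℕₚ.+-comm (k ℕ.+ k) 1)

  rising-nonzero : ∀ n t → rising n (int (suc t)) ≢ 0ℤ
  rising-nonzero zero    t ()
  rising-nonzero (suc n) t eq with i*j≡0⇒i≡0∨j≡0 (rising n (int (suc t))) eq
  ... | inj₁ r≡0 = rising-nonzero n t r≡0
  ... | inj₂ s≡0 = int-suc-nonzero (t ℕ.+ n) (trans (int-+ (suc t) n) s≡0)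

  product-nonzero : ∀ {i j} → i ≢ 0ℤ → j ≢ 0ℤ → i * j ≢ 0ℤ
  product-nonzero {i} i≢0 j≢0 eq with i*j≡0⇒i≡0∨j≡0 i eq
  ... | inj₁ i≡0 = i≢0 i≡0
  ... | inj₂ j≡0 = j≢0 j≡0

  grid-nonzero : ∀ a b → grid a b 1ℤ ≢ 0ℤ
  grid-nonzero zero    b ()
  grid-nonzero (suc a) b = product-nonzero (grid-nonzero a b)
    (subst (λ x → rising b x ≢ 0ℤ) (int-+ 1 a) (rising-nonzero b a))

  superfactorial-nonzero : ∀ h → superfactorial h ≢ 0ℤ
  superfactorial-nonzero zero    ()
  superfactorial-nonzero (suc h) = product-nonzero (factorial-nonzero h) (superfactorial-nonzero h)

  -- The induction step common to the three cases. `L` and `M` are the rising factorials of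
  -- `selberg-step`, `R₁` and `R₂` the hooks of the two grids. The factor `κ` is `1 + k` if the
  -- centre is marked and 1 otherwise.
  value-step : ∀ {E E′ f κ L M R₁ R₂ g g′ s s′ G₁ G₂ G₁′ G₂′} →
    L * M * E′ ≡ f * f * (R₁ * R₂) * E → E * (g * g) ≡ s * (G₁ * G₂) →
    g′ ≡ g * L * (κ * M) → s′ ≡ κ * f * M * (κ * f * L) * s → R₁ * G₁ ≡ G₁′ → R₂ * G₂ ≡ G₂′ →
    E′ * (g′ * g′) ≡ s′ * (G₁′ * G₂′)
  value-step {E} {E′} {f} {κ} {L} {M} {R₁} {R₂} {g} {s = s} {G₁ = G₁} {G₂} step value refl refl refl refl = begin
    E′ * (g * L * (κ * M) * (g * L * (κ * M)))
      ≡⟨ lemma₁ E′ g L M κ ⟩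
    L * M * E′ * (L * M * (κ * κ) * (g * g))
      ≡⟨ cong (_* (L * M * (κ * κ) * (g * g))) step ⟩
    f * f * (R₁ * R₂) * E * (L * M * (κ * κ) * (g * g))
      ≡⟨ lemma₂ f R₁ R₂ E L M κ g ⟩
    κ * f * M * (κ * f * L) * (R₁ * R₂) * (E * (g * g))
      ≡⟨ cong (κ * f * M * (κ * f * L) * (R₁ * R₂) *_) value ⟩
    κ * f * M * (κ * f * L) * (R₁ * R₂) * (s * (G₁ * G₂))
      ≡⟨ lemma₃ (κ * f * M * (κ * f * L)) R₁ R₂ s G₁ G₂ ⟩
    κ * f * M * (κ * f * L) * s * (R₁ * G₁ * (R₂ * G₂)) ∎
    where
    opaque
      unfolding _+_
      lemma₁ : ∀ e g l m k → e * (g * l * (k * m) * (g * l * (k * m))) ≡ l * m * e * (l * m * (k * k) * (g * g))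
      lemma₁ = solve-∀
      lemma₂ : ∀ f r r′ e l m k g → f * f * (r * r′) * e * (l * m * (k * k) * (g * g)) ≡
        k * f * m * (k * f * l) * (r * r′) * (e * (g * g))
      lemma₂ = solve-∀
      lemma₃ : ∀ a r r′ s g g′ → a * (r * r′) * (s * (g * g′)) ≡ a * s * (r * g * (r′ * g′))
      lemma₃ = solve-∀

  opaque
    unfolding _+_
    value-zero : (1ℤ * (1ℤ * 1ℤ) + 0ℤ) * (1ℤ * 1ℤ) ≡ 1ℤ * (1ℤ * 1ℤ)
    value-zero = solve-∀

  grid-suc-shift : ∀ a b n k → grid a b (n - int k) ≡ grid a b (1ℤ + (n - int (suc k)))
  grid-suc-shift a b n k = cong (grid a b) (trans (lemma n (int k)) (cong (λ x → 1ℤ + (n - x)) (sym (int-+ 1 k))))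
    where
    opaque
      unfolding _+_
      lemma : ∀ n k → n - k ≡ 1ℤ + (n - (1ℤ + k))
      lemma = solve-∀

  square-step : ∀ k n → rising (suc (k ℕ.+ k)) (n - int k) * grid k k (1ℤ + (n - int k)) ≡
    grid (suc k) (suc k) (1ℤ + (n - int (suc k)))
  square-step k n = trans (sym (grid-square-suc k n)) (grid-suc-shift (suc k) (suc k) n k)

  -- The three kinds of centre: empty, unmarked, marked

  module EvenEven where
    open Palindrome [] public

    opaque
      unfolding _+_
      mass-step : ∀ n → (1ℤ + n) * (1ℤ + n) ≡ (n + (1ℤ + int 0)) * (n + 1ℤ)
      mass-step = solve-∀
      telescope : ∀ n j → (n + 1ℤ) * (n + (1ℤ + int 0) + j) - n * (n - j) ≡
        (j + 1ℤ + int 0) * ((n + n + (1ℤ + int 0)) * 1ℤ)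
      telescope = solve-∀

    -- The weight is `2s + 1`, whose sum over `s < n` is the square of `n`; hence `κ n = n` with
    -- `e = 0`.
    open QuadraticLattice γ 0 weight (λ n → n) (_+ 1ℤ) mass-step telescope using (η; selberg-step)

    value : ∀ N k →
      sumOver energy (choose k (downFrom N)) * (grid k k 1ℤ * grid k k 1ℤ) ≡
      superfactorial (pad k 0) * (grid k k (1ℤ + (int N - int k)) * grid k k (1ℤ + (int N - int k)))
    value N zero    = value-zero
    value N (suc k) = value-step step (value N k)
      (trans (grid-one-suc k k) (cong (grid k k 1ℤ * L *_) (sym (*-identityˡ M))))
      (trans (superfactorial-pad k) (cong (λ x → x * M * (x * L) * superfactorial (pad k 0)) (sym (*-identityˡ f))))
      (square-step k n) (square-step k n)
      where
      n = int N
      E = sumOver energy (choose k (downFrom N))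
      E′ = sumOver energy (choose (suc k) (downFrom N))
      f = int (k !)
      L = rising k (1ℤ + int k)
      M = rising (suc k) (1ℤ + int k)
      R = rising (suc (k ℕ.+ k)) (n - int k)
      step : L * M * E′ ≡ f * f * (R * R) * E
      step = begin
        L * M * E′
          ≡⟨ cong (λ i → rising k (1ℤ + int i) * rising (suc k) (1ℤ + int i) * E′) (ℕₚ.+-identityʳ k) ⟨
        rising k (1ℤ + int (k ℕ.+ 0)) * rising (suc k) (1ℤ + int (k ℕ.+ 0)) * E′
          ≡⟨ selberg-step N k ⟩
        f * f * (n * n) * (rising k (n + γ) * falling k (n - 1ℤ) * falling k (n - η) * rising k (n + int 0 + 1ℤ)) * E
          ≡⟨ cong₂ (λ x y → f * f * (n * n) * (x * falling k (n - 1ℤ) * falling k (n - η) * y) * E)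
               (cong (rising k) (lemma-γ n)) (cong (rising k) (lemma-0 n)) ⟩
        f * f * (n * n) * (rising k (n + 1ℤ) * falling k (n - 1ℤ) * falling k (n - η) * rising k (n + 1ℤ)) * E
          ≡⟨ cong (λ x → f * f * (n * n) * (rising k (n + 1ℤ) * falling k (n - 1ℤ) * falling k x * rising k (n + 1ℤ)) * E)
               (lemma-η n) ⟩
        f * f * (n * n) * (rising k (n + 1ℤ) * falling k (n - 1ℤ) * falling k (n - 1ℤ) * rising k (n + 1ℤ)) * E
          ≡⟨ lemma f n (rising k (n + 1ℤ)) (falling k (n - 1ℤ)) E ⟩
        f * f * ((falling k (n - 1ℤ) * (n * rising k (n + 1ℤ))) * (falling k (n - 1ℤ) * (n * rising k (n + 1ℤ)))) * E
          ≡⟨ cong (λ x → f * f * (x * x) * E) (rising-join k n) ⟨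
        f * f * (R * R) * E ∎
        where
        opaque
          unfolding _+_
          lemma-γ : ∀ n → n + (1ℤ + int 0) ≡ n + 1ℤ
          lemma-γ = solve-∀
          lemma-η : ∀ n → n - (int 2 + int 0 - (1ℤ + int 0)) ≡ n - 1ℤ
          lemma-η = solve-∀
          lemma-0 : ∀ n → n + int 0 + 1ℤ ≡ n + 1ℤ
          lemma-0 = solve-∀
          lemma : ∀ f n r h e → f * f * (n * n) * (r * h * h * r) * e ≡ f * f * ((h * (n * r)) * (h * (n * r))) * e
          lemma = solve-∀

  module EvenOdd where
    open Palindrome (false ∷ []) public

    opaque
      unfolding _+_
      mass-step : ∀ n → (1ℤ + n) * (1ℤ + n + 1ℤ) ≡ (n + (1ℤ + int 1)) * (n + 1ℤ)
      mass-step = solve-∀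
      telescope : ∀ n j → (n + 1ℤ) * (n + (1ℤ + int 1) + j) - (n + 1ℤ) * (n - j) ≡
        (j + 1ℤ + int 0) * ((n + n + (1ℤ + int 1)) * 1ℤ)
      telescope = solve-∀

    -- The weight is `2s + 2` with sum `n * (n + 1)`. The two unequal factors of this mass lead to
    -- two hooks, around `n` and `n + 1`, and so to two different box products.
    open QuadraticLattice γ 0 weight (_+ 1ℤ) (_+ 1ℤ) mass-step telescope using (η; selberg-step)

    value : ∀ N k →
      sumOver energy (choose k (downFrom N)) * (grid k k 1ℤ * grid k k 1ℤ) ≡
      superfactorial (pad k 0) * (grid k k (1ℤ + (int N - int k)) * grid k k (1ℤ + (int N + 1ℤ - int k)))
    value N zero    = value-zero
    value N (suc k) = value-step step (value N k)
      (trans (grid-one-suc k k) (cong (grid k k 1ℤ * L *_) (sym (*-identityˡ M))))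
      (trans (superfactorial-pad k) (cong (λ x → x * M * (x * L) * superfactorial (pad k 0)) (sym (*-identityˡ f))))
      (square-step k n) (square-step k (n + 1ℤ))
      where
      n = int N
      E = sumOver energy (choose k (downFrom N))
      E′ = sumOver energy (choose (suc k) (downFrom N))
      f = int (k !)
      L = rising k (1ℤ + int k)
      M = rising (suc k) (1ℤ + int k)
      R : ℤ → ℤ
      R n = rising (suc (k ℕ.+ k)) (n - int k)
      step : L * M * E′ ≡ f * f * (R n * R (n + 1ℤ)) * E
      step = begin
        L * M * E′
          ≡⟨ cong (λ i → rising k (1ℤ + int i) * rising (suc k) (1ℤ + int i) * E′) (ℕₚ.+-identityʳ k) ⟨
        rising k (1ℤ + int (k ℕ.+ 0)) * rising (suc k) (1ℤ + int (k ℕ.+ 0)) * E′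
          ≡⟨ selberg-step N k ⟩
        f * f * (n * (n + 1ℤ)) * (rising k (n + γ) * falling k (n - 1ℤ) * falling k (n - η) * rising k (n + int 0 + 1ℤ)) * E
          ≡⟨ cong₂ (λ x y → f * f * (n * (n + 1ℤ)) * (rising k x * falling k (n - 1ℤ) * falling k y * rising k (n + int 0 + 1ℤ)) * E)
               (lemma-γ n) (lemma-η n) ⟩
        f * f * (n * (n + 1ℤ)) * (rising k (n + 1ℤ + 1ℤ) * falling k (n - 1ℤ) * falling k (n + 1ℤ - 1ℤ) * rising k (n + int 0 + 1ℤ)) * E
          ≡⟨ cong (λ x → f * f * (n * (n + 1ℤ)) * (rising k (n + 1ℤ + 1ℤ) * falling k (n - 1ℤ) * falling k (n + 1ℤ - 1ℤ) * rising k x) * E)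
               (lemma-0 n) ⟩
        f * f * (n * (n + 1ℤ)) * (rising k (n + 1ℤ + 1ℤ) * falling k (n - 1ℤ) * falling k (n + 1ℤ - 1ℤ) * rising k (n + 1ℤ)) * E
          ≡⟨ lemma f n (rising k (n + 1ℤ + 1ℤ)) (falling k (n - 1ℤ)) (falling k (n + 1ℤ - 1ℤ)) (rising k (n + 1ℤ)) E ⟩
        f * f * ((falling k (n - 1ℤ) * (n * rising k (n + 1ℤ))) * (falling k (n + 1ℤ - 1ℤ) * ((n + 1ℤ) * rising k (n + 1ℤ + 1ℤ)))) * E
          ≡⟨ cong₂ (λ x y → f * f * (x * y) * E) (rising-join k n) (rising-join k (n + 1ℤ)) ⟨
        f * f * (R n * R (n + 1ℤ)) * E ∎
        where
        opaque
          unfolding _+_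
          lemma-γ : ∀ n → n + (1ℤ + int 1) ≡ n + 1ℤ + 1ℤ
          lemma-γ = solve-∀
          lemma-η : ∀ n → n - (int 2 + int 0 - (1ℤ + int 1)) ≡ n + 1ℤ - 1ℤ
          lemma-η = solve-∀
          lemma-0 : ∀ n → n + int 0 + 1ℤ ≡ n + 1ℤ
          lemma-0 = solve-∀
          lemma : ∀ f n r h i s e → f * f * (n * (n + 1ℤ)) * (r * h * i * s) * e ≡
            f * f * ((h * (n * s)) * (i * ((n + 1ℤ) * r))) * e
          lemma = solve-∀

  module OddEven where
    open Palindrome (true ∷ []) public

    -- The marked centre adds a squared factor, so the weight is twice the cube of `s + 1`. The sum
    -- of the first `n` cubes is the square of `n (n + 1) / 2`; with `1 + e = 2` the mass becomes
    -- the square of `n (n + 1)`.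
    κ κ′ : ℤ → ℤ
    κ n = n * ((n + 1ℤ) * (n + 1ℤ))
    κ′ n = (n + 1ℤ) * (n + 1ℤ) * (n + int 2)

    opaque
      unfolding _+_
      mass-step : ∀ n → (1ℤ + n) * ((1ℤ + n) * ((1ℤ + n + 1ℤ) * (1ℤ + n + 1ℤ))) ≡
        (n + (1ℤ + int 1)) * ((n + 1ℤ) * (n + 1ℤ) * (n + int 2))
      mass-step = solve-∀
      telescope : ∀ n j →
        (n + 1ℤ) * (n + 1ℤ) * (n + int 2) * (n + (1ℤ + int 1) + j) - n * ((n + 1ℤ) * (n + 1ℤ)) * (n - j) ≡
        (j + 1ℤ + int 1) * ((n + n + (1ℤ + int 1)) * ((int 1 + n - int 0) * (int 0 + 1ℤ + n) * 1ℤ))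
      telescope = solve-∀

    open QuadraticLattice γ 1 weight κ κ′ mass-step telescope using (η; selberg-step)

    value : ∀ N k →
      sumOver energy (choose k (downFrom N)) * (grid k (suc k) 1ℤ * grid k (suc k) 1ℤ) ≡
      superfactorial (pad k 1) * (grid k (suc k) (1ℤ + (int N - int k)) * grid k (suc k) (1ℤ + (int N - int k)))
    value N zero    = trans value-zero (cong (_* (1ℤ * 1ℤ)) (sym (*-identityˡ 1ℤ)))
    value N (suc k) = value-step step (value N k)
      (trans (grid-one-suc k (suc k)) (cong (grid k (suc k) 1ℤ * L *_) (trans (rising-suc (suc k) (1ℤ + int k))
        (cong (λ x → (1ℤ + int k) * rising (suc k) (1ℤ + x)) (sym (int-+ 1 k))))))
      (trans (superfactorial-pad₁ k) (cong (λ x → x * M * (x * L) * superfactorial (pad k 1)) (int-! k)))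
      oblong-step oblong-step
      where
      n = int N
      E = sumOver energy (choose k (downFrom N))
      E′ = sumOver energy (choose (suc k) (downFrom N))
      f = int (k !)
      L = rising k (1ℤ + int (suc k))
      M = rising (suc k) (1ℤ + int (suc k))
      R = rising (suc (k ℕ.+ k)) (n - int k) * (n + int k + 1ℤ)
      oblong-step : R * grid k (suc k) (1ℤ + (n - int k)) ≡ grid (suc k) (suc (suc k)) (1ℤ + (n - int (suc k)))
      oblong-step = trans (sym (grid-oblong-suc k n)) (grid-suc-shift (suc k) (suc (suc k)) n k)
      step : L * M * E′ ≡ f * f * (R * R) * E
      step = begin
        L * M * E′
          ≡⟨ cong (λ i → rising k (1ℤ + int i) * rising (suc k) (1ℤ + int i) * E′) (ℕₚ.+-comm k 1) ⟨
        rising k (1ℤ + int (k ℕ.+ 1)) * rising (suc k) (1ℤ + int (k ℕ.+ 1)) * E′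
          ≡⟨ selberg-step N k ⟩
        f * f * (n * κ n) * (rising k (n + γ) * falling k (n - 1ℤ) * falling k (n - η) * rising k (n + int 1 + 1ℤ)) * E
          ≡⟨ cong₂ (λ x y → f * f * (n * κ n) * (rising k x * falling k (n - 1ℤ) * falling k y * rising k (n + int 1 + 1ℤ)) * E)
               (lemma-γ n) (lemma-η n) ⟩
        f * f * (n * κ n) * (rising k (1ℤ + (n + 1ℤ)) * falling k (n - 1ℤ) * falling k (n - 1ℤ) * rising k (n + int 1 + 1ℤ)) * E
          ≡⟨ cong (λ x → f * f * (n * κ n) * (rising k (1ℤ + (n + 1ℤ)) * falling k (n - 1ℤ) * falling k (n - 1ℤ) * rising k x) * E)
               (lemma-0 n) ⟩
        f * f * (n * κ n) * (rising k (1ℤ + (n + 1ℤ)) * falling k (n - 1ℤ) * falling k (n - 1ℤ) * rising k (1ℤ + (n + 1ℤ))) * E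
          ≡⟨ lemma f n (rising k (1ℤ + (n + 1ℤ))) (falling k (n - 1ℤ)) E ⟩
        f * f * ((falling k (n - 1ℤ) * (n * ((n + 1ℤ) * rising k (1ℤ + (n + 1ℤ))))) * (falling k (n - 1ℤ) * (n * ((n + 1ℤ) * rising k (1ℤ + (n + 1ℤ)))))) * E
          ≡⟨ cong (λ x → f * f * (x * x) * E) (begin
               rising (suc (k ℕ.+ k)) (n - int k) * (n + int k + 1ℤ)
                 ≡⟨ cong (_* (n + int k + 1ℤ)) (rising-join k n) ⟩
               falling k (n - 1ℤ) * (n * rising k (n + 1ℤ)) * (n + int k + 1ℤ)
                 ≡⟨ lemma-R (falling k (n - 1ℤ)) n (rising k (n + 1ℤ)) (int k) ⟩
               falling k (n - 1ℤ) * (n * rising (suc k) (n + 1ℤ))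
                 ≡⟨ cong (λ x → falling k (n - 1ℤ) * (n * x)) (rising-suc k (n + 1ℤ)) ⟩
               falling k (n - 1ℤ) * (n * ((n + 1ℤ) * rising k (1ℤ + (n + 1ℤ)))) ∎) ⟨
        f * f * (R * R) * E ∎
        where
        opaque
          unfolding _+_
          lemma-γ : ∀ n → n + (1ℤ + int 1) ≡ 1ℤ + (n + 1ℤ)
          lemma-γ = solve-∀
          lemma-η : ∀ n → n - (int 2 + int 1 - (1ℤ + int 1)) ≡ n - 1ℤ
          lemma-η = solve-∀
          lemma-0 : ∀ n → n + int 1 + 1ℤ ≡ 1ℤ + (n + 1ℤ)
          lemma-0 = solve-∀
          lemma-R : ∀ h n r k → h * (n * r) * (n + k + 1ℤ) ≡ h * (n * (r * (n + 1ℤ + k)))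
          lemma-R = solve-∀
          lemma : ∀ f n r h e → f * f * (n * (n * ((n + 1ℤ) * (n + 1ℤ)))) * (r * h * h * r) * e ≡
            f * f * ((h * (n * ((n + 1ℤ) * r))) * (h * (n * ((n + 1ℤ) * r)))) * e
          lemma = solve-∀

  -- The products PP

  fromℚᵘ-* : ∀ p q → ℚ.fromℚᵘ (p ℚᵘ.* q) ≡ ℚ.fromℚᵘ p ℚ.* ℚ.fromℚᵘ q
  fromℚᵘ-* p q = ℚₚ.toℚᵘ-injective (ℚᵘₚ.≃-trans (ℚₚ.toℚᵘ-fromℚᵘ (p ℚᵘ.* q)) (ℚᵘₚ.≃-sym
    (ℚᵘₚ.≃-trans (ℚₚ.toℚᵘ-homo-* (ℚ.fromℚᵘ p) (ℚ.fromℚᵘ q))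
      (ℚᵘₚ.*-cong (ℚₚ.toℚᵘ-fromℚᵘ p) (ℚₚ.toℚᵘ-fromℚᵘ q)))))

  -- Built from unnormalised fractions so that products can be compared without meeting greatest
  -- common divisors.
  rational : ℤ → ℚ
  rational z = ℚ.fromℚᵘ (mkℚᵘ z 0)

  opaque
    unfolding _+_

    rational-* : ∀ y z → rational (y * z) ≡ rational y ℚ.* rational z
    rational-* y z = fromℚᵘ-* (mkℚᵘ y 0) (mkℚᵘ z 0)

  rational-injective : ∀ {y z} → rational y ≡ rational z → y ≡ z
  rational-injective {y} {z} eq with ℚₚ.fromℚᵘ-injective {mkℚᵘ y 0} {mkℚᵘ z 0} eq
  ... | *≡* y≡z = trans (sym (ℤₚ.*-identityʳ y)) (trans y≡z (ℤₚ.*-identityʳ z))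

  rational-cancel : ∀ d {p q} → d ≢ 0ℤ → p ℚ.* rational d ≡ q ℚ.* rational d → p ≡ q
  rational-cancel d {p} {q} d≢0 eq = trans (sym (undo p)) (trans (cong (ℚ._* ℚ.1/ rational d) eq) (undo q))
    where
    instance
      nonZero : ℚ.NonZero (rational d)
      nonZero = ℚ.≢-nonZero (d≢0 ∘ rational-injective)
    undo : ∀ p → p ℚ.* rational d ℚ.* ℚ.1/ rational d ≡ p
    undo p = trans (ℚₚ.*-assoc p _ _) (trans (cong (p ℚ.*_) (ℚₚ.*-inverseʳ (rational d))) (ℚₚ.*-identityʳ p))

  ratio : ℕ → ℚ
  ratio t = int (suc (suc t)) / suc t

  ratio-clear : ∀ t → ratio t ℚ.* rational (int (suc t)) ≡ rational (int (suc (suc t)))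
  ratio-clear t = trans (sym (fromℚᵘ-* (mkℚᵘ (int (suc (suc t))) t) (mkℚᵘ (int (suc t)) 0)))
    (ℚₚ.fromℚᵘ-cong {mkℚᵘ (int (suc (suc t))) t ℚᵘ.* mkℚᵘ (int (suc t)) 0} {mkℚᵘ (int (suc (suc t))) 0} (*≡* (trans (ℤₚ.*-identityʳ _)
      (cong (λ i → int (suc (suc t)) ℤ.* int i) (sym (ℕₚ.*-identityʳ (suc t)))))))

  ∏-suc : ∀ n f → ∏[< suc n ] f ≡ f 0 ℚ.* ∏[< n ] (f ∘ suc)
  ∏-suc n f = cong (λ xs → f 0 ℚ.* foldr ℚ._*_ 1ℚ xs)
    (trans (map-applyUpTo suc f n) (sym (map-applyUpTo (λ i → i) (f ∘ suc) n)))

  ∏-cong : ∀ n {f g : ℕ → ℚ} → (∀ i → f i ≡ g i) → ∏[< n ] f ≡ ∏[< n ] g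
  ∏-cong zero    eq = refl
  ∏-cong (suc n) {f} {g} eq = trans (∏-suc n f) (trans (cong₂ ℚ._*_ (eq 0) (∏-cong n (eq ∘ suc))) (sym (∏-suc n g)))

  interchange : ∀ {p q r s t u} → p ℚ.* r ≡ t → q ℚ.* s ≡ u → (p ℚ.* q) ℚ.* (r ℚ.* s) ≡ t ℚ.* u
  interchange {p} {q} {r} {s} pr qs = trans (ℚₚ.*-assoc p q _) (trans
    (cong (p ℚ.*_) (trans (sym (ℚₚ.*-assoc q r s)) (trans (cong (ℚ._* s) (ℚₚ.*-comm q r)) (ℚₚ.*-assoc r q s))))
    (trans (sym (ℚₚ.*-assoc p r _)) (cong₂ ℚ._*_ pr qs)))

  line : ℕ → ℕ → ℚ
  line c t = ∏[< c ] (λ k → ratio (t ℕ.+ k))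

  -- The numerator of each factor is the denominator of the next; only the first denominator and the
  -- last numerator survive.
  line-clear : ∀ c t → line c t ℚ.* rational (int (suc t)) ≡ rational (int (suc (t ℕ.+ c)))
  line-clear zero    t = trans (ℚₚ.*-identityˡ _) (cong (λ i → rational (int (suc i))) (sym (ℕₚ.+-identityʳ t)))
  line-clear (suc c) t = begin
    line (suc c) t ℚ.* rational (int (suc t))
      ≡⟨ cong (ℚ._* rational (int (suc t))) (trans (∏-suc c (λ k → ratio (t ℕ.+ k)))
           (cong₂ ℚ._*_ (cong ratio (ℕₚ.+-identityʳ t)) (∏-cong c (λ k → cong ratio (ℕₚ.+-suc t k))))) ⟩
    ratio t ℚ.* line c (suc t) ℚ.* rational (int (suc t))
      ≡⟨ cong (ℚ._* rational (int (suc t))) (ℚₚ.*-comm (ratio t) (line c (suc t))) ⟩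
    line c (suc t) ℚ.* ratio t ℚ.* rational (int (suc t))
      ≡⟨ ℚₚ.*-assoc (line c (suc t)) _ _ ⟩
    line c (suc t) ℚ.* (ratio t ℚ.* rational (int (suc t)))
      ≡⟨ cong (line c (suc t) ℚ.*_) (ratio-clear t) ⟩
    line c (suc t) ℚ.* rational (int (suc (suc t)))
      ≡⟨ line-clear c (suc t) ⟩
    rational (int (suc (suc t ℕ.+ c)))
      ≡⟨ cong (λ i → rational (int (suc i))) (sym (ℕₚ.+-suc t c)) ⟩
    rational (int (suc (t ℕ.+ suc c))) ∎

  plane : ℕ → ℕ → ℕ → ℚ
  plane b c t = ∏[< b ] (λ j → line c (t ℕ.+ j))

  plane-clear : ∀ b c t →
    plane b c t ℚ.* rational (rising b (int (suc t))) ≡ rational (rising b (int (suc (t ℕ.+ c))))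
  plane-clear zero    c t = refl
  plane-clear (suc b) c t = begin
    plane (suc b) c t ℚ.* rational (rising (suc b) (int (suc t)))
      ≡⟨ cong₂ ℚ._*_
           (trans (∏-suc b (λ j → line c (t ℕ.+ j))) (cong₂ ℚ._*_ (cong (line c) (ℕₚ.+-identityʳ t)) (∏-cong b (λ j → cong (line c) (ℕₚ.+-suc t j)))))
           (first t) ⟩
    (line c t ℚ.* plane b c (suc t)) ℚ.* (rational (int (suc t)) ℚ.* rational (rising b (int (suc (suc t)))))
      ≡⟨ interchange {line c t} {plane b c (suc t)} (line-clear c t) (plane-clear b c (suc t)) ⟩
    rational (int (suc (t ℕ.+ c))) ℚ.* rational (rising b (int (suc (suc (t ℕ.+ c)))))
      ≡⟨ first (t ℕ.+ c) ⟨
    rational (rising (suc b) (int (suc (t ℕ.+ c)))) ∎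
    where
    first : ∀ t → rational (rising (suc b) (int (suc t))) ≡
      rational (int (suc t)) ℚ.* rational (rising b (int (suc (suc t))))
    first t = trans (cong rational (trans (rising-suc b (int (suc t)))
      (cong (λ x → int (suc t) * rising b x) (sym (int-+ 1 (suc t)))))) (rational-* _ _)

  box : ℕ → ℕ → ℕ → ℕ → ℚ
  box a b c t = ∏[< a ] (λ i → plane b c (t ℕ.+ i))

  box-clear : ∀ a b c t →
    box a b c t ℚ.* rational (grid a b (int (suc t))) ≡ rational (grid a b (int (suc (t ℕ.+ c))))
  box-clear zero    b c t = refl
  box-clear (suc a) b c t = begin
    box (suc a) b c t ℚ.* rational (grid (suc a) b (int (suc t)))
      ≡⟨ cong₂ ℚ._*_
           (trans (∏-suc a (λ i → plane b c (t ℕ.+ i))) (cong₂ ℚ._*_ (cong (plane b c) (ℕₚ.+-identityʳ t)) (∏-cong a (λ i → cong (plane b c) (ℕₚ.+-suc t i)))))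
           (first t) ⟩
    (plane b c t ℚ.* box a b c (suc t)) ℚ.* (rational (rising b (int (suc t))) ℚ.* rational (grid a b (int (suc (suc t)))))
      ≡⟨ interchange {plane b c t} {box a b c (suc t)} (plane-clear b c t) (box-clear a b c (suc t)) ⟩
    rational (rising b (int (suc (t ℕ.+ c)))) ℚ.* rational (grid a b (int (suc (suc (t ℕ.+ c)))))
      ≡⟨ first (t ℕ.+ c) ⟨
    rational (grid (suc a) b (int (suc (t ℕ.+ c)))) ∎
    where
    first : ∀ t → rational (grid (suc a) b (int (suc t))) ≡
      rational (rising b (int (suc t))) ℚ.* rational (grid a b (int (suc (suc t))))
    first t = trans (cong rational (trans (grid-firstRow a b (int (suc t)))
      (cong (λ x → rising b (int (suc t)) * grid a b x) (sym (int-+ 1 (suc t)))))) (rational-* _ _)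

  PP-clear : ∀ a b c → PP a b c ℚ.* rational (grid a b 1ℤ) ≡ rational (grid a b (int (suc c)))
  PP-clear a b c = box-clear a b c 0

  PP-product : ∀ a b c a′ b′ c′ Z →
    int Z * (grid a b 1ℤ * grid a′ b′ 1ℤ) ≡ grid a b (int (suc c)) * grid a′ b′ (int (suc c′)) →
    fromℕ Z ≡ PP a b c ℚ.* PP a′ b′ c′
  PP-product a b c a′ b′ c′ Z eq = rational-cancel D (product-nonzero (grid-nonzero a b) (grid-nonzero a′ b′)) (begin
    rational (int Z) ℚ.* rational D
      ≡⟨ rational-* (int Z) D ⟨
    rational (int Z * D)
      ≡⟨ trans (cong rational eq) (rational-* _ _) ⟩
    rational (grid a b (int (suc c))) ℚ.* rational (grid a′ b′ (int (suc c′)))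
      ≡⟨ interchange {PP a b c} {PP a′ b′ c′} (PP-clear a b c) (PP-clear a′ b′ c′) ⟨
    (PP a b c ℚ.* PP a′ b′ c′) ℚ.* (rational (grid a b 1ℤ) ℚ.* rational (grid a′ b′ 1ℤ))
      ≡⟨ cong (PP a b c ℚ.* PP a′ b′ c′ ℚ.*_) (rational-* (grid a b 1ℤ) (grid a′ b′ 1ℤ)) ⟨
    (PP a b c ℚ.* PP a′ b′ c′) ℚ.* rational D ∎)
    where
    D = grid a b 1ℤ * grid a′ b′ 1ℤ

  -- Evaluation of the numbers of patterns

  normalise : ∀ s Z F D P → s ≢ 0ℤ → s * Z ≡ F → F * D ≡ s * P → Z * D ≡ P
  normalise s Z F D P s≢0 sZ FD = *-cancelˡ s s≢0 (trans (sym (*-assoc s Z D)) (trans (cong (_* D) sZ) FD))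

  pattern-sum : ∀ a c a′ M → a ≡ a′ → a ℕ.+ c ≡ M →
    superfactorial a′ * int (length (patterns a c)) ≡
    sumOver (λ u → det a′ (map power (positions u))) (palindromes M)
  pattern-sum a c _ _ refl refl = length-patterns a c

  remaining : ∀ x y → 1ℤ + (int (x ℕ.+ y) - int x) ≡ int (suc y)
  remaining x y = trans (cong (λ z → 1ℤ + (z - int x)) (int-+ x y)) (trans (lemma (int x) (int y)) (sym (int-+ 1 y)))
    where
    opaque
      unfolding _+_
      lemma : ∀ x y → 1ℤ + (x + y - x) ≡ 1ℤ + y
      lemma = solve-∀

  remaining₁ : ∀ x y → 1ℤ + (int (x ℕ.+ y) + 1ℤ - int x) ≡ int (suc (y ℕ.+ 1))
  remaining₁ x y = trans (cong (λ z → 1ℤ + (z + 1ℤ - int x)) (int-+ x y))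
    (trans (lemma (int x) (int y)) (sym (trans (int-+ 1 (y ℕ.+ 1)) (cong (1ℤ +_) (int-+ y 1)))))
    where
    opaque
      unfolding _+_
      lemma : ∀ x y → 1ℤ + (x + y + 1ℤ - x) ≡ 1ℤ + (y + 1ℤ)
      lemma = solve-∀

  even≢odd : ∀ n x → pad n 1 ≢ pad x 0
  even≢odd zero    zero    ()
  even≢odd zero    (suc x) ()
  even≢odd (suc n) zero    ()
  even≢odd (suc n) (suc x) eq = even≢odd n x (ℕₚ.suc-injective (ℕₚ.suc-injective eq))

  patterns-even-even : ∀ x y → fromℕ (length (patterns (2 ℕ.* x) (2 ℕ.* y))) ≡ PP x x y ℚ.* PP x x y
  patterns-even-even x y = PP-product x x y x x y _ (normalise (superfactorial (pad x 0)) _ _ _ _ (superfactorial-nonzero (pad x 0))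
    (trans (pattern-sum (2 ℕ.* x) (2 ℕ.* y) (pad x 0) (pad (x ℕ.+ y) 0)
        (trans (arrange x) (sym (pad-+ x 0))) (trans (arrange′ x y) (sym (pad-+ (x ℕ.+ y) 0))))
      (trans (sum-evenPalindromes (x ℕ.+ y) _) (sum-wrap refl (x ℕ.+ y) x)))
    (trans (value (x ℕ.+ y) x)
      (cong (λ z → superfactorial (pad x 0) * (grid x x z * grid x x z)) (remaining x y))))
    where
    open EvenEven
    arrange : ∀ x → 2 ℕ.* x ≡ x ℕ.+ x ℕ.+ 0
    arrange = solveℕ
    arrange′ : ∀ x y → 2 ℕ.* x ℕ.+ 2 ℕ.* y ≡ x ℕ.+ y ℕ.+ (x ℕ.+ y) ℕ.+ 0
    arrange′ = solveℕ

  patterns-even-odd : ∀ x y → fromℕ (length (patterns (2 ℕ.* x) (2 ℕ.* y ℕ.+ 1))) ≡ PP x x y ℚ.* PP x x (y ℕ.+ 1)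
  patterns-even-odd x y = PP-product x x y x x (y ℕ.+ 1) _ (normalise (superfactorial (pad x 0)) _ _ _ _ (superfactorial-nonzero (pad x 0))
    (trans (pattern-sum (2 ℕ.* x) (2 ℕ.* y ℕ.+ 1) (pad x 0) (pad (x ℕ.+ y) 1)
        (trans (arrange x) (sym (pad-+ x 0))) (trans (arrange′ x y) (sym (pad-+ (x ℕ.+ y) 1))))
      (trans (sum-oddPalindromes (x ℕ.+ y) _)
        -- A marked centre would make the number of marks odd, so only the unmarked centre
        -- contributes.
        (trans (cong₂ _+_ (OddEven.sum-wrap-parity (x ℕ.+ y) (pad x 0) (λ n → even≢odd n x)) (sum-wrap refl (x ℕ.+ y) x))
          (+-identityˡ _))))
    (trans (value (x ℕ.+ y) x)
      (cong₂ (λ z w → superfactorial (pad x 0) * (grid x x z * grid x x w)) (remaining x y) (remaining₁ x y))))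
    where
    open EvenOdd
    arrange : ∀ x → 2 ℕ.* x ≡ x ℕ.+ x ℕ.+ 0
    arrange = solveℕ
    arrange′ : ∀ x y → 2 ℕ.* x ℕ.+ (2 ℕ.* y ℕ.+ 1) ≡ x ℕ.+ y ℕ.+ (x ℕ.+ y) ℕ.+ 1
    arrange′ = solveℕ

  patterns-odd-even : ∀ x y → fromℕ (length (patterns (2 ℕ.* x ℕ.+ 1) (2 ℕ.* y))) ≡
    PP x (x ℕ.+ 1) y ℚ.* PP x (x ℕ.+ 1) y
  patterns-odd-even x y rewrite ℕₚ.+-comm x 1 =
    PP-product x (suc x) y x (suc x) y _ (normalise (superfactorial (pad x 1)) _ _ _ _ (superfactorial-nonzero (pad x 1))
    (trans (pattern-sum (2 ℕ.* x ℕ.+ 1) (2 ℕ.* y) (pad x 1) (pad (x ℕ.+ y) 1)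
        (trans (arrange x) (sym (pad-+ x 1))) (trans (arrange′ x y) (sym (pad-+ (x ℕ.+ y) 1))))
      (trans (sum-oddPalindromes (x ℕ.+ y) _)
        -- Conversely, an odd number of marks forces the centre to be marked.
        (trans (cong₂ _+_ (sum-wrap base (x ℕ.+ y) x)
            (EvenOdd.sum-wrap-parity (x ℕ.+ y) (pad x 1) (λ n → even≢odd x n ∘ sym)))
          (+-identityʳ _))))
    (trans (value (x ℕ.+ y) x)
      (cong (λ z → superfactorial (pad x 1) * (grid x (suc x) z * grid x (suc x) z)) (remaining x y))))
    where
    open OddEven
    base : 1ℤ * 1ℤ ≡ 1ℤ
    base = *-identityˡ 1ℤ
    arrange : ∀ x → 2 ℕ.* x ℕ.+ 1 ≡ x ℕ.+ x ℕ.+ 1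
    arrange = solveℕ
    arrange′ : ∀ x y → 2 ℕ.* x ℕ.+ 1 ℕ.+ 2 ℕ.* y ≡ x ℕ.+ y ℕ.+ (x ℕ.+ y) ℕ.+ 1
    arrange′ = solveℕ

-- The bijection between invariant tilings and patterns

module Tilings where
  open IntegerSums using (Rows; emptyOnly; chains; preds; positions; palindromes; patterns)
  open import Data.Nat using (_+_)

  open DecMembership _≟ₚ_ using () renaming (_∈?_ to _∈ₚ?_)
  open DecMembership _≟ₜ_ using () renaming (_∈?_ to _∈ₜ?_)
  open DecMembership _≟ₗ_ using () renaming (_∈?_ to _∈ₗ?_)

  -- Encoding of interlacing rows

  unique-map : ∀ {A B : Set} (f : A → B) {xs} → Unique xs →
    (∀ {x y} → x ∈ xs → y ∈ xs → f x ≡ f y → x ≡ y) → Unique (map f xs)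
  unique-map f []          inj = []
  unique-map f (x∉ ∷ uniq) inj =
    ¬Any⇒All¬ _ (λ fx∈ → let y , y∈ , eq = ∈-map⁻ f fx∈ in
      All¬⇒¬Any x∉ (subst (_∈ _) (sym (inj (here refl) (there y∈) eq)) y∈))
    ∷ unique-map f uniq (λ x∈ y∈ → inj (there x∈) (there y∈))

  bijection-length : ∀ {A B : Set} (f : A → B) {xs ys} → Unique xs → Unique ys →
    (∀ {x} → x ∈ xs → f x ∈ ys) →
    (∀ {x y} → x ∈ xs → y ∈ xs → f x ≡ f y → x ≡ y) →
    (∀ {y} → y ∈ ys → ∃ λ x → x ∈ xs × f x ≡ y) →
    length xs ≡ length ys
  bijection-length f {xs} {ys} ux uy into inj onto = trans (sym (length-map f xs))
    (↭-length (∼bag⇒↭ (unique∧set⇒bag (unique-map f ux inj) uy (mk⇔ to from))))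
    where
    to : ∀ {y} → y ∈ map f xs → y ∈ ys
    to y∈ with ∈-map⁻ f y∈
    ... | x , x∈ , refl = into x∈
    from : ∀ {y} → y ∈ ys → y ∈ map f xs
    from y∈ with onto y∈
    ... | x , x∈ , refl = ∈-map⁺ f x∈

  module _ {A : Set} where

    ∈-sublists⇒⊆ : ∀ (xs : List A) {ys x} → ys ∈ sublists xs → x ∈ ys → x ∈ xs
    ∈-sublists⇒⊆ []       (here refl) ()
    ∈-sublists⇒⊆ (z ∷ xs) ys∈ x∈ with ∈-++⁻ (map (z ∷_) (sublists xs)) ys∈
    ... | inj₂ ys∈′ = there (∈-sublists⇒⊆ xs ys∈′ x∈)
    ... | inj₁ zs∈ with ∈-map⁻ (z ∷_) zs∈
    ...   | zs , zs∈′ , refl with x∈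
    ...     | here refl = here refl
    ...     | there x∈′ = there (∈-sublists⇒⊆ xs zs∈′ x∈′)

    ∈-sublists-unique : ∀ {xs : List A} {ys} → Unique xs → ys ∈ sublists xs → Unique ys
    ∈-sublists-unique {[]}     _           (here refl) = []
    ∈-sublists-unique {z ∷ xs} (z∉ ∷ uniq) ys∈ with ∈-++⁻ (map (z ∷_) (sublists xs)) ys∈
    ... | inj₂ ys∈′ = ∈-sublists-unique uniq ys∈′
    ... | inj₁ zs∈ with ∈-map⁻ (z ∷_) zs∈
    ...   | zs , zs∈′ , refl =
      ¬Any⇒All¬ _ (All¬⇒¬Any z∉ ∘ ∈-sublists⇒⊆ xs zs∈′) ∷ ∈-sublists-unique uniq zs∈′

    -- Sublists inherit their order from a list without repetitions, so their members determine
    -- them.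
    sublists-extensional : ∀ {xs : List A} {ys zs} → Unique xs → ys ∈ sublists xs → zs ∈ sublists xs →
      (∀ {x} → x ∈ ys → x ∈ zs) → (∀ {x} → x ∈ zs → x ∈ ys) → ys ≡ zs
    sublists-extensional {[]} _ (here refl) (here refl) _ _ = refl
    sublists-extensional {x ∷ xs} (x∉ ∷ uniq) ys∈ zs∈ to from
      with ∈-++⁻ (map (x ∷_) (sublists xs)) ys∈ | ∈-++⁻ (map (x ∷_) (sublists xs)) zs∈
    ... | inj₂ ys∈′ | inj₂ zs∈′ = sublists-extensional uniq ys∈′ zs∈′ to from
    ... | inj₁ ys∈′ | inj₂ zs∈′ with ∈-map⁻ (x ∷_) ys∈′
    ...   | _ , _ , refl = contradiction (∈-sublists⇒⊆ xs zs∈′ (to (here refl))) (All¬⇒¬Any x∉)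
    sublists-extensional {x ∷ xs} (x∉ ∷ uniq) ys∈ zs∈ to from
        | inj₂ ys∈′ | inj₁ zs∈′ with ∈-map⁻ (x ∷_) zs∈′
    ...   | _ , _ , refl = contradiction (∈-sublists⇒⊆ xs ys∈′ (from (here refl))) (All¬⇒¬Any x∉)
    sublists-extensional {x ∷ xs} (x∉ ∷ uniq) ys∈ zs∈ to from
        | inj₁ ys∈′ | inj₁ zs∈′ with ∈-map⁻ (x ∷_) ys∈′ | ∈-map⁻ (x ∷_) zs∈′
    ...   | ys , ys∈″ , refl | zs , zs∈″ , refl =
      cong (x ∷_) (sublists-extensional uniq ys∈″ zs∈″
        (λ y∈ → drop (∈-sublists⇒⊆ xs ys∈″ y∈) (to (there y∈)))
        (λ y∈ → drop (∈-sublists⇒⊆ xs zs∈″ y∈) (from (there y∈))))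
      where
      drop : ∀ {y ws} → y ∈ xs → y ∈ x ∷ ws → y ∈ ws
      drop y∈xs (here refl) = contradiction y∈xs (All¬⇒¬Any x∉)
      drop y∈xs (there y∈)  = y∈

    sublists-unique : ∀ {xs : List A} → Unique xs → Unique (sublists xs)
    sublists-unique []                     = [] ∷ []
    sublists-unique {x ∷ xs} (x∉ ∷ uniq) = Uniqueₚ.++⁺
      (Uniqueₚ.map⁺ ∷-injectiveʳ (sublists-unique uniq)) (sublists-unique uniq) disjoint
      where
      disjoint : ∀ {ys} → ys ∈ map (x ∷_) (sublists xs) × ys ∈ sublists xs → ⊥
      disjoint (ys∈ , ys∈′) with ∈-map⁻ (x ∷_) ys∈
      ... | _ , _ , refl = All¬⇒¬Any x∉ (∈-sublists⇒⊆ xs ys∈′ (here refl))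

    filter-∈-sublists : ∀ {P : Pred A 0ℓ} (P? : Decidable P) xs → filter P? xs ∈ sublists xs
    filter-∈-sublists P? []       = here refl
    filter-∈-sublists P? (x ∷ xs) with does (P? x)
    ... | true  = ∈-++⁺ˡ (∈-map⁺ (x ∷_) (filter-∈-sublists P? xs))
    ... | false = ∈-++⁺ʳ _ (filter-∈-sublists P? xs)

  bit : Bool → ℕ
  bit false = 0
  bit true  = 1

  length-filter-∷ : ∀ {A : Set} {P : Pred A 0ℓ} (P? : Decidable P) x xs →
    length (filter P? (x ∷ xs)) ≡ bit (does (P? x)) + length (filter P? xs)
  length-filter-∷ P? x xs with does (P? x)
  ... | true  = refl
  ... | false = refl

  module _ {A B : Set} (f : A → List B) where

    pairs : List A → List (A × B)
    pairs = concatMap (λ x → map (x ,_) (f x))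

    ∈-pairs⁺ : ∀ {x y xs} → x ∈ xs → y ∈ f x → (x , y) ∈ pairs xs
    ∈-pairs⁺ {x} x∈ y∈ = ∈-concatMap⁺ (λ x → map (x ,_) (f x)) (lose x∈ (∈-map⁺ (x ,_) y∈))

    ∈-pairs⁻ : ∀ {x y xs} → (x , y) ∈ pairs xs → x ∈ xs × y ∈ f x
    ∈-pairs⁻ {xs = xs} p∈ with find (∈-concatMap⁻ (λ x → map (x ,_) (f x)) {xs = xs} p∈)
    ... | x , x∈ , xy∈ with ∈-map⁻ (x ,_) xy∈
    ...   | y , y∈ , refl = x∈ , y∈

    pairs-unique : ∀ {xs} → Unique xs → (∀ x → Unique (f x)) → Unique (pairs xs)
    pairs-unique []                      uf = []
    pairs-unique {x ∷ xs} (x∉ ∷ uniq) uf = Uniqueₚ.++⁺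
      (Uniqueₚ.map⁺ (λ { refl → refl }) (uf x)) (pairs-unique uniq uf) disjoint
      where
      disjoint : ∀ {z} → z ∈ map (x ,_) (f x) × z ∈ pairs xs → ⊥
      disjoint (z∈ , z∈′) with ∈-map⁻ (x ,_) z∈
      ... | _ , _ , refl = All¬⇒¬Any x∉ (proj₁ (∈-pairs⁻ z∈′))

  ∷-branches-unique : ∀ {n} {xs ys : List (Vec Bool n)} → Unique xs → Unique ys →
    Unique (map (false ∷_) xs ++ map (true ∷_) ys)
  ∷-branches-unique ux uy = Uniqueₚ.++⁺
    (Uniqueₚ.map⁺ ∷ᵥ-injectiveʳ ux) (Uniqueₚ.map⁺ ∷ᵥ-injectiveʳ uy) disjoint
    where
    disjoint : ∀ {n} {xs ys : List (Vec Bool n)} {z} →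
      z ∈ map (false ∷_) xs × z ∈ map (true ∷_) ys → ⊥
    disjoint (z∈ , z∈′) with ∈-map⁻ (false ∷_) z∈
    ... | _ , _ , refl with ∈-map⁻ (true ∷_) z∈′
    ...   | _ , _ , ()

  preds-unique : ∀ b {n} (u : Vec Bool (suc n)) → Unique (preds b u)
  preds-unique false {zero}  (false ∷ []) = []
  preds-unique false {zero}  (true  ∷ []) = [] ∷ []
  preds-unique true  {zero}  (false ∷ []) = [] ∷ []
  preds-unique true  {zero}  (true  ∷ []) = []
  preds-unique false {suc n} (false ∷ u)  = Uniqueₚ.map⁺ ∷ᵥ-injectiveʳ (preds-unique false u)
  preds-unique false {suc n} (true  ∷ u)  = ∷-branches-unique (preds-unique true u) (preds-unique false u)
  preds-unique true  {suc n} (false ∷ u)  = ∷-branches-unique (preds-unique true u) (preds-unique false u)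
  preds-unique true  {suc n} (true  ∷ u)  = []

  chains-unique : ∀ c h u → Unique (chains c h u)
  chains-unique c zero    u = base (positions u)
    where
    base : ∀ ps → Unique (emptyOnly c ps)
    base []      = [] ∷ []
    base (_ ∷ _) = []
  chains-unique c (suc h) u = pairs-unique (chains c h) (preds-unique false u) (chains-unique c h)

  palindromes-unique : ∀ n → Unique (palindromes n)
  palindromes-unique zero          = [] ∷ []
  palindromes-unique (suc zero)    = ((λ ()) ∷ []) ∷ ([] ∷ [])
  palindromes-unique (suc (suc n)) = Uniqueₚ.++⁺
    (Uniqueₚ.map⁺ inner (palindromes-unique n)) (Uniqueₚ.map⁺ inner (palindromes-unique n)) disjoint
    where
    inner : ∀ {b : Bool} {v w : Vec Bool n} → b ∷ (v ∷ʳ b) ≡ b ∷ (w ∷ʳ b) → v ≡ w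
    inner {v = v} {w} eq = proj₁ (∷ʳ-injective v w (∷ᵥ-injectiveʳ eq))
    disjoint : ∀ {z} → z ∈ map (λ w → true ∷ (w ∷ʳ true)) (palindromes n) ×
      z ∈ map (λ w → false ∷ (w ∷ʳ false)) (palindromes n) → ⊥
    disjoint (z∈ , z∈′) with ∈-map⁻ (λ w → true ∷ (w ∷ʳ true)) z∈
    ... | _ , _ , refl with ∈-map⁻ (λ w → false ∷ (w ∷ʳ false)) z∈′
    ...   | _ , _ , ()

  patterns-unique : ∀ a c → Unique (patterns a c)
  patterns-unique a c = pairs-unique (chains c a) (palindromes-unique (a + c)) (chains-unique c a)

  prefix : ∀ n → (ℕ → Bool) → Vec Bool n
  prefix zero    f = []
  prefix (suc n) f = f 0 ∷ prefix n (f ∘ suc)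

  prefix-cong : ∀ n {f g} → (∀ {i} → i < n → f i ≡ g i) → prefix n f ≡ prefix n g
  prefix-cong zero    eq = refl
  prefix-cong (suc n) eq = cong₂ _∷_ (eq (s≤s z≤n)) (prefix-cong n (eq ∘ s≤s))

  prefix-injective : ∀ n {f g i} → prefix n f ≡ prefix n g → i < n → f i ≡ g i
  prefix-injective (suc n) {i = zero}  eq _         = ∷-injectiveˡ eq
  prefix-injective (suc n) {i = suc i} eq (s≤s i<n) = prefix-injective n (∷ᵥ-injectiveʳ eq) i<n

  entry : ∀ {n} → Vec Bool n → ℕ → Bool
  entry []      i       = false
  entry (b ∷ v) zero    = b
  entry (b ∷ v) (suc i) = entry v i

  prefix-entry : ∀ {n} (v : Vec Bool n) → prefix n (entry v) ≡ v
  prefix-entry []      = refl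
  prefix-entry (b ∷ v) = cong (b ∷_) (prefix-entry v)

  prefix-snoc : ∀ n f → prefix (suc n) f ≡ prefix n f ∷ʳ f n
  prefix-snoc zero    f = refl
  prefix-snoc (suc n) f = cong (f 0 ∷_) (prefix-snoc n (f ∘ suc))

  prefix-palindrome⁻ : ∀ n f → prefix n f ∈ palindromes n → ∀ {i j} → suc (i + j) ≡ n → f i ≡ f j
  prefix-palindrome⁻ (suc zero)    f f∈ {zero} {zero} refl = refl
  prefix-palindrome⁻ (suc (suc n)) f f∈ {i} {j} eq =
    let w , w∈ , inner , _ , front , back = decompose in ends w∈ inner (trans front (sym back)) i j eq
    where
    decompose : ∃ λ w → w ∈ palindromes n × prefix n (f ∘ suc) ≡ w × ∃ λ b → f 0 ≡ b × f (suc n) ≡ b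
    decompose with ∈-++⁻ (map (λ w → true ∷ (w ∷ʳ true)) (palindromes n)) f∈
    ... | inj₁ f∈′ with ∈-map⁻ (λ w → true ∷ (w ∷ʳ true)) f∈′
    ...   | w , w∈ , eq with ∷ʳ-injective (prefix n (f ∘ suc)) w (trans (sym (prefix-snoc n (f ∘ suc))) (∷ᵥ-injectiveʳ eq))
    ...     | inner , back = w , w∈ , inner , true , ∷-injectiveˡ eq , back
    decompose | inj₂ f∈′ with ∈-map⁻ (λ w → false ∷ (w ∷ʳ false)) f∈′
    ...   | w , w∈ , eq with ∷ʳ-injective (prefix n (f ∘ suc)) w (trans (sym (prefix-snoc n (f ∘ suc))) (∷ᵥ-injectiveʳ eq))
    ...     | inner , back = w , w∈ , inner , false , ∷-injectiveˡ eq , back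
    ends : ∀ {w} → w ∈ palindromes n → prefix n (f ∘ suc) ≡ w → f 0 ≡ f (suc n) →
      ∀ i j → suc (i + j) ≡ suc (suc n) → f i ≡ f j
    ends w∈ inner outer zero    (suc j) refl = outer
    ends w∈ inner outer (suc i) zero    eq rewrite ℕₚ.+-identityʳ i with refl ← eq = sym outer
    ends w∈ refl  outer (suc i) (suc j) eq =
      prefix-palindrome⁻ n (f ∘ suc) w∈ (trans (sym (ℕₚ.+-suc i j)) (ℕₚ.suc-injective (ℕₚ.suc-injective eq)))

  prefix-palindrome⁺ : ∀ n f → (∀ {i j} → suc (i + j) ≡ n → f i ≡ f j) → prefix n f ∈ palindromes n
  prefix-palindrome⁺ zero          f sym-f = here refl
  prefix-palindrome⁺ (suc zero)    f sym-f with f 0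
  ... | true  = here refl
  ... | false = there (here refl)
  prefix-palindrome⁺ (suc (suc n)) f sym-f = subst (_∈ palindromes (suc (suc n)))
    (cong (f 0 ∷_) (sym (trans (prefix-snoc n (f ∘ suc))
      (cong (prefix n (f ∘ suc) ∷ʳ_) (sym (sym-f {0} {suc n} refl))))))
    (place (f 0) (prefix-palindrome⁺ n (f ∘ suc) λ {i} {j} eq → sym-f (cong suc (trans (cong suc (ℕₚ.+-suc i j)) (cong suc eq)))))
    where
    place : ∀ b {w} → w ∈ palindromes n → b ∷ (w ∷ʳ b) ∈ palindromes (suc (suc n))
    place true  w∈ = ∈-++⁺ˡ (∈-map⁺ (λ w → true ∷ (w ∷ʳ true)) w∈)
    place false w∈ = ∈-++⁺ʳ _ (∈-map⁺ (λ w → false ∷ (w ∷ʳ false)) w∈)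

  -- The triangles of a strip, from left to right, are △₀ ▽₀ △₁ … ▽ₙ₋₁ △ₙ.  D and U
  -- mark those covered from below and from above, X i covers △ᵢ and ▽ᵢ together,
  -- and Y (suc i) covers ▽ᵢ and △ᵢ₊₁.
  record Strip (n : ℕ) (D U X Y : ℕ → Bool) : Set where
    field
      up   : ∀ {i} → i < n → bit (Y i) + bit (X i) + bit (U i) ≡ 1
      down : ∀ {i} → i < n → bit (X i) + bit (Y (suc i)) + bit (D i) ≡ 1
      end  : bit (Y n) + bit (U n) ≡ 1

  open Strip public

  strip-tail : ∀ {n D U X Y} → Strip (suc n) D U X Y → Strip n (D ∘ suc) (U ∘ suc) (X ∘ suc) (Y ∘ suc)
  strip-tail s .up   = up s ∘ s≤s
  strip-tail s .down = down s ∘ s≤s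
  strip-tail s .end  = end s

  -- The flag of `preds` is `Y i`: it is set when the △ at hand is already covered together with the
  -- ▽ on its left, that is, when the last mark passed belongs to the upper row.
  step : ∀ {n} y x u y′ d {w : Vec Bool n} {v} → bit y + bit x + bit u ≡ 1 → bit x + bit y′ + bit d ≡ 1 →
    w ∈ preds y′ v → d ∷ w ∈ preds y (u ∷ v)
  step false false false y′    d     ()   _    _
  step false true  true  y′    d     ()   _    _
  step true  false true  y′    d     ()   _    _
  step true  true  u     y′    d     ()   _    _
  step false true  false true  d     refl ()   _
  step false true  false false true  refl ()   _
  step false true  false false false refl refl w∈ = ∈-map⁺ (false ∷_) w∈
  step false false true  true  true  refl ()   _
  step false false true  false false refl ()   _
  step false false true  true  false refl refl w∈ = ∈-++⁺ˡ (∈-map⁺ (false ∷_) w∈)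
  step false false true  false true  refl refl w∈ = ∈-++⁺ʳ _ (∈-map⁺ (true ∷_) w∈)
  step true  false false true  true  refl ()   _
  step true  false false false false refl ()   _
  step true  false false true  false refl refl w∈ = ∈-++⁺ˡ (∈-map⁺ (false ∷_) w∈)
  step true  false false false true  refl refl w∈ = ∈-++⁺ʳ _ (∈-map⁺ (true ∷_) w∈)

  strip⇒preds : ∀ n {D U X Y} → Strip n D U X Y → prefix n D ∈ preds (Y 0) (prefix (suc n) U)
  strip⇒preds zero {D} {U} {X} {Y} s = base (Y 0) (U 0) (end s)
    where
    base : ∀ y u → bit y + bit u ≡ 1 → [] ∈ preds y (u ∷ [])
    base false true  _ = here refl
    base true  false _ = here refl
    base false false ()
    base true  true  ()
  strip⇒preds (suc n) {D} {U} {X} {Y} s =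
    step (Y 0) (X 0) (U 0) (Y 1) (D 0) (up s (s≤s z≤n)) (down s (s≤s z≤n)) (strip⇒preds n (strip-tail s))

  horizontal : Bool → Bool → Bool
  horizontal y u = not (y ∨ u)

  -- The marks on its two bounding lines force all lozenges inside a strip: from left to right, each
  -- triangle is covered by its left neighbour, by its mark, or else by its right neighbour.
  flow : Bool → (ℕ → Bool) → (ℕ → Bool) → ℕ → Bool
  flow y D U zero    = y
  flow y D U (suc i) = flow (horizontal (horizontal y (U 0)) (D 0)) (D ∘ suc) (U ∘ suc) i

  crossing : Bool → (ℕ → Bool) → (ℕ → Bool) → ℕ → Bool
  crossing y D U i = horizontal (flow y D U i) (U i)

  unstep : ∀ {n} y u d {w : Vec Bool n} {v} → d ∷ w ∈ preds y (u ∷ v) →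
    (bit y + bit (horizontal y u) + bit u ≡ 1) ×
    (bit (horizontal y u) + bit (horizontal (horizontal y u) d) + bit d ≡ 1) ×
    w ∈ preds (horizontal (horizontal y u) d) v
  unstep false false d p∈ with ∈-map⁻ (false ∷_) p∈
  ... | _ , w∈ , refl = refl , refl , w∈
  unstep false true d {v = v} p∈ with ∈-++⁻ (map (false ∷_) (preds true v)) p∈
  ... | inj₁ q∈ with ∈-map⁻ (false ∷_) q∈
  ...   | _ , w∈ , refl = refl , refl , w∈
  unstep false true d {v = v} p∈ | inj₂ q∈ with ∈-map⁻ (true ∷_) q∈
  ...   | _ , w∈ , refl = refl , refl , w∈
  unstep true false d {v = v} p∈ with ∈-++⁻ (map (false ∷_) (preds true v)) p∈
  ... | inj₁ q∈ with ∈-map⁻ (false ∷_) q∈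
  ...   | _ , w∈ , refl = refl , refl , w∈
  unstep true false d {v = v} p∈ | inj₂ q∈ with ∈-map⁻ (true ∷_) q∈
  ...   | _ , w∈ , refl = refl , refl , w∈
  unstep true true d ()

  preds⇒strip : ∀ n {D U} y → prefix n D ∈ preds y (prefix (suc n) U) →
    Strip n D U (crossing y D U) (flow y D U)
  preds⇒strip zero {D} {U} y p∈ = record { up = λ () ; down = λ () ; end = base y (U 0) p∈ }
    where
    base : ∀ y u → [] ∈ preds y (u ∷ []) → bit y + bit u ≡ 1
    base false true  _ = refl
    base true  false _ = refl
    base false false ()
    base true  true  ()
  preds⇒strip (suc n) {D} {U} y p∈ with unstep y (U 0) (D 0) p∈
  ... | first-up , first-down , rest∈ = record { up = up′ ; down = down′ ; end = end rest }
    where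
    rest = preds⇒strip n {D ∘ suc} {U ∘ suc} (horizontal (horizontal y (U 0)) (D 0)) rest∈
    up′ : ∀ {i} → i < suc n → bit (flow y D U i) + bit (crossing y D U i) + bit (U i) ≡ 1
    up′ {zero}  _         = first-up
    up′ {suc i} (s≤s i<n) = up rest i<n
    down′ : ∀ {i} → i < suc n → bit (crossing y D U i) + bit (flow y D U (suc i)) + bit (D i) ≡ 1
    down′ {zero}  _         = first-down
    down′ {suc i} (s≤s i<n) = down rest i<n

  exactlyOne : ∀ a b c → bit a + bit b + bit c ≡ 1 → b ≡ horizontal a c
  exactlyOne false true  false _ = refl
  exactlyOne true  false false _ = refl
  exactlyOne false false true  _ = refl
  exactlyOne false false false ()
  exactlyOne false true  true  ()
  exactlyOne true  false true  ()
  exactlyOne true  true  c     ()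

  strip-X : ∀ {n D U X Y} → Strip n D U X Y → ∀ {i} → i < n → X i ≡ horizontal (Y i) (U i)
  strip-X {U = U} {X} {Y} s {i} i<n = exactlyOne (Y i) (X i) (U i) (up s i<n)

  strip-Y : ∀ {n D U X Y} → Strip n D U X Y → ∀ {i} → i < n → Y (suc i) ≡ horizontal (X i) (D i)
  strip-Y {D = D} {X = X} {Y} s {i} i<n = exactlyOne (X i) (Y (suc i)) (D i) (down s i<n)

  strip-determined : ∀ {n D U X Y D′ U′ X′ Y′} → Strip n D U X Y → Strip n D′ U′ X′ Y′ →
    Y 0 ≡ Y′ 0 → (∀ {i} → i < n → D i ≡ D′ i) → (∀ {i} → i < n → U i ≡ U′ i) →
    ∀ {i} → i < n → X i ≡ X′ i × Y (suc i) ≡ Y′ (suc i)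
  strip-determined {n} {X = X} {Y} {X′ = X′} {Y′} s s′ start D≡ U≡ {i} i<n =
    same-X i i<n , same-Y (suc i) i<n
    where
    same-Y : ∀ i → i ≤ n → Y i ≡ Y′ i
    same-X : ∀ i → i < n → X i ≡ X′ i
    same-Y zero    _   = start
    same-Y (suc i) i<n = trans (strip-Y s i<n) (trans (cong₂ horizontal (same-X i i<n) (D≡ i<n)) (sym (strip-Y s′ i<n)))
    same-X i i<n = trans (strip-X s i<n)
      (trans (cong₂ horizontal (same-Y i (ℕₚ.<⇒≤ i<n)) (U≡ i<n)) (sym (strip-X s′ i<n)))

  positions-empty⁺ : ∀ n {f} → (∀ {i} → i < n → f i ≡ false) → positions (prefix n f) ≡ []
  positions-empty⁺ zero        eq = refl
  positions-empty⁺ (suc n) {f} eq rewrite eq {0} (s≤s z≤n) = positions-empty⁺ n (eq ∘ s≤s)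

  positions-empty⁻ : ∀ n {f} → positions (prefix n f) ≡ [] → ∀ {i} → i < n → f i ≡ false
  positions-empty⁻ (suc n) {f} eq {i} i<n = go (f 0) refl eq i i<n
    where
    go : ∀ b → f 0 ≡ b → positions (b ∷ prefix n (f ∘ suc)) ≡ [] → ∀ i → i < suc n → f i ≡ false
    go false f0 eq zero    _         = f0
    go false f0 eq (suc i) (s≤s i<n) = positions-empty⁻ n eq i<n

  -- Chains of rows as Boolean fields

  module _ (c : ℕ) where

    rows : (ℕ → ℕ → Bool) → ∀ h → Rows c h
    rows V zero    = tt
    rows V (suc h) = prefix (h + c) (V h) , rows V h

    rows-cong : ∀ {V W} h → (∀ {k i} → k < h → i < k + c → V k i ≡ W k i) → rows V h ≡ rows W h
    rows-cong zero    eq = refl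
    rows-cong (suc h) eq = cong₂ _,_ (prefix-cong (h + c) (eq ℕₚ.≤-refl))
      (rows-cong h (λ k<h → eq (ℕₚ.m≤n⇒m≤1+n k<h)))

    rows-injective : ∀ {V W} h → rows V h ≡ rows W h → ∀ {k i} → k < h → i < k + c → V k i ≡ W k i
    rows-injective {V} {W} (suc h) eq {k} k<1+h i< with k ℕ.≟ h
    ... | yes refl = prefix-injective (h + c) (cong proj₁ eq) i<
    ... | no k≢h   = rows-injective h (cong proj₂ eq) (ℕₚ.≤∧≢⇒< (ℕₚ.≤-pred k<1+h) k≢h) i<

    entries : ∀ h → Rows c h → ℕ → ℕ → Bool
    entries zero    _        k i = false
    entries (suc h) (d , rs) k i with k ℕ.≟ h
    ... | yes _ = entry d i
    ... | no  _ = entries h rs k i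

    rows-field : ∀ h (rs : Rows c h) → rows (entries h rs) h ≡ rs
    rows-field zero    rs       = refl
    rows-field (suc h) (d , rs) = cong₂ _,_
      (trans (prefix-cong (h + c) top) (prefix-entry d))
      (trans (rows-cong h below) (rows-field h rs))
      where
      top : ∀ {i} → i < h + c → entries (suc h) (d , rs) h i ≡ entry d i
      top _ with h ℕ.≟ h
      ... | yes _  = refl
      ... | no h≢h = contradiction refl h≢h
      below : ∀ {k i} → k < h → i < k + c → entries (suc h) (d , rs) k i ≡ entries h rs k i
      below {k} k<h _ with k ℕ.≟ h
      ... | yes refl = contradiction k<h (ℕₚ.<-irrefl refl)
      ... | no  _    = refl

    record Interlaced (V : ℕ → ℕ → Bool) (h : ℕ) : Set where
      field
        bottom : ∀ {i} → i < c → V 0 i ≡ false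
        preds∈ : ∀ {k} → k < h → prefix (k + c) (V k) ∈ preds false (prefix (suc k + c) (V (suc k)))

    open Interlaced public

    chains⁺ : ∀ {V} h → Interlaced V h → rows V h ∈ chains c h (prefix (h + c) (V h))
    chains⁺ {V} zero    il rewrite positions-empty⁺ c (bottom il) = here refl
    chains⁺ {V} (suc h) il = ∈-pairs⁺ (chains c h) (preds∈ il ℕₚ.≤-refl)
      (chains⁺ h record { bottom = bottom il ; preds∈ = λ k<h → preds∈ il (ℕₚ.m≤n⇒m≤1+n k<h) })

    chains⁻ : ∀ {V} h → rows V h ∈ chains c h (prefix (h + c) (V h)) → Interlaced V h
    chains⁻ {V} zero    r∈ = record { bottom = positions-empty⁻ c (empty (positions (prefix c (V 0))) r∈) ; preds∈ = λ () }
      where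
      empty : ∀ ps → tt ∈ emptyOnly c ps → ps ≡ []
      empty [] _ = refl
    chains⁻ {V} (suc h) r∈ with ∈-pairs⁻ (chains c h) {xs = preds false (prefix (suc h + c) (V (suc h)))} r∈
    ... | p∈ , rest∈ with chains⁻ h rest∈
    ...   | il = record { bottom = bottom il ; preds∈ = all }
      where
      all : ∀ {k} → k < suc h → prefix (k + c) (V k) ∈ preds false (prefix (suc k + c) (V (suc k)))
      all {k} k<1+h with k ℕ.≟ h
      ... | yes refl = p∈
      ... | no k≢h   = preds∈ il (ℕₚ.≤∧≢⇒< (ℕₚ.≤-pred k<1+h) k≢h)

  module _ (a c : ℕ) {V : ℕ → ℕ → Bool} where

    patterns⁺ : Interlaced c V a → (∀ {i j} → suc (i + j) ≡ a + c → V a i ≡ V a j) →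
      rows c V (suc a) ∈ patterns a c
    patterns⁺ il sym-V = ∈-pairs⁺ (chains c a) (prefix-palindrome⁺ (a + c) (V a) sym-V) (chains⁺ c a il)

    patterns⁻ : rows c V (suc a) ∈ patterns a c →
      Interlaced c V a × (∀ {i j} → suc (i + j) ≡ a + c → V a i ≡ V a j)
    patterns⁻ r∈ with ∈-pairs⁻ (chains c a) {xs = palindromes (a + c)} r∈
    ... | u∈ , rest∈ = chains⁻ c a rest∈ , prefix-palindrome⁻ (a + c) (V a) u∈

  -- Lozenges of the hexagon

  -- A `vertical` lozenge crosses the line between two strips and is what the rows record; the other
  -- two kinds lie within one strip.
  data Shape : Lozenge → Set where
    vertical : ∀ p q → Shape ((▽ , p , q) , (△ , p , q))
    eastern  : ∀ p q → Shape ((▽ , p , q) , (△ , suc p , q))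
    northern : ∀ p q → Shape ((▽ , p , q) , (△ , p , suc q))

  length-filter₃ : ∀ {A : Set} {P : Pred A 0ℓ} (P? : Decidable P) x y z {i j k} →
    does (P? x) ≡ i → does (P? y) ≡ j → does (P? z) ≡ k →
    length (filter P? (x ∷ y ∷ z ∷ [])) ≡ bit i + (bit j + (bit k + 0))
  length-filter₃ P? x y z refl refl refl = trans (length-filter-∷ P? x (y ∷ z ∷ []))
    (cong (bit (does (P? x)) +_) (trans (length-filter-∷ P? y (z ∷ []))
      (cong (bit (does (P? y)) +_) (length-filter-∷ P? z []))))

  -- A △ that meets the ▽ shares an edge with it or is one of three that touch it in a single
  -- vertex; the count 2 excludes the latter. The count is first rewritten as a sum over three
  -- decisions, so that these can be matched on.
  shape : ∀ p q p′ q′ → SharesEdge (▽ , p , q) (△ , p′ , q′) → Shape ((▽ , p , q) , (△ , p′ , q′))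
  shape p q p′ q′ eq = common
    ((suc p , suc q) ∈ₚ? vertices (△ , p′ , q′)) ((p , suc q) ∈ₚ? vertices (△ , p′ , q′))
    ((suc p , q) ∈ₚ? vertices (△ , p′ , q′))
    (trans (sym (length-filter₃ (_∈ₚ? vertices (△ , p′ , q′)) (suc p , suc q) (p , suc q) (suc p , q) refl refl refl)) eq)
    where
    common : ∀ {p q p′ q′} (x : Dec ((suc p , suc q) ∈ vertices (△ , p′ , q′)))
      (y : Dec ((p , suc q) ∈ vertices (△ , p′ , q′))) (z : Dec ((suc p , q) ∈ vertices (△ , p′ , q′))) →
      bit (does x) + (bit (does y) + (bit (does z) + 0)) ≡ 2 → Shape ((▽ , p , q) , (△ , p′ , q′))
    common (yes (there (here refl)))         _ _ _ = northern _ _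
    common (yes (there (there (here refl)))) _ _ _ = eastern _ _
    common (yes (here refl)) (yes (here ()))                 _ _
    common (yes (here refl)) (yes (there (here ())))         _ _
    common (yes (here refl)) (yes (there (there (here ())))) _ _
    common (yes (here refl)) (no _) (yes (here ()))                 _
    common (yes (here refl)) (no _) (yes (there (here ())))         _
    common (yes (here refl)) (no _) (yes (there (there (here ())))) _
    common (yes (here refl)) (no _) (no _) ()
    common (no _) (yes (here refl))                 _ _ = northern _ _
    common (no _) (yes (there (there (here refl)))) _ _ = vertical _ _
    common (no _) (yes (there (here refl))) (yes (here ()))                 _
    common (no _) (yes (there (here refl))) (yes (there (here ())))         _
    common (no _) (yes (there (here refl))) (yes (there (there (here ())))) _
    common (no _) (yes (there (here refl))) (no _) ()
    common (no _) (no _) (yes _) ()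
    common (no _) (no _) (no _)  ()

  sharesEdge : ∀ {s t} → Shape (s , t) → SharesEdge s t
  sharesEdge (vertical p q) = length-filter₃ (_∈ₚ? vertices (△ , p , q)) (suc p , suc q) (p , suc q) (suc p , q)
    (dec-false ((suc p , suc q) ∈ₚ? vertices (△ , p , q))
      λ { (here ()) ; (there (here ())) ; (there (there (here ()))) })
    (dec-true ((p , suc q) ∈ₚ? vertices (△ , p , q)) (there (there (here refl))))
    (dec-true ((suc p , q) ∈ₚ? vertices (△ , p , q)) (there (here refl)))
  sharesEdge (eastern p q) = length-filter₃ (_∈ₚ? vertices (△ , suc p , q)) (suc p , suc q) (p , suc q) (suc p , q)
    (dec-true ((suc p , suc q) ∈ₚ? vertices (△ , suc p , q)) (there (there (here refl))))
    (dec-false ((p , suc q) ∈ₚ? vertices (△ , suc p , q))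
      λ { (here ()) ; (there (here ())) ; (there (there (here ()))) })
    (dec-true ((suc p , q) ∈ₚ? vertices (△ , suc p , q)) (here refl))
  sharesEdge (northern p q) = length-filter₃ (_∈ₚ? vertices (△ , p , suc q)) (suc p , suc q) (p , suc q) (suc p , q)
    (dec-true ((suc p , suc q) ∈ₚ? vertices (△ , p , suc q)) (there (here refl)))
    (dec-true ((p , suc q) ∈ₚ? vertices (△ , p , suc q)) (here refl))
    (dec-false ((suc p , q) ∈ₚ? vertices (△ , p , suc q))
      λ { (here ()) ; (there (here ())) ; (there (there (here ()))) })

  -- The strips run along the direction e₂ - e₁; level t is c plus the number of
  -- the strip containing t.
  level : Triangle → ℕ
  level (△ , p , q) = p + q
  level (▽ , p , q) = suc (p + q)

  level-≤ : ∀ {s t} → Shape (s , t) → level t ≤ level s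
  level-≤ (vertical p q) = ℕₚ.n≤1+n (p + q)
  level-≤ (eastern p q)  = ℕₚ.≤-refl
  level-≤ (northern p q) = ℕₚ.≤-reflexive (ℕₚ.+-suc p q)

  ∸-suc : ∀ {i n} → i < n → n ∸ i ≡ suc (n ∸ suc i)
  ∸-suc {zero}  {suc n} _         = refl
  ∸-suc {suc i} {suc n} (s≤s i<n) = ∸-suc i<n

  complement-≤ : ∀ {s t} u v → s + t ≡ u + v → u ≤ s → t ≤ v
  complement-≤ {s} {t} u v eq u≤s =
    ℕₚ.+-cancelˡ-≤ u t v (ℕₚ.≤-trans (ℕₚ.+-monoˡ-≤ t u≤s) (ℕₚ.≤-reflexive eq))

  complement-≥ : ∀ {s t} u v → s + t ≡ u + v → s ≤ u → v ≤ t
  complement-≥ {s} {t} u v eq s≤u =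
    ℕₚ.+-cancelˡ-≤ s v t (ℕₚ.≤-trans (ℕₚ.+-monoˡ-≤ v s≤u) (ℕₚ.≤-reflexive (sym eq)))

  module _ (a c : ℕ) where

    open Hexagon a a c

    M : ℕ
    M = a + c

    -- The conditions imposed by the extreme vertices, which imply all others. They say that the
    -- strip number `level t - c` runs from 0 to `2a - 1`.
    record Inside (t : Triangle) : Set where
      constructor inside
      field
        left   : proj₁ (proj₂ t) < M
        right  : proj₂ (proj₂ t) < M
        bottom : c ≤ level t
        top    : level t < a + a + c

    inside⇒vertices : ∀ t → Inside t → All InHexagon (vertices t)
    inside⇒vertices (△ , p , q) (inside p< q< c≤ l<) =
      (ℕₚ.<⇒≤ p< , ℕₚ.<⇒≤ q< , c≤ , ℕₚ.<⇒≤ l<) ∷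
      (p< , ℕₚ.<⇒≤ q< , ℕₚ.m≤n⇒m≤1+n c≤ , l<) ∷
      (ℕₚ.<⇒≤ p< , q< , subst (c ≤_) (sym (ℕₚ.+-suc p q)) (ℕₚ.m≤n⇒m≤1+n c≤)
                      , subst (_≤ a + a + c) (sym (ℕₚ.+-suc p q)) l<) ∷ []
    inside⇒vertices (▽ , p , q) (inside p< q< c≤ l<) =
      (p< , q< , subst (c ≤_) (cong suc (sym (ℕₚ.+-suc p q))) (ℕₚ.m≤n⇒m≤1+n c≤)
               , subst (_≤ a + a + c) (cong suc (sym (ℕₚ.+-suc p q))) l<) ∷
      (ℕₚ.<⇒≤ p< , q< , subst (c ≤_) (sym (ℕₚ.+-suc p q)) c≤
                      , subst (_≤ a + a + c) (sym (ℕₚ.+-suc p q)) (ℕₚ.<⇒≤ l<)) ∷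
      (p< , ℕₚ.<⇒≤ q< , c≤ , ℕₚ.<⇒≤ l<) ∷ []

    vertices⇒inside : ∀ t → All InHexagon (vertices t) → Inside t
    vertices⇒inside (△ , p , q) ((_ , _ , c≤ , _) ∷ (p< , _ , _ , l<) ∷ (_ , q< , _) ∷ []) = inside p< q< c≤ l<
    vertices⇒inside (▽ , p , q) ((p< , q< , _ , l<) ∷ _ ∷ (_ , _ , c≤ , _) ∷ []) =
      inside p< q< c≤ (subst (_≤ a + a + c) (cong suc (ℕₚ.+-suc p q)) l<)

    ∈-trianglesOf⁺ : ∀ {o p q} → Inside (o , p , q) → (o , p , q) ∈ trianglesOf o
    ∈-trianglesOf⁺ {o} {p} {q} ins@(inside p< q< _ _) = ∈-filter⁺ (λ t → All.all? inHexagon? (vertices t))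
      (∈-map⁺ (o ,_) (∈-cartesianProduct⁺ (∈-upTo⁺ p<) (∈-upTo⁺ q<))) (inside⇒vertices _ ins)

    ∈-trianglesOf⁻ : ∀ {o t} → t ∈ trianglesOf o → proj₁ t ≡ o × Inside t
    ∈-trianglesOf⁻ {o} {t} t∈ with ∈-filter⁻ (λ t → All.all? inHexagon? (vertices t))
      {xs = map (o ,_) (cartesianProduct (upTo (a + c)) (upTo (a + c)))} t∈
    ... | t∈′ , all with ∈-map⁻ (o ,_) t∈′
    ...   | _ , _ , refl = refl , vertices⇒inside _ all

    inside⇒∈ : ∀ {t} → Inside t → t ∈ allTriangles
    inside⇒∈ {△ , p , q} ins = ∈-++⁺ˡ (∈-trianglesOf⁺ ins)
    inside⇒∈ {▽ , p , q} ins = ∈-++⁺ʳ (trianglesOf △) (∈-trianglesOf⁺ ins)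

    ∈⇒inside : ∀ {t} → t ∈ allTriangles → Inside t
    ∈⇒inside t∈ with ∈-++⁻ (trianglesOf △) t∈
    ... | inj₁ t∈′ = proj₂ (∈-trianglesOf⁻ t∈′)
    ... | inj₂ t∈′ = proj₂ (∈-trianglesOf⁻ t∈′)

    trianglesOf-unique : ∀ o → Unique (trianglesOf o)
    trianglesOf-unique o = Uniqueₚ.filter⁺ (λ t → All.all? inHexagon? (vertices t))
      (Uniqueₚ.map⁺ (λ { refl → refl }) (Uniqueₚ.cartesianProduct⁺ (Uniqueₚ.upTo⁺ (a + c)) (Uniqueₚ.upTo⁺ (a + c))))

    allLozenges-unique : Unique allLozenges
    allLozenges-unique = Uniqueₚ.filter⁺ (λ (s , t) → sharesEdge? s t)
      (Uniqueₚ.cartesianProduct⁺ (trianglesOf-unique ▽) (trianglesOf-unique △))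

    lozenge⁺ : ∀ {s t} → Shape (s , t) → Inside s → Inside t → (s , t) ∈ allLozenges
    lozenge⁺ {s} {t} sh si ti = ∈-filter⁺ (λ (s , t) → sharesEdge? s t)
      (∈-cartesianProduct⁺ (lower∈ sh si) (upper∈ sh ti)) (sharesEdge sh)
      where
      lower∈ : ∀ {s t} → Shape (s , t) → Inside s → s ∈ trianglesOf ▽
      lower∈ (vertical p q) = ∈-trianglesOf⁺
      lower∈ (eastern p q)  = ∈-trianglesOf⁺
      lower∈ (northern p q) = ∈-trianglesOf⁺
      upper∈ : ∀ {s t} → Shape (s , t) → Inside t → t ∈ trianglesOf △
      upper∈ (vertical p q) = ∈-trianglesOf⁺
      upper∈ (eastern p q)  = ∈-trianglesOf⁺
      upper∈ (northern p q) = ∈-trianglesOf⁺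

    lozenge⁻ : ∀ {s t} → (s , t) ∈ allLozenges → Shape (s , t) × Inside s × Inside t
    lozenge⁻ {▽ , p , q} {△ , p′ , q′} l∈ with ∈-filter⁻ (λ (s , t) → sharesEdge? s t)
      {xs = cartesianProduct (trianglesOf ▽) (trianglesOf △)} l∈
    ... | l∈′ , edge with ∈-cartesianProduct⁻ (trianglesOf ▽) (trianglesOf △) l∈′
    ...   | s∈ , t∈ = shape p q p′ q′ edge , proj₂ (∈-trianglesOf⁻ s∈) , proj₂ (∈-trianglesOf⁻ t∈)
    lozenge⁻ {△ , _} {_} l∈ with ∈-filter⁻ (λ (s , t) → sharesEdge? s t)
      {xs = cartesianProduct (trianglesOf ▽) (trianglesOf △)} l∈
    ... | l∈′ , _ with ∈-trianglesOf⁻ (proj₁ (∈-cartesianProduct⁻ (trianglesOf ▽) (trianglesOf △) l∈′))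
    ...   | () , _
    lozenge⁻ {▽ , _} {▽ , _} l∈ with ∈-filter⁻ (λ (s , t) → sharesEdge? s t)
      {xs = cartesianProduct (trianglesOf ▽) (trianglesOf △)} l∈
    ... | l∈′ , _ with ∈-trianglesOf⁻ (proj₂ (∈-cartesianProduct⁻ (trianglesOf ▽) (trianglesOf △) l∈′))
    ...   | () , _

    -- The rotation and the two halves of the hexagon

    reflect : ∀ {p} → p < M → suc (p + (M ∸ suc p)) ≡ M
    reflect = ℕₚ.m+[n∸m]≡n

    reflect-< : ∀ {p} → p < M → M ∸ suc p < M
    reflect-< {p} p< = subst (M ∸ suc p <_) (reflect p<) (s≤s (ℕₚ.m≤n+m (M ∸ suc p) p))

    reflect-involutive : ∀ {p} → p < M → M ∸ suc (M ∸ suc p) ≡ p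
    reflect-involutive {p} p< = trans (cong (_∸ suc (M ∸ suc p)) (trans (sym (reflect p<)) (cong suc (ℕₚ.+-comm p _))))
      (ℕₚ.m+n∸m≡n (suc (M ∸ suc p)) p)

    rotateTriangle-involutive : ∀ {t} → Inside t → rotateTriangle (rotateTriangle t) ≡ t
    rotateTriangle-involutive {△ , p , q} (inside p< q< _ _) =
      cong₂ (λ x y → △ , x , y) (reflect-involutive p<) (reflect-involutive q<)
    rotateTriangle-involutive {▽ , p , q} (inside p< q< _ _) =
      cong₂ (λ x y → ▽ , x , y) (reflect-involutive p<) (reflect-involutive q<)

    -- Strip `h` goes to strip `2a - 1 - h`. Hence the triangles of level below `M`, the lower half,
    -- are exchanged with the others.
    level-rotate : ∀ {t} → Inside t → level t + suc (level (rotateTriangle t)) ≡ M + M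
    level-rotate {△ , p , q} (inside p< q< _ _) = trans (arrange p q _ _) (cong₂ _+_ (reflect p<) (reflect q<))
      where
      arrange : ∀ p q p′ q′ → p + q + suc (suc (p′ + q′)) ≡ suc (p + p′) + suc (q + q′)
      arrange = solveℕ
    level-rotate {▽ , p , q} (inside p< q< _ _) = trans (arrange p q _ _) (cong₂ _+_ (reflect p<) (reflect q<))
      where
      arrange : ∀ p q p′ q′ → suc (p + q) + suc (p′ + q′) ≡ suc (p + p′) + suc (q + q′)
      arrange = solveℕ

    M+M : M + M ≡ c + (a + a + c)
    M+M = arrange a c
      where
      arrange : ∀ a c → a + c + (a + c) ≡ c + (a + a + c)
      arrange = solveℕ

    level-rotate′ : ∀ {t} → Inside t → suc (level t) + level (rotateTriangle t) ≡ M + M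
    level-rotate′ {t} ins = trans (sym (ℕₚ.+-suc (level t) (level (rotateTriangle t)))) (level-rotate {t} ins)

    inside-rotate : ∀ {t} → Inside t → Inside (rotateTriangle t)
    inside-rotate {t} ins@(inside p< q< c≤ l<) = inside (reflect-< p<) (reflect-< q<)
      (complement-≥ (a + a + c) c (trans (level-rotate′ ins) (trans M+M (ℕₚ.+-comm c (a + a + c)))) l<)
      (complement-≤ c (a + a + c) (trans (level-rotate ins) M+M) c≤)

    rotate-lower : ∀ {t} → Inside t → M ≤ level t → level (rotateTriangle t) < M
    rotate-lower {t} ins M≤ = complement-≤ M M (level-rotate {t} ins) M≤

    rotate-upper : ∀ {t} → Inside t → level t < M → M ≤ level (rotateTriangle t)
    rotate-upper {t} ins <M = complement-≥ M M (level-rotate′ {t} ins) <M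

    rotate-shape : ∀ {s t} → Shape (s , t) → Inside t → Shape (rotate (s , t))
    rotate-shape (vertical p q) _ = vertical _ _
    rotate-shape (eastern p q) (inside p< _ _ _) =
      subst (λ x → Shape ((▽ , M ∸ suc (suc p) , M ∸ suc q) , (△ , x , M ∸ suc q))) (sym (∸-suc p<)) (eastern _ _)
    rotate-shape (northern p q) (inside _ q< _ _) =
      subst (λ x → Shape ((▽ , M ∸ suc p , M ∸ suc (suc q)) , (△ , M ∸ suc p , x))) (sym (∸-suc q<)) (northern _ _)

    rotate-∈ : ∀ {l} → l ∈ allLozenges → rotate l ∈ allLozenges
    rotate-∈ {s , t} l∈ with lozenge⁻ l∈
    ... | sh , si , ti = lozenge⁺ (rotate-shape sh ti) (inside-rotate ti) (inside-rotate si)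

    rotate-involutive : ∀ {l} → l ∈ allLozenges → rotate (rotate l) ≡ l
    rotate-involutive {s , t} l∈ with lozenge⁻ l∈
    ... | _ , si , ti = cong₂ _,_ (rotateTriangle-involutive si) (rotateTriangle-involutive ti)

    strip-number : ∀ {l} → c ≤ l → l < M → ∃ λ h → l ≡ h + c × h < a
    strip-number {l} c≤ l< = l ∸ c , sym (ℕₚ.m∸n+n≡m c≤) ,
      ℕₚ.+-cancelʳ-< c (l ∸ c) a (subst (_< a + c) (sym (ℕₚ.m∸n+n≡m c≤)) l<)

    strip-inside : ∀ {h} t → level t ≡ h + c → h < a → Inside t
    strip-inside {h} (△ , p , q) eq h<a = inside
      (ℕₚ.≤-<-trans (ℕₚ.m≤m+n p q) l<) (ℕₚ.≤-<-trans (ℕₚ.m≤n+m q p) l<)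
      (ℕₚ.≤-trans (ℕₚ.m≤n+m c h) (ℕₚ.≤-reflexive (sym eq)))
      (ℕₚ.<-≤-trans l< (ℕₚ.+-monoˡ-≤ c (ℕₚ.m≤m+n a a)))
      where
      l< : p + q < M
      l< = subst (_< M) (sym eq) (ℕₚ.+-monoˡ-< c h<a)
    strip-inside {h} (▽ , p , q) eq h<a = inside
      (ℕₚ.≤-<-trans (ℕₚ.m≤n⇒m≤1+n (ℕₚ.m≤m+n p q)) l<) (ℕₚ.≤-<-trans (ℕₚ.m≤n⇒m≤1+n (ℕₚ.m≤n+m q p)) l<)
      (ℕₚ.≤-trans (ℕₚ.m≤n+m c h) (ℕₚ.≤-reflexive (sym eq)))
      (ℕₚ.<-≤-trans l< (ℕₚ.+-monoˡ-≤ c (ℕₚ.m≤m+n a a)))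
      where
      l< : suc (p + q) < M
      l< = subst (_< M) (sym eq) (ℕₚ.+-monoˡ-< c h<a)

    reflected : ∀ i j → suc (i + j) ≡ M → M ∸ suc i ≡ j
    reflected i j eq = trans (cong (_∸ suc i) (sym eq)) (ℕₚ.m+n∸m≡n i j)

    -- On the line through the center the rotation reverses the order of the crossing lozenges; this
    -- makes the top row a palindrome.
    rotate-middle : ∀ i j → suc (i + j) ≡ M →
      rotate ((▽ , i , j) , (△ , i , j)) ≡ ((▽ , j , i) , (△ , j , i))
    rotate-middle i j eq = cong₂ (λ x y → (▽ , x , y) , (△ , x , y)) (reflected i j eq)
      (reflected j i (trans (cong suc (ℕₚ.+-comm j i)) eq))

    module Covering {T : List Lozenge} (T∈ : T ∈ sublists allLozenges) where

      m : Lozenge → Bool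
      m l = does (l ∈ₗ? T)

      m-true : ∀ {l} → l ∈ T → m l ≡ true
      m-true {l} = dec-true (l ∈ₗ? T)

      m-false : ∀ {l} → l ∉ T → m l ≡ false
      m-false {l} = dec-false (l ∈ₗ? T)

      m-true⁻ : ∀ {l} → m l ≡ true → l ∈ T
      m-true⁻ {l} eq with l ∈ₗ? T
      ... | yes l∈ = l∈
      m-true⁻ {l} () | no _

      T⊆ : ∀ {l} → l ∈ T → l ∈ allLozenges
      T⊆ = ∈-sublists⇒⊆ allLozenges T∈

      T-shape : ∀ {l} → l ∈ T → Shape l
      T-shape {s , t} l∈ = proj₁ (lozenge⁻ (T⊆ l∈))

      T-unique : Unique T
      T-unique = ∈-sublists-unique allLozenges-unique T∈

      count : Triangle → ℕ
      count t = length (covering t T)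

      covering-unique : ∀ t → Unique (covering t T)
      covering-unique t = Uniqueₚ.filter⁺ (λ l → t ∈ₜ? triangles l) T-unique

      covering⁻ : ∀ {t l} → l ∈ covering t T → l ∈ T × t ∈ triangles l
      covering⁻ {t} = ∈-filter⁻ (λ l → t ∈ₜ? triangles l) {xs = T}

      covering⁺ : ∀ {t l} → l ∈ T → t ∈ triangles l → l ∈ covering t T
      covering⁺ {t} = ∈-filter⁺ (λ l → t ∈ₜ? triangles l)

      -- Turns the number of lozenges of `T` covering `t` into a sum of at most three bits, the form
      -- in which `Strip` states the covering conditions.
      count-neighbours : ∀ t {ns} → Unique ns → All (λ l → t ∈ triangles l) ns →
        (∀ {l} → Shape l → t ∈ triangles l → l ∈ ns) → count t ≡ length (filter (_∈ₗ? T) ns)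
      count-neighbours t {ns} uniq all complete =
        bijection-length id (covering-unique t) (Uniqueₚ.filter⁺ (_∈ₗ? T) uniq)
          (λ l∈ → let l∈T , t∈ = covering⁻ l∈ in ∈-filter⁺ (_∈ₗ? T) (complete (T-shape l∈T) t∈) l∈T)
          (λ _ _ eq → eq)
          (λ l∈ → let l∈ns , l∈T = ∈-filter⁻ (_∈ₗ? T) {xs = ns} l∈ in
            _ , covering⁺ l∈T (All.lookup all l∈ns) , refl)

      east : ℕ → ℕ → Bool
      -- There is no ▽ to the left of a △ at `p = 0`; the value false also provides the initial flag
      -- of `preds` in each strip.
      east zero    q = false
      east (suc p) q = m ((▽ , p , q) , (△ , suc p , q))

      north : ℕ → ℕ → Bool
      north p zero    = false
      north p (suc q) = m ((▽ , p , q) , (△ , p , suc q))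

      vert : ℕ → ℕ → Bool
      vert p q = m ((▽ , p , q) , (△ , p , q))

      count-▽ : ∀ p q → count (▽ , p , q) ≡ bit (north p (suc q)) + bit (east (suc p) q) + bit (vert p q)
      count-▽ p q = trans
        (count-neighbours (▽ , p , q)
          {((▽ , p , q) , (△ , p , suc q)) ∷ ((▽ , p , q) , (△ , suc p , q)) ∷ ((▽ , p , q) , (△ , p , q)) ∷ []}
          (((λ ()) ∷ (λ ()) ∷ []) ∷ ((λ ()) ∷ []) ∷ [] ∷ [])
          (here refl ∷ here refl ∷ here refl ∷ [])
          complete)
        (trans (length-filter-∷ (_∈ₗ? T) _ _) (trans (cong (bit (north p (suc q)) +_)
          (trans (length-filter-∷ (_∈ₗ? T) _ _) (cong (bit (east (suc p) q) +_)
            (trans (length-filter-∷ (_∈ₗ? T) _ _) (ℕₚ.+-identityʳ _)))))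
          (sym (ℕₚ.+-assoc (bit (north p (suc q))) _ _))))
        where
        complete : ∀ {l} → Shape l → (▽ , p , q) ∈ triangles l →
          l ∈ ((▽ , p , q) , (△ , p , suc q)) ∷ ((▽ , p , q) , (△ , suc p , q)) ∷ ((▽ , p , q) , (△ , p , q)) ∷ []
        complete (vertical _ _) (here refl) = there (there (here refl))
        complete (eastern _ _)  (here refl) = there (here refl)
        complete (northern _ _) (here refl) = here refl
        complete (vertical _ _) (there (here ()))
        complete (eastern _ _)  (there (here ()))
        complete (northern _ _) (there (here ()))

      count-△ : ∀ p q → count (△ , p , q) ≡ bit (east p q) + bit (north p q) + bit (vert p q)
      count-△ zero zero = trans
        (count-neighbours (△ , 0 , 0) {((▽ , 0 , 0) , (△ , 0 , 0)) ∷ []} ([] ∷ []) (there (here refl) ∷ []) complete)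
        (trans (length-filter-∷ (_∈ₗ? T) _ _) (ℕₚ.+-identityʳ _))
        where
        complete : ∀ {l} → Shape l → (△ , 0 , 0) ∈ triangles l → l ∈ ((▽ , 0 , 0) , (△ , 0 , 0)) ∷ []
        complete (vertical _ _) (here ())
        complete (eastern _ _)  (here ())
        complete (northern _ _) (here ())
        complete (vertical _ _) (there (here refl)) = here refl
        complete (eastern _ _)  (there (here ()))
        complete (northern _ _) (there (here ()))
      count-△ zero (suc q) = trans
        (count-neighbours (△ , 0 , suc q)
          {((▽ , 0 , q) , (△ , 0 , suc q)) ∷ ((▽ , 0 , suc q) , (△ , 0 , suc q)) ∷ []}
          (((λ ()) ∷ []) ∷ [] ∷ []) (there (here refl) ∷ there (here refl) ∷ []) complete)
        (trans (length-filter-∷ (_∈ₗ? T) _ _) (cong (bit (north 0 (suc q)) +_)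
          (trans (length-filter-∷ (_∈ₗ? T) _ _) (ℕₚ.+-identityʳ _))))
        where
        complete : ∀ {l} → Shape l → (△ , 0 , suc q) ∈ triangles l →
          l ∈ ((▽ , 0 , q) , (△ , 0 , suc q)) ∷ ((▽ , 0 , suc q) , (△ , 0 , suc q)) ∷ []
        complete (vertical _ _) (here ())
        complete (eastern _ _)  (here ())
        complete (northern _ _) (here ())
        complete (vertical _ _) (there (here refl)) = there (here refl)
        complete (eastern _ _)  (there (here ()))
        complete (northern _ _) (there (here refl)) = here refl
      count-△ (suc p) zero = trans
        (count-neighbours (△ , suc p , 0)
          {((▽ , p , 0) , (△ , suc p , 0)) ∷ ((▽ , suc p , 0) , (△ , suc p , 0)) ∷ []}
          (((λ ()) ∷ []) ∷ [] ∷ []) (there (here refl) ∷ there (here refl) ∷ []) complete)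
        (trans (length-filter-∷ (_∈ₗ? T) _ _) (trans (cong (bit (east (suc p) 0) +_)
          (trans (length-filter-∷ (_∈ₗ? T) _ _) (ℕₚ.+-identityʳ _)))
          (cong (_+ bit (vert (suc p) 0)) (sym (ℕₚ.+-identityʳ (bit (east (suc p) 0)))))))
        where
        complete : ∀ {l} → Shape l → (△ , suc p , 0) ∈ triangles l →
          l ∈ ((▽ , p , 0) , (△ , suc p , 0)) ∷ ((▽ , suc p , 0) , (△ , suc p , 0)) ∷ []
        complete (vertical _ _) (here ())
        complete (eastern _ _)  (here ())
        complete (northern _ _) (here ())
        complete (vertical _ _) (there (here refl)) = there (here refl)
        complete (eastern _ _)  (there (here refl)) = here refl
        complete (northern _ _) (there (here ()))
      count-△ (suc p) (suc q) = trans
        (count-neighbours (△ , suc p , suc q)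
          {((▽ , p , suc q) , (△ , suc p , suc q)) ∷ ((▽ , suc p , q) , (△ , suc p , suc q)) ∷
           ((▽ , suc p , suc q) , (△ , suc p , suc q)) ∷ []}
          (((λ ()) ∷ (λ ()) ∷ []) ∷ ((λ ()) ∷ []) ∷ [] ∷ [])
          (there (here refl) ∷ there (here refl) ∷ there (here refl) ∷ [])
          complete)
        (trans (length-filter-∷ (_∈ₗ? T) _ _) (trans (cong (bit (east (suc p) (suc q)) +_)
          (trans (length-filter-∷ (_∈ₗ? T) _ _) (cong (bit (north (suc p) (suc q)) +_)
            (trans (length-filter-∷ (_∈ₗ? T) _ _) (ℕₚ.+-identityʳ _)))))
          (sym (ℕₚ.+-assoc (bit (east (suc p) (suc q))) _ _))))
        where
        complete : ∀ {l} → Shape l → (△ , suc p , suc q) ∈ triangles l →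
          l ∈ ((▽ , p , suc q) , (△ , suc p , suc q)) ∷ ((▽ , suc p , q) , (△ , suc p , suc q)) ∷
           ((▽ , suc p , suc q) , (△ , suc p , suc q)) ∷ []
        complete (vertical _ _) (here ())
        complete (eastern _ _)  (here ())
        complete (northern _ _) (here ())
        complete (vertical _ _) (there (here refl)) = there (there (here refl))
        complete (eastern _ _)  (there (here refl)) = here refl
        complete (northern _ _) (there (here refl)) = there (here refl)

      -- Coordinates along the strips: `V h i` is the lozenge across the `i`-th edge of the line
      -- `p + q = h + c`, while `X h i` and `Y h i` cover the △ at `(i , h + c - i)` with the ▽ on
      -- its right and on its left.
      V X Y : ℕ → ℕ → Bool
      V h i = vert i (h + c ∸ suc i)
      X h i = north i (suc (h + c ∸ suc i))
      Y h i = east i (h + c ∸ i)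

      bottom-row : ∀ {i} → i < c → V 0 i ≡ false
      bottom-row {i} i<c = m-false λ l∈ → let _ , _ , inside _ _ c≤ _ = lozenge⁻ (T⊆ l∈) in
        ℕₚ.<-irrefl refl (subst (_≤ i + (c ∸ suc i)) (sym (ℕₚ.m+[n∸m]≡n i<c)) c≤)

      tiling-strip : IsTiling T → ∀ {h} → h < a → Strip (h + c) (V h) (V (suc h)) (X h) (Y h)
      tiling-strip tiling {h} h<a = record { up = up′ ; down = down′ ; end = end′ }
        where
        n = h + c
        covered : ∀ t → level t ≡ n → count t ≡ 1
        covered t eq = All.lookup tiling (inside⇒∈ (strip-inside t eq h<a))
        up′ : ∀ {i} → i < n → bit (Y h i) + bit (X h i) + bit (V (suc h) i) ≡ 1
        up′ {i} i<n = trans (cong (λ q → bit (Y h i) + bit (north i q) + bit (V (suc h) i)) (sym (∸-suc i<n)))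
          (trans (sym (count-△ i (n ∸ i))) (covered (△ , i , n ∸ i) (ℕₚ.m+[n∸m]≡n (ℕₚ.<⇒≤ i<n))))
        down′ : ∀ {i} → i < n → bit (X h i) + bit (Y h (suc i)) + bit (V h i) ≡ 1
        down′ {i} i<n = trans (sym (count-▽ i (n ∸ suc i))) (covered (▽ , i , n ∸ suc i) (ℕₚ.m+[n∸m]≡n i<n))
        end′ : bit (Y h n) + bit (V (suc h) n) ≡ 1
        end′ = trans (cong (_+ bit (V (suc h) n)) (trans (sym (ℕₚ.+-identityʳ _)) (cong (λ q → bit (Y h n) + bit (north n q)) (sym (ℕₚ.n∸n≡0 n)))))
          (trans (sym (count-△ n (n ∸ n))) (covered (△ , n , n ∸ n) (ℕₚ.m+[n∸m]≡n (ℕₚ.≤-refl {n}))))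

      module _ (invariant : IsInvariant T) where

        rotate-T : ∀ {l} → l ∈ T → rotate l ∈ T
        rotate-T l∈ = All.lookup (proj₁ invariant) (∈-map⁺ rotate l∈)

        m-rotate : ∀ {l} → l ∈ allLozenges → m l ≡ m (rotate l)
        m-rotate {l} l∈ with l ∈ₗ? T
        ... | yes l∈T = sym (m-true (rotate-T l∈T))
        ... | no  l∉T = sym (m-false λ r∈ → l∉T (subst (_∈ T) (rotate-involutive l∈) (rotate-T r∈)))

        middle-row : ∀ {i j} → suc (i + j) ≡ M → V a i ≡ V a j
        middle-row {i} {j} eq = trans (cong (vert i) (reflected i j eq)) (trans flipped (cong (vert j) (sym (reflected j i (trans (cong suc (ℕₚ.+-comm j i)) eq)))))
          where
          flipped : vert i j ≡ vert j i
          flipped with ((▽ , i , j) , (△ , i , j)) ∈ₗ? T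
          ... | yes l∈ = sym (m-true (subst (_∈ T) (rotate-middle i j eq) (rotate-T l∈)))
          ... | no  l∉ = sym (m-false λ l∈ → l∉ (subst (_∈ T) (rotate-middle j i (trans (cong suc (ℕₚ.+-comm j i)) eq)) (rotate-T l∈)))

        -- Carries the covering condition from the lower half to the upper half.
        count-rotate : ∀ {t} → Inside t → count t ≡ count (rotateTriangle t)
        count-rotate {t} ins = bijection-length rotate (covering-unique t) (covering-unique (rotateTriangle t))
          (λ l∈ → let l∈T , t∈ = covering⁻ l∈ in covering⁺ (rotate-T l∈T) (turn t∈))
          (λ {l} {l′} l∈ l′∈ eq → trans (sym (rotate-involutive (T⊆ (proj₁ (covering⁻ {t} l∈)))))
            (trans (cong rotate eq) (rotate-involutive (T⊆ (proj₁ (covering⁻ {t} l′∈))))))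
          (λ {l} l∈ → let l∈T , t∈ = covering⁻ l∈ in rotate l ,
            covering⁺ (rotate-T l∈T) (subst (_∈ triangles (rotate l)) (rotateTriangle-involutive ins) (turn t∈)) ,
            rotate-involutive (T⊆ l∈T))
          where
          turn : ∀ {t l} → t ∈ triangles l → rotateTriangle t ∈ triangles (rotate l)
          turn (here refl)         = there (here refl)
          turn (there (here refl)) = here refl

  -- Invariant tilings and rows

  module _ (a c : ℕ) where

    open Hexagon a a c

    private
      m : ℕ
      m = M a c

    strip-index : ∀ {x h} → x ≡ h + c → x ∸ c ≡ h
    strip-index {h = h} refl = ℕₚ.m+n∸n≡m h c

    module Fill (V : ℕ → ℕ → Bool) where

      Y X : ℕ → ℕ → Bool
      Y h = flow false (V h) (V (suc h))
      X h = crossing false (V h) (V (suc h))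

      -- Comparing coordinates reveals the kind of lozenge, and `p′ + q′ ∸ c` is the strip of its △.
      -- A vertical lozenge crosses the upper border of that strip, hence the index one higher in
      -- `V`.
      fillLower : Lozenge → Bool
      fillLower ((_ , p , q) , (_ , p′ , q′)) =
        if does (p′ ≟ suc p) then Y (p′ + q′ ∸ c) (suc p) else
        if does (q′ ≟ suc q) then X (p′ + q′ ∸ c) p else V (suc (p′ + q′ ∸ c)) p

      -- The side is decided by the △, so that lozenges across the center line count as lower and
      -- are read directly from the top row.
      fill : Lozenge → Bool
      fill (s , t) = if does (level t <? m) then fillLower (s , t) else fillLower (rotate (s , t))

      fill-lower : ∀ {s t} → level t < m → fill (s , t) ≡ fillLower (s , t)
      fill-lower {s} {t} < rewrite dec-true (level t <? m) < = refl

      fill-upper : ∀ {s t} → m ≤ level t → fill (s , t) ≡ fillLower (rotate (s , t))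
      fill-upper {s} {t} ≥ rewrite dec-false (level t <? m) (ℕₚ.≤⇒≯ ≥) = refl

      fillLower-vertical : ∀ {h} p q → p + q ≡ h + c → fillLower ((▽ , p , q) , (△ , p , q)) ≡ V (suc h) p
      fillLower-vertical {h} p q eq
        rewrite dec-false (p ≟ suc p) (λ ()) | dec-false (q ≟ suc q) (λ ()) =
        cong (λ k → V (suc k) p) (strip-index {h = h} eq)

      fillLower-eastern : ∀ {h} p q → suc p + q ≡ h + c → fillLower ((▽ , p , q) , (△ , suc p , q)) ≡ Y h (suc p)
      fillLower-eastern {h} p q eq rewrite dec-true (suc p ≟ suc p) refl =
        cong (λ k → Y k (suc p)) (strip-index {h = h} eq)

      fillLower-northern : ∀ {h} p q → p + suc q ≡ h + c → fillLower ((▽ , p , q) , (△ , p , suc q)) ≡ X h p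
      fillLower-northern {h} p q eq
        rewrite dec-false (p ≟ suc p) (λ ()) | dec-true (suc q ≟ suc q) refl =
        cong (λ k → X k p) (strip-index {h = h} eq)

      tiling : List Lozenge
      tiling = filter (λ l → fill l Bool.≟ true) allLozenges

      tiling∈ : tiling ∈ sublists allLozenges
      tiling∈ = filter-∈-sublists (λ l → fill l Bool.≟ true) allLozenges

      module C = Covering a c tiling∈

      m≡fill : ∀ {l} → l ∈ allLozenges → C.m l ≡ fill l
      m≡fill {l} l∈ = go (fill l) refl
        where
        go : ∀ b → fill l ≡ b → C.m l ≡ b
        go true  eq = C.m-true (∈-filter⁺ (λ l → fill l Bool.≟ true) l∈ eq)
        go false eq = C.m-false λ l∈T →
          contradiction (trans (sym (proj₂ (∈-filter⁻ (λ l → fill l Bool.≟ true) {xs = allLozenges} l∈T))) eq) λ ()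

      module _ (il : Interlaced c V a) (mirror : ∀ {i j} → suc (i + j) ≡ a + c → V a i ≡ V a j) where

        strip : ∀ {h} → h < a → Strip (h + c) (V h) (V (suc h)) (X h) (Y h)
        strip {h} h<a = preds⇒strip (h + c) false (preds∈ il h<a)

        m-northern : ∀ {h} p q → suc (p + q) ≡ h + c → h < a → C.north p (suc q) ≡ X h p
        m-northern {h} p q eq h<a = trans
          (m≡fill (lozenge⁺ a c (northern p q) (strip-inside a c (▽ , p , q) eq h<a) (strip-inside a c (△ , p , suc q) eq′ h<a)))
          (trans (fill-lower {▽ , p , q} {△ , p , suc q} (subst (_< m) (sym eq′) (ℕₚ.+-monoˡ-< c h<a)))
            (fillLower-northern p q eq′))
          where
          eq′ : p + suc q ≡ h + c
          eq′ = trans (ℕₚ.+-suc p q) eq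

        m-eastern : ∀ {h} p q → suc (p + q) ≡ h + c → h < a → C.east (suc p) q ≡ Y h (suc p)
        m-eastern {h} p q eq h<a = trans
          (m≡fill (lozenge⁺ a c (eastern p q) (strip-inside a c (▽ , p , q) eq h<a) (strip-inside a c (△ , suc p , q) eq h<a)))
          (trans (fill-lower {▽ , p , q} {△ , suc p , q} (subst (_< m) (sym eq) (ℕₚ.+-monoˡ-< c h<a)))
            (fillLower-eastern p q eq))

        m-vertical : ∀ {h} p q → p + q ≡ h + c → h < a → C.vert p q ≡ V (suc h) p
        m-vertical {h} p q eq h<a with strip-inside a c (△ , p , q) eq h<a
        ... | ins@(inside p< q< c≤ _) = trans
          (m≡fill (lozenge⁺ a c (vertical p q) (inside p< q< (ℕₚ.m≤n⇒m≤1+n c≤) (ℕₚ.≤-<-trans l< m<)) ins))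
          (trans (fill-lower {▽ , p , q} {△ , p , q} l<) (fillLower-vertical p q eq))
          where
          l< : p + q < m
          l< = subst (_< m) (sym eq) (ℕₚ.+-monoˡ-< c h<a)
          -- The ▽ may lie just above the center line; that strip belongs to the hexagon because
          -- `h < a` makes `a` positive.
          m< : m < a + a + c
          m< = ℕₚ.+-monoˡ-< c (ℕₚ.m<m+n a (ℕₚ.≤-<-trans z≤n h<a))

        m-bottom : ∀ p q → suc (p + q) ≡ c → C.vert p q ≡ false
        m-bottom p q eq = C.m-false λ l∈ → let _ , _ , inside _ _ c≤ _ = lozenge⁻ a c (C.T⊆ l∈) in
          ℕₚ.<-irrefl refl (subst (_≤ p + q) (sym eq) c≤)

        m-below : ∀ {h} p q → suc (p + q) ≡ h + c → h < a → C.vert p q ≡ V h p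
        m-below {zero}  p q eq h<a = trans (m-bottom p q eq)
          (sym (bottom il (subst (p <_) eq (s≤s (ℕₚ.m≤m+n p q)))))
        m-below {suc h} p q eq h<a = m-vertical p q (ℕₚ.suc-injective eq) (ℕₚ.<-trans (ℕₚ.n<1+n h) h<a)

        m-left : ∀ {h} p q → p + q ≡ h + c → h < a → C.east p q ≡ Y h p
        m-left zero    q eq h<a = refl
        m-left (suc p) q eq h<a = m-eastern p q eq h<a

        count-lower : ∀ {t} → Inside a c t → level t < m → C.count t ≡ 1
        count-lower {▽ , p , q} (inside _ _ c≤ _) l< with strip-number a c c≤ l<
        ... | h , eq , h<a = trans (C.count-▽ p q) (trans
          (cong₂ _+_ (cong₂ (λ x y → bit x + bit y) (m-northern p q eq h<a) (m-eastern p q eq h<a))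
            (cong bit (m-below p q eq h<a)))
          (down (strip h<a) (subst (p <_) eq (s≤s (ℕₚ.m≤m+n p q)))))
        count-lower {△ , p , suc q} (inside _ _ c≤ _) l< with strip-number a c c≤ l<
        ... | h , eq , h<a = trans (C.count-△ p (suc q)) (trans
          (cong₂ _+_ (cong₂ (λ x y → bit x + bit y) (m-left p (suc q) eq h<a)
              (m-northern p q (trans (sym (ℕₚ.+-suc p q)) eq) h<a))
            (cong bit (m-vertical p (suc q) eq h<a)))
          (up (strip h<a) (subst (p <_) (trans (sym (ℕₚ.+-suc p q)) eq) (s≤s (ℕₚ.m≤m+n p q)))))
        count-lower {△ , p , zero} (inside _ _ c≤ _) l< with strip-number a c c≤ l<
        ... | h , eq , h<a with refl ← trans (sym (ℕₚ.+-identityʳ p)) eq = trans (C.count-△ (h + c) 0) (trans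
          (cong₂ _+_ (trans (ℕₚ.+-identityʳ _) (cong bit (m-left (h + c) 0 eq h<a)))
            (cong bit (m-vertical (h + c) 0 eq h<a)))
          (end (strip h<a)))

        fill-middle : ∀ p q → c ≤ p + q → suc (p + q) ≡ m → fill ((▽ , p , q) , (△ , p , q)) ≡ V a p
        fill-middle p q c≤ eq with strip-number a c {p + q} c≤ (ℕₚ.≤-reflexive eq)
        ... | h , level≡ , h<a = trans (fill-lower {▽ , p , q} {△ , p , q} (ℕₚ.≤-reflexive eq))
          (trans (fillLower-vertical p q level≡)
            (cong (λ k → V k p) (ℕₚ.+-cancelʳ-≡ c (suc h) a (trans (cong suc (sym level≡)) eq))))

        -- Off the center line, exactly one of `l` and its rotation is lower and the claim is the
        -- definition of `fill`. Lozenges across the center line stay lower, and there the claim is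
        -- that the top row is a palindrome.
        fill-rotate : ∀ {l} → l ∈ allLozenges → fill l ≡ fill (rotate l)
        fill-rotate {s , t} l∈ with lozenge⁻ a c l∈ | level t <? m | level s <? m
        ... | sh , si , ti | no t≥ | _ = trans (fill-upper {s} {t} (ℕₚ.≮⇒≥ t≥))
          (sym (fill-lower {rotateTriangle t} {rotateTriangle s}
            (rotate-lower a c si (ℕₚ.≤-trans (ℕₚ.≮⇒≥ t≥) (level-≤ sh)))))
        ... | sh , si , ti | yes t< | yes s< = trans (fill-lower {s} {t} t<)
          (sym (trans (fill-upper {rotateTriangle t} {rotateTriangle s} (rotate-upper a c si s<))
            (cong fillLower (rotate-involutive a c l∈))))
        ... | eastern p q  , si , ti | yes t< | no s≥ = contradiction t< s≥
        ... | northern p q , si , ti | yes t< | no s≥ = contradiction (subst (_< m) (ℕₚ.+-suc p q) t<) s≥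
        ... | vertical p q , si , inside p< q< c≤ _ | yes t< | no s≥ = trans (fill-middle p q c≤ eq)
          (trans (mirror eq) (sym (trans (cong fill (rotate-middle a c p q eq))
            (fill-middle q p (subst (c ≤_) (ℕₚ.+-comm p q) c≤) (trans (cong suc (ℕₚ.+-comm q p)) eq)))))
          where
          eq : suc (p + q) ≡ m
          eq = ℕₚ.≤-antisym t< (ℕₚ.≮⇒≥ s≥)

        tiling-rotate : ∀ {l} → l ∈ tiling → rotate l ∈ tiling
        tiling-rotate l∈ with ∈-filter⁻ (λ l → fill l Bool.≟ true) {xs = allLozenges} l∈
        ... | l∈all , filled = ∈-filter⁺ (λ l → fill l Bool.≟ true) (rotate-∈ a c l∈all)
          (trans (sym (fill-rotate l∈all)) filled)

        tiling-invariant : IsInvariant tiling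
        tiling-invariant = Allₚ.map⁺ (All.tabulate tiling-rotate) , All.tabulate λ l∈ →
          subst (_∈ map rotate tiling) (rotate-involutive a c (C.T⊆ l∈)) (∈-map⁺ rotate (tiling-rotate l∈))

        tiling-covers : IsTiling tiling
        tiling-covers = All.tabulate λ {t} t∈ → covers (∈⇒inside a c t∈)
          where
          covers : ∀ {t} → Inside a c t → C.count t ≡ 1
          covers {t} ins with level t <? m
          ... | yes l< = count-lower ins l<
          ... | no l≮  = trans (C.count-rotate tiling-invariant ins)
            (count-lower (inside-rotate a c ins) (rotate-lower a c ins (ℕₚ.≮⇒≥ l≮)))

        tiling-rows : ∀ {h i} → h < suc a → i < h + c → C.V h i ≡ V h i
        tiling-rows {zero}  {i} _         i< = trans (C.bottom-row i<) (sym (bottom il i<))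
        tiling-rows {suc h} {i} (s≤s h<a) (s≤s i≤) = m-vertical i (h + c ∸ i) (ℕₚ.m+[n∸m]≡n i≤) h<a

    module Recover {T T′ : List Lozenge} (T∈ : T ∈ sublists allLozenges) (T′∈ : T′ ∈ sublists allLozenges)
      (covers : IsTiling T) (covers′ : IsTiling T′) (inv : IsInvariant T) (inv′ : IsInvariant T′) where

      module C  = Covering a c T∈
      module C′ = Covering a c T′∈

      module _ (same : ∀ {h i} → h < suc a → i < h + c → C.V h i ≡ C′.V h i) where

        -- Both tilings start each strip without a lozenge entering from the left, so equal marks on
        -- the two borders force equal interiors.
        same-strip : ∀ {h} → h < a → ∀ {i} → i < h + c → C.X h i ≡ C′.X h i × C.Y h (suc i) ≡ C′.Y h (suc i)
        same-strip {h} h<a = strip-determined (C.tiling-strip covers h<a) (C′.tiling-strip covers′ h<a) refl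
          (same (ℕₚ.m≤n⇒m≤1+n h<a)) (λ i< → same (s≤s h<a) (ℕₚ.m≤n⇒m≤1+n i<))

        same-lower : ∀ {s t} → Shape (s , t) → Inside a c t → level t < m → C.m (s , t) ≡ C′.m (s , t)
        same-lower (vertical p q) (inside _ _ c≤ _) l< with strip-number a c c≤ l<
        ... | h , eq , h<a = subst (λ x → C.vert p x ≡ C′.vert p x)
          (trans (cong (_∸ p) (sym eq)) (ℕₚ.m+n∸m≡n p q))
          (same (s≤s h<a) (s≤s (subst (p ≤_) eq (ℕₚ.m≤m+n p q))))
        same-lower (eastern p q) (inside _ _ c≤ _) l< with strip-number a c c≤ l<
        ... | h , eq , h<a = subst (λ x → C.east (suc p) x ≡ C′.east (suc p) x)
          (trans (cong (_∸ suc p) (sym eq)) (ℕₚ.m+n∸m≡n p q))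
          (proj₂ (same-strip h<a (subst (p <_) eq (s≤s (ℕₚ.m≤m+n p q)))))
        same-lower (northern p q) (inside _ _ c≤ _) l< with strip-number a c c≤ l<
        ... | h , eq , h<a = subst (λ x → C.north p (suc x) ≡ C′.north p (suc x))
          (trans (cong (_∸ suc p) (sym eq′)) (ℕₚ.m+n∸m≡n p q))
          (proj₁ (same-strip h<a (subst (p <_) eq′ (s≤s (ℕₚ.m≤m+n p q)))))
          where
          eq′ : suc (p + q) ≡ h + c
          eq′ = trans (sym (ℕₚ.+-suc p q)) eq

        -- A lozenge whose △ is in the upper half is rotated into the lower half first; invariance
        -- preserves its membership in both tilings.
        same-m : ∀ {l} → l ∈ allLozenges → C.m l ≡ C′.m l
        same-m {s , t} l∈ with lozenge⁻ a c l∈ | level t <? m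
        ... | sh , si , ti | yes t< = same-lower sh ti t<
        ... | sh , si , ti | no t≮ = trans (C.m-rotate inv l∈) (trans
          (same-lower (rotate-shape a c sh ti) (inside-rotate a c si)
            (rotate-lower a c si (ℕₚ.≤-trans (ℕₚ.≮⇒≥ t≮) (level-≤ sh))))
          (sym (C′.m-rotate inv′ l∈)))

        same-tiling : T ≡ T′
        same-tiling = sublists-extensional (allLozenges-unique a c) T∈ T′∈
          (λ l∈ → C′.m-true⁻ (trans (sym (same-m (C.T⊆ l∈))) (C.m-true l∈)))
          (λ l∈ → C.m-true⁻ (trans (same-m (C′.T⊆ l∈)) (C′.m-true l∈)))

    verticals : List Lozenge → ℕ → ℕ → Bool
    verticals T h i = does (((▽ , i , h + c ∸ suc i) , (△ , i , h + c ∸ suc i)) ∈ₗ? T)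

    -- A tiling is sent to its vertical lozenges up to the center line. `Recover` gives injectivity,
    -- and `Fill` rebuilds a tiling from any pattern.
    SC-patterns : SC a a c ≡ length (patterns a c)
    SC-patterns = bijection-length (λ T → rows c (verticals T) (suc a))
      (Uniqueₚ.filter⁺ valid? (sublists-unique (allLozenges-unique a c))) (patterns-unique a c) into injective onto
      where
      valid? : ∀ T → Dec (IsTiling T × IsInvariant T)
      valid? T = isTiling? T ×-dec isInvariant? T
      valid⁻ : ∀ {T} → T ∈ filter valid? (sublists allLozenges) → T ∈ sublists allLozenges × IsTiling T × IsInvariant T
      valid⁻ = ∈-filter⁻ valid? {xs = sublists allLozenges}
      into : ∀ {T} → T ∈ filter valid? (sublists allLozenges) → rows c (verticals T) (suc a) ∈ patterns a c
      into T∈ with valid⁻ T∈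
      ... | T∈′ , covers , inv = patterns⁺ a c
        (record { bottom = C.bottom-row ; preds∈ = λ {h} h<a → strip⇒preds (h + c) (C.tiling-strip covers h<a) })
        (C.middle-row inv)
        where module C = Covering a c T∈′
      injective : ∀ {T T′} → T ∈ filter valid? (sublists allLozenges) → T′ ∈ filter valid? (sublists allLozenges) →
        rows c (verticals T) (suc a) ≡ rows c (verticals T′) (suc a) → T ≡ T′
      injective T∈ T′∈ eq with valid⁻ T∈ | valid⁻ T′∈
      ... | T∈′ , covers , inv | T′∈′ , covers′ , inv′ =
        Recover.same-tiling T∈′ T′∈′ covers covers′ inv inv′ (rows-injective c (suc a) eq)
      onto : ∀ {π} → π ∈ patterns a c →
        ∃ λ T → T ∈ filter valid? (sublists allLozenges) × rows c (verticals T) (suc a) ≡ π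
      onto {π} π∈ with patterns⁻ a c {entries c (suc a) π} (subst (_∈ patterns a c) (sym (rows-field c (suc a) π)) π∈)
      ... | il , mirror = tiling ,
        ∈-filter⁺ valid? tiling∈ (tiling-covers il mirror , tiling-invariant il mirror) ,
        trans (rows-cong c (suc a) (tiling-rows il mirror)) (rows-field c (suc a) π)
        where open Fill (entries c (suc a) π)

open import Data.Nat using (_+_; _*_; _≥_)
open IntegerSums using (patterns-even-even; patterns-even-odd; patterns-odd-even)
open Tilings using (SC-patterns)

theorem7p1 : (x y : ℕ) → x ≥ 1 → y ≥ 1 →
    (fromℕ (SC (2 * x) (2 * x) (2 * y)) ≡ PP x x y ℚ.* PP x x y) ×
    (fromℕ (SC (2 * x) (2 * x) (2 * y + 1)) ≡ PP x x y ℚ.* PP x x (y + 1)) ×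
    (fromℕ (SC (2 * x + 1) (2 * x + 1) (2 * y)) ≡ PP x (x + 1) y ℚ.* PP x (x + 1) y)
theorem7p1 x y _ _ =
  trans (cong fromℕ (SC-patterns (2 * x) (2 * y))) (patterns-even-even x y) ,
  trans (cong fromℕ (SC-patterns (2 * x) (2 * y + 1))) (patterns-even-odd x y) ,
  trans (cong fromℕ (SC-patterns (2 * x + 1) (2 * y))) (patterns-odd-even x y)
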